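{- Every commutative association scheme whose first eigenmatrix (for suitable orderings of relations $R_0,\dots,R_7$ and primitive idempotents) is \[ \begin{bmatrix} 1 & 1 & 1 & 1 & 63 & 63 & 63 & 63\\ 1 & i & -1 & -i & 21 & 21i & -21 & -21i\\ 1 & -1 & 1 & -1 & -9 & 9 & -9 & 9\\ 1 & -i & -1 & i & 21 & -21i & -21 & 21i\\ 1 & 1 & 1 & 1 & -1 & -1 & -1 & -1\\ 1 & i & -1 & -i & -3 & -3i & 3 & 3i\\ 1 & -1 & 1 & -1 & 7 & -7 & 7 & -7\\ 1 & -i & -1 & i & -3 & 3i & 3 & -3i \end{bmatrix} \] is isomorphic to Hoggar's scheme $\mathcal{H}$.
   Context: Let $\Phi=\{\varphi_j\}_{j=1}^{64}$ be unit vectors spanning Hoggar's $64$ equiangular lines in $\mathbb{C}^8$ (so $|\langle\varphi_i,\varphi_j\rangle|=1/3$ for $i\neq j$), and $\Omega=\Phi\cup i\Phi\cup(-\Phi)\cup(-i\Phi)$ ($256$ vectors). Hoggar's scheme $\mathcal{H}$ is $(\Omega,\{R_0,\dots,R_7\})$ with $(\mathbf{x},\mathbf{y})\in R_j$ iff $\langle\mathbf{x},\mathbf{y}\rangle=\alpha_j$, where $\alpha_0=1,\alpha_1=i,\alpha_2=-1,\alpha_3=-i,\alpha_4=1/3,\alpha_5=i/3,\alpha_6=-1/3,\alpha_7=-i/3$; it is a $7$-class association scheme. The first eigenmatrix $\mathsf{P}$ of a scheme is defined by $\mathsf{A}_j=\sum_i\mathsf{P}_{ij}\mathsf{E}_i$,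 where $\mathsf{A}_j$ is the adjacency matrix of $R_j$ and $\mathsf{E}_i$ are the primitive idempotents of the Bose–Mesner algebra (rows indexed by idempotents, columns by relations $R_0,\dots,R_7$). -}

module Defs where

open import Data.Nat using (ℕ; zero; suc)
open import Data.Bool using (Bool; true; false; if_then_else_; _xor_; _∧_)
open import Data.Product using (_×_; _,_; Σ; ∃; ∃-syntax)
open import Data.Fin using (Fin; zero; suc)
open import Data.Fin.Properties using (_≟_)
open import Data.Fin.Permutation using (Permutation′; _⟨$⟩ʳ_)
open import Data.Vec using (Vec; []; _∷_; lookup)
open import Data.List using (List; []; _∷_; foldr; map)
open import Data.Integer as ℤ using (ℤ; +_; -_)
open import Data.Rational as ℚ using (ℚ; 0ℚ; 1ℚ)
open import Relation.Nullary using (¬_)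
open import Relation.Nullary.Decidable using (⌊_⌋)
open import Relation.Binary.PropositionalEquality using (_≡_)
open import Function.Bundles using (_⇔_; _↔_; Inverse)

record ℤi : Set where
  constructor _+i_
  field
    re im : ℤ

record ℚi : Set where
  constructor _+iℚ_
  field
    re im : ℚ

module ZI where
  _+_ : ℤi → ℤi → ℤi
  (a +i b) + (c +i d) = (a ℤ.+ c) +i (b ℤ.+ d)

  _*_ : ℤi → ℤi → ℤi
  (a +i b) * (c +i d) = ((a ℤ.* c) ℤ.- (b ℤ.* d)) +i ((a ℤ.* d) ℤ.+ (b ℤ.* c))

  conj : ℤi → ℤi
  conj (a +i b) = a +i (- b)

  0ᶻ : ℤi
  0ᶻ = (+ 0) +i (+ 0)

module QI where
  _+_ : ℚi → ℚi → ℚi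
  (a +iℚ b) + (c +iℚ d) = (a ℚ.+ c) +iℚ (b ℚ.+ d)

  _*_ : ℚi → ℚi → ℚi
  (a +iℚ b) * (c +iℚ d) = ((a ℚ.* c) ℚ.- (b ℚ.* d)) +iℚ ((a ℚ.* d) ℚ.+ (b ℚ.* c))

  0q : ℚi
  0q = 0ℚ +iℚ 0ℚ

  1q : ℚi
  1q = 1ℚ +iℚ 0ℚ

  fromℤi : ℤi → ℚi
  fromℤi (a +i b) = (a ℚ./ 1) +iℚ (b ℚ./ 1)

open QI using (0q; 1q; fromℤi)

sumFin : (n : ℕ) → (Fin n → ℚi) → ℚi
sumFin zero    f = 0q
sumFin (suc n) f = f zero QI.+ sumFin n (λ i → f (suc i))

count : (n : ℕ) → (Fin n → Bool) → ℕ
count zero    p = 0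
count (suc n) p = (if p zero then 1 else 0) Data.Nat.+ count n (λ i → p (suc i))

Mat : ℕ → Set
Mat n = Fin n → Fin n → ℚi

_⊗_ : {n : ℕ} → Mat n → Mat n → Mat n
_⊗_ {n} M N x y = sumFin n (λ z → M x z QI.* N z y)

idMat : (n : ℕ) → Mat n
idMat n x y = if ⌊ x ≟ y ⌋ then 1q else 0q

zeroMat : (n : ℕ) → Mat n
zeroMat n x y = 0q

-- Association schemes with 8 relations R₀,…,R₇ on the point set Fin n.
-- A scheme is given by the function r with (x , y) ∈ R_j iff r x y ≡ j.

pCount : {n : ℕ} → (Fin n → Fin n → Fin 8) → Fin 8 → Fin 8 → Fin n → Fin n → ℕ
pCount {n} r i j x y = count n (λ z → ⌊ r x z ≟ i ⌋ ∧ ⌊ r z y ≟ j ⌋)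

record IsAssociationScheme (n : ℕ) (r : Fin n → Fin n → Fin 8) : Set where
  field
    nonempty     : ∀ i → ∃[ x ] ∃[ y ] r x y ≡ i
    diagonal     : ∀ x y → (r x y ≡ zero) ⇔ (x ≡ y)
    transposeRel : ∀ i → ∃[ i′ ] ∀ x y → (r y x ≡ i) ⇔ (r x y ≡ i′)
    intersection : ∀ i j k → ∃[ p ] ∀ x y → r x y ≡ k → pCount r i j x y ≡ p

IsCommutative : (n : ℕ) → (Fin n → Fin n → Fin 8) → Set
IsCommutative n r = ∀ i j x y → pCount r i j x y ≡ pCount r j i x y

adj : {n : ℕ} → (Fin n → Fin n → Fin 8) → Fin 8 → Mat n
adj r j x y = if ⌊ r x y ≟ j ⌋ then 1q else 0q

-- E₀,…,E₇ are the primitive idempotents of the Bose–Mesner algebra spanned by A₀,…,A₇: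
-- nonzero, pairwise orthogonal idempotents lying in the algebra and summing to I
-- (8 of them in the 8-dimensional algebra, hence exactly its primitive idempotents).
record ArePrimitiveIdempotents (n : ℕ) (A : Fin 8 → Mat n) (E : Fin 8 → Mat n) : Set where
  field
    inAlgebra  : ∀ i → Σ (Fin 8 → ℚi) λ c → ∀ x y → E i x y ≡ sumFin 8 (λ j → c j QI.* A j x y)
    idempotent : ∀ i x y → (E i ⊗ E i) x y ≡ E i x y
    orthogonal : ∀ i k → ¬ (i ≡ k) → ∀ x y → (E i ⊗ E k) x y ≡ 0q
    nonzero    : ∀ i → ¬ (∀ x y → E i x y ≡ 0q)
    sumToId    : ∀ x y → sumFin 8 (λ i → E i x y) ≡ idMat n x y

HasFirstEigenmatrix : (n : ℕ) → (Fin n → Fin n → Fin 8) → (Fin 8 → Fin 8 → ℤi) → Set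
HasFirstEigenmatrix n r P =
  Σ (Permutation′ 8) λ σ → Σ (Fin 8 → Mat n) λ E →
    ArePrimitiveIdempotents n (λ j → adj r (σ ⟨$⟩ʳ j)) E
    × (∀ j x y → adj r (σ ⟨$⟩ʳ j) x y ≡ sumFin 8 (λ i → fromℤi (P i j) QI.* E i x y))

-- The matrix P of the theorem (rows: idempotents, columns: relations)

r+ r- i+ i- : ℕ → ℤi
r+ k = (+ k) +i (+ 0)
r- k = (- (+ k)) +i (+ 0)
i+ k = (+ 0) +i (+ k)
i- k = (+ 0) +i (- (+ k))

Pvec : Vec (Vec ℤi 8) 8
Pvec =
    (r+ 1 ∷ r+ 1 ∷ r+ 1 ∷ r+ 1 ∷ r+ 63 ∷ r+ 63 ∷ r+ 63 ∷ r+ 63 ∷ [])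
  ∷ (r+ 1 ∷ i+ 1 ∷ r- 1 ∷ i- 1 ∷ r+ 21 ∷ i+ 21 ∷ r- 21 ∷ i- 21 ∷ [])
  ∷ (r+ 1 ∷ r- 1 ∷ r+ 1 ∷ r- 1 ∷ r- 9 ∷ r+ 9 ∷ r- 9 ∷ r+ 9 ∷ [])
  ∷ (r+ 1 ∷ i- 1 ∷ r- 1 ∷ i+ 1 ∷ r+ 21 ∷ i- 21 ∷ r- 21 ∷ i+ 21 ∷ [])
  ∷ (r+ 1 ∷ r+ 1 ∷ r+ 1 ∷ r+ 1 ∷ r- 1 ∷ r- 1 ∷ r- 1 ∷ r- 1 ∷ [])
  ∷ (r+ 1 ∷ i+ 1 ∷ r- 1 ∷ i- 1 ∷ r- 3 ∷ i- 3 ∷ r+ 3 ∷ i+ 3 ∷ [])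
  ∷ (r+ 1 ∷ r- 1 ∷ r+ 1 ∷ r- 1 ∷ r+ 7 ∷ r- 7 ∷ r+ 7 ∷ r- 7 ∷ [])
  ∷ (r+ 1 ∷ i- 1 ∷ r- 1 ∷ i+ 1 ∷ r- 3 ∷ i+ 3 ∷ r+ 3 ∷ i- 3 ∷ [])
  ∷ []

Pmat : Fin 8 → Fin 8 → ℤi
Pmat i j = lookup (lookup Pvec i) j

-- Hoggar's 64 lines in ℂ⁸ and Hoggar's scheme ℋ.
-- Coordinates of ℂ⁸ are indexed by 𝔽₂³ = Bool × Bool × Bool.  The 64 lines are the
-- orbit of a fiducial vector v under the Heisenberg–Weyl group of 𝔽₂³:
--   φ_{a,b}(x) = (-1)^{b·x} v(x + a).
-- All vectors are stored with entries in ℤ[i] and squared norm 6, i.e. the unit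
-- vector is (1/√6)·φ; accordingly inner products are 6·α_j.

P3 : Set
P3 = Bool × Bool × Bool

pts : List P3
pts = Data.List.concatMap (λ a → Data.List.concatMap (λ b → map (λ c → (a , b , c)) (false ∷ true ∷ [])) (false ∷ true ∷ [])) (false ∷ true ∷ [])

_⊕_ : P3 → P3 → P3
(a₁ , a₂ , a₃) ⊕ (b₁ , b₂ , b₃) = (a₁ xor b₁ , a₂ xor b₂ , a₃ xor b₃)

dot3 : P3 → P3 → Bool
dot3 (a₁ , a₂ , a₃) (b₁ , b₂ , b₃) = ((a₁ ∧ b₁) xor (a₂ ∧ b₂)) xor (a₃ ∧ b₃)

fiducial : P3 → ℤi
fiducial (false , false , false) = r+ 1
fiducial (false , false , true ) = r+ 1
fiducial (false , true  , false) = r+ 0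
fiducial (false , true  , true ) = r+ 0
fiducial (true  , false , false) = r+ 1
fiducial (true  , false , true ) = i+ 1
fiducial (true  , true  , false) = (+ 1) +i (+ 1)
fiducial (true  , true  , true ) = r+ 0

Line : Set
Line = P3 × P3

hoggarVec : Line → P3 → ℤi
hoggarVec (a , b) x = (if dot3 b x then r- 1 else r+ 1) ZI.* fiducial (x ⊕ a)

ipow : Fin 4 → ℤi
ipow zero = r+ 1
ipow (suc zero) = i+ 1
ipow (suc (suc zero)) = r- 1
ipow (suc (suc (suc zero))) = i- 1

-- Ω = Φ ∪ iΦ ∪ -Φ ∪ -iΦ, indexed by (power of i , line)
ΩIdx : Set
ΩIdx = Fin 4 × Line

ωVec : ΩIdx → P3 → ℤi
ωVec (p , l) x = ipow p ZI.* hoggarVec l x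

inner : (P3 → ℤi) → (P3 → ℤi) → ℤi
inner u w = foldr (λ x s → (ZI.conj (u x) ZI.* w x) ZI.+ s) ZI.0ᶻ pts

-- 6·α_j for α = (1, i, -1, -i, 1/3, i/3, -1/3, -i/3)
α6 : Fin 8 → ℤi
α6 zero = r+ 6
α6 (suc zero) = i+ 6
α6 (suc (suc zero)) = r- 6
α6 (suc (suc (suc zero))) = i- 6
α6 (suc (suc (suc (suc zero)))) = r+ 2
α6 (suc (suc (suc (suc (suc zero))))) = i+ 2
α6 (suc (suc (suc (suc (suc (suc zero)))))) = r- 2
α6 (suc (suc (suc (suc (suc (suc (suc zero))))))) = i- 2

HoggarRel : ΩIdx → ΩIdx → Fin 8 → Set
HoggarRel u w j = inner (ωVec u) (ωVec w) ≡ α6 j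

IsoToHoggar : (n : ℕ) → (Fin n → Fin n → Fin 8) → Set
IsoToHoggar n r =
  Σ (Fin n ↔ ΩIdx) λ φ → Σ (Permutation′ 8) λ τ →
    ∀ x y j → (r x y ≡ τ ⟨$⟩ʳ j) ⇔ HoggarRel (Inverse.to φ x) (Inverse.to φ y) j

{-# OPTIONS --safe #-}

-- The Gram matrix G = (3⟨x,y⟩) is 96 times one primitive idempotent and its entrywise square is 64 times another.
-- Hence the points are unit vectors of an 8-dimensional lattice over ℤ[i] (rescaled to norm 3) that carry a
-- projective 2-design: Σᵤ ⟨a,u⟩⟨b,u⟩⟨u,c⟩⟨u,d⟩ is proportional to ⟨a,c⟩⟨b,d⟩ + ⟨a,d⟩⟨b,c⟩.  For a lattice vector w of
-- norm 3 the numbers |⟨w,u⟩|² are odd, at most 9 and sums of two squares, i.e. 1, 5 or 9, and the first moments of the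
-- design force the value 9, so w is a point.  Thus the points are exactly the lattice vectors of norm 3, and it is
-- enough to find eight points whose Gram matrix is that of a basis of Hoggar's lattice.  They are found one at a time:
-- an intersection number provides a new point with prescribed inner products with two known vectors, and its other
-- inner products are restricted because those with all known lattice vectors of norm 3 must be 1 or 3 times a power of i.
module Submission where

open import Defs
open import Algebra.Bundles using (CommutativeRing)
import Algebra.Properties.CommutativeSemigroup as CommutativeSemigroupProperties
import Algebra.Properties.Semiring.Sum as SemiringSum
import Algebra.Solver.Ring.NaturalCoefficients.Default as RingSolver
open import Algebra.Structures using (IsCommutativeRing)
open import Data.Bool using (Bool; true; false; if_then_else_)
import Data.Bool.Properties as Boolₚ
open import Data.Empty using (⊥)
open import Data.Fin using (Fin; zero; suc; toℕ)
open import Data.Fin.Patterns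
open import Data.Fin.Permutation using (Permutation′; _⟨$⟩ʳ_; _⟨$⟩ˡ_; inverseʳ; inverseˡ)
open import Data.Fin.Properties using (_≟_; all?; any?; pigeonhole; *↔×; 2↔Bool)
open import Data.Integer as ℤ using (ℤ; +_; -_; -[1+_]; 0ℤ)
open import Data.Integer.DivMod using (_/ℕ_)
import Data.Integer.Properties as ℤₚ
open import Data.Integer.Tactic.RingSolver using () renaming (solve-∀ to solveℤ)
open import Data.List using (List; []; _∷_; _++_; map; foldr; length; zipWith; filter; cartesianProductWith)
open import Data.List.Membership.DecPropositional as DecMembership using ()
open import Data.List.Membership.Propositional using (_∈_; _∉_)
open import Data.List.Membership.Propositional.Properties using (∈-filter⁺; ∈-cartesianProductWith⁺; ∈-++⁺ˡ; ∈-++⁺ʳ)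
open import Data.List.Properties using () renaming (≡-dec to List-≡-dec)
open import Data.List.Relation.Unary.All as All using (All; []; _∷_)
import Data.List.Relation.Unary.All.Properties as Allₚ
open import Data.List.Relation.Unary.Any using (Any; here; there)
open import Data.Nat as ℕ using (ℕ; zero; suc)
open import Data.Nat.DivMod using (_/_; _%_)
import Data.Nat.Properties as ℕₚ
open import Data.Product using (_×_; _,_; proj₁; proj₂; ∃-syntax)
open import Data.Product.Function.NonDependent.Propositional using (_×-↔_)
open import Data.Product.Properties using () renaming (≡-dec to ×-≡-dec)
open import Data.Rational as ℚ using (ℚ; 0ℚ; 1ℚ)
import Data.Rational.Properties as ℚₚ
import Data.Rational.Unnormalised as ℚᵘ
import Data.Rational.Unnormalised.Properties as ℚᵘₚ
open import Data.Sum using (_⊎_; inj₁; inj₂; [_,_]′)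
open import Data.Unit using (⊤; tt)
open import Function using (_∘_)
open import Function.Bundles using (_↔_; Inverse; Equivalence; mk⇔; mk↔ₛ′)
open import Function.Construct.Composition using (_↔-∘_)
open import Function.Construct.Identity using (↔-id)
open import Level using (0ℓ)
open import Relation.Binary.Definitions using (DecidableEquality)
open import Relation.Binary.PropositionalEquality using (_≡_; refl; sym; trans; cong; cong₂; subst; isEquivalence; module ≡-Reasoning)
open import Relation.Nullary using (Dec; yes; no; ¬_; contradiction)
open import Relation.Nullary.Decidable using (⌊_⌋; map′; _×-dec_; _⊎-dec_; _→-dec_; ¬?; from-yes; dec⇒maybe)
open import Tactic.RingSolver using (solve-∀)
import Tactic.RingSolver.Core.AlmostCommutativeRing as ACR

open ZI using (conj) renaming (_+_ to _⊞_; _*_ to _⊠_; 0ᶻ to 0ᵢ)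
open QI using (0q; 1q; fromℤi) renaming (_+_ to _⊕q_; _*_ to _⊗q_)
open ℤi

-- `G` has trace 256·3 = 96·8 and its entrywise square has trace 256·9 = 64·36, so the ranks are 8
-- and 36 = dim Sym²(ℂ⁸): the squares u⊗u form a tight frame of the whole symmetric square, which is
-- the design property. The proof does not speak of ranks. It forms the difference `D` of the two
-- sides of the design identity and contracts Σ |D|² with the reproducing property of `G` until only
-- Σ D(v,v,v,v) and Σ D(a,b,a,b) are left; both vanish by counting. For a lattice vector of norm 3,
-- oddness leaves the value 5 possible, hence the polynomial (t - 1)(t - 5): its sum is 576 - 6·288
-- + 5·256 = 128 = 4·32, exactly the contribution of the four multiples of one point by powers of i,
-- where t = 9. The obstacle afterwards is that intersection numbers control only pairs: a new point
-- comes with two known inner products, and the others are a matter of cases. The closure of the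
-- points under lattice vectors of norm 3 keeps the cases few, and it lets every step pass to a more
-- convenient set of points.

-- The ring of Gaussian integers.

1ᵢ : ℤi
1ᵢ = r+ 1

neg : ℤi → ℤi
neg (a +i b) = (- a) +i (- b)

infix 4 _≟ᵢ_
_≟ᵢ_ : DecidableEquality ℤi
(a +i b) ≟ᵢ (c +i d) =
  map′ (λ { (refl , refl) → refl }) (λ { refl → refl , refl }) ((a ℤ.≟ c) ×-dec (b ℤ.≟ d))

private
  dist-re : ∀ a b c d e f → a ℤ.* (c ℤ.+ e) ℤ.- b ℤ.* (d ℤ.+ f) ≡ (a ℤ.* c ℤ.- b ℤ.* d) ℤ.+ (a ℤ.* e ℤ.- b ℤ.* f)
  dist-re = solveℤ
  dist-im : ∀ a b c d e f → a ℤ.* (d ℤ.+ f) ℤ.+ b ℤ.* (c ℤ.+ e) ≡ (a ℤ.* d ℤ.+ b ℤ.* c) ℤ.+ (a ℤ.* f ℤ.+ b ℤ.* e)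
  dist-im = solveℤ
  assoc-re : ∀ a b c d e f → (a ℤ.* c ℤ.- b ℤ.* d) ℤ.* e ℤ.- (a ℤ.* d ℤ.+ b ℤ.* c) ℤ.* f ≡ a ℤ.* (c ℤ.* e ℤ.- d ℤ.* f) ℤ.- b ℤ.* (c ℤ.* f ℤ.+ d ℤ.* e)
  assoc-re = solveℤ
  assoc-im : ∀ a b c d e f → (a ℤ.* c ℤ.- b ℤ.* d) ℤ.* f ℤ.+ (a ℤ.* d ℤ.+ b ℤ.* c) ℤ.* e ≡ a ℤ.* (c ℤ.* f ℤ.+ d ℤ.* e) ℤ.+ b ℤ.* (c ℤ.* e ℤ.- d ℤ.* f)
  assoc-im = solveℤ
  comm-re : ∀ a b c d → a ℤ.* c ℤ.- b ℤ.* d ≡ c ℤ.* a ℤ.- d ℤ.* b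
  comm-re = solveℤ
  comm-im : ∀ a b c d → a ℤ.* d ℤ.+ b ℤ.* c ≡ c ℤ.* b ℤ.+ d ℤ.* a
  comm-im = solveℤ
  one-re : ∀ a b → (+ 1) ℤ.* a ℤ.- (+ 0) ℤ.* b ≡ a
  one-re = solveℤ
  one-im : ∀ a b → (+ 1) ℤ.* b ℤ.+ (+ 0) ℤ.* a ≡ b
  one-im = solveℤ

⊞-comm : ∀ x y → x ⊞ y ≡ y ⊞ x
⊞-comm (a +i b) (c +i d) = cong₂ _+i_ (ℤₚ.+-comm a c) (ℤₚ.+-comm b d)
⊠-comm : ∀ x y → x ⊠ y ≡ y ⊠ x
⊠-comm (a +i b) (c +i d) = cong₂ _+i_ (comm-re a b c d) (comm-im a b c d)
⊞-identityˡ : ∀ x → 0ᵢ ⊞ x ≡ x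
⊞-identityˡ (a +i b) = cong₂ _+i_ (ℤₚ.+-identityˡ a) (ℤₚ.+-identityˡ b)
⊠-identityˡ : ∀ x → 1ᵢ ⊠ x ≡ x
⊠-identityˡ (a +i b) = cong₂ _+i_ (one-re a b) (one-im a b)
neg-inverseˡ : ∀ x → neg x ⊞ x ≡ 0ᵢ
neg-inverseˡ (a +i b) = cong₂ _+i_ (ℤₚ.+-inverseˡ a) (ℤₚ.+-inverseˡ b)
⊠-distribˡ : ∀ x y z → x ⊠ (y ⊞ z) ≡ (x ⊠ y) ⊞ (x ⊠ z)
⊠-distribˡ (a +i b) (c +i d) (e +i f) = cong₂ _+i_ (dist-re a b c d e f) (dist-im a b c d e f)

ℤi-isCommutativeRing : IsCommutativeRing _≡_ _⊞_ _⊠_ neg 0ᵢ 1ᵢ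
ℤi-isCommutativeRing = record
  { isRing = record
    { +-isAbelianGroup = record
      { isGroup = record
        { isMonoid = record
          { isSemigroup = record
            { isMagma = record { isEquivalence = isEquivalence ; ∙-cong = cong₂ _⊞_ }
            ; assoc = λ { (a +i b) (c +i d) (e +i f) → cong₂ _+i_ (ℤₚ.+-assoc a c e) (ℤₚ.+-assoc b d f) } }
          ; identity = ⊞-identityˡ , λ x → trans (⊞-comm x _) (⊞-identityˡ x) }
        ; inverse = neg-inverseˡ , λ x → trans (⊞-comm x _) (neg-inverseˡ x)
        ; ⁻¹-cong = cong neg }
      ; comm = ⊞-comm }
    ; *-cong = cong₂ _⊠_
    ; *-assoc = λ { (a +i b) (c +i d) (e +i f) → cong₂ _+i_ (assoc-re a b c d e f) (assoc-im a b c d e f) }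
    ; *-identity = ⊠-identityˡ , λ x → trans (⊠-comm x _) (⊠-identityˡ x)
    ; distrib = ⊠-distribˡ , λ x y z → trans (⊠-comm (y ⊞ z) x) (trans (⊠-distribˡ x y z) (cong₂ _⊞_ (⊠-comm x y) (⊠-comm x z)))
    }
  ; *-comm = ⊠-comm }

ℤi-ring : CommutativeRing 0ℓ 0ℓ
ℤi-ring = record { isCommutativeRing = ℤi-isCommutativeRing }

ℤi-solver : ACR.AlmostCommutativeRing 0ℓ 0ℓ
ℤi-solver = ACR.fromCommutativeRing ℤi-ring (λ x → dec⇒maybe (0ᵢ ≟ᵢ x))

-- Finite sums in a commutative ring.

module FiniteSum (R : CommutativeRing 0ℓ 0ℓ) where
  open CommutativeRing R hiding (zero) renaming (refl to ≈-refl; sym to ≈-sym; trans to ≈-trans)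
  open SemiringSum semiring

  -- Opaque, so that the summand can be inferred from the sum.
  opaque
    ∑ : ∀ {n} → (Fin n → Carrier) → Carrier
    ∑ = sum

    ∑≡sum : ∀ {n} (f : Fin n → Carrier) → ∑ f ≡ sum f
    ∑≡sum f = refl

    ∑-cong : ∀ {n} {f g : Fin n → Carrier} → (∀ i → f i ≈ g i) → ∑ f ≈ ∑ g
    ∑-cong = sum-cong-≋

    ∑-swap : ∀ {m n} {f : Fin m → Fin n → Carrier} → ∑ (λ i → ∑ (f i)) ≈ ∑ (λ j → ∑ (λ i → f i j))
    ∑-swap {f = f} = ∑-comm f

    ∑-+ : ∀ {n} {f g : Fin n → Carrier} → ∑ (λ i → f i + g i) ≈ ∑ f + ∑ g
    ∑-+ {f = f} {g} = ∑-distrib-+ f g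

    *-∑ : ∀ {n} {x} {f : Fin n → Carrier} → x * ∑ f ≈ ∑ (λ i → x * f i)
    *-∑ {x = x} {f} = *-distribˡ-sum x f

    ∑-* : ∀ {n} {x} {f : Fin n → Carrier} → ∑ f * x ≈ ∑ (λ i → f i * x)
    ∑-* {x = x} {f} = *-distribʳ-sum x f

    ∑-0 : ∀ {n} {f : Fin n → Carrier} → (∀ i → f i ≈ 0#) → ∑ f ≈ 0#
    ∑-0 {n} p = ≈-trans (sum-cong-≋ p) (sum-replicate-zero n)

    ∑-single : ∀ {n} (a : Fin n) {f : Fin n → Carrier} → (∀ i → ¬ (a ≡ i) → f i ≈ 0#) → ∑ f ≈ f a
    ∑-single zero p = ≈-trans (+-congˡ (∑-0 (λ i → p (suc i) λ ()))) (+-identityʳ _)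
    ∑-single (suc a) {f} p =
      ≈-trans (+-cong (p zero λ ()) (∑-single a {f ∘ suc} λ i ne → p (suc i) λ { refl → ne refl }))
              (+-identityˡ _)

  ∑-product : ∀ {m n} {f : Fin m → Carrier} {g : Fin n → Carrier} →
              ∑ f * ∑ g ≈ ∑ (λ i → ∑ (λ k → f i * g k))
  ∑-product = ≈-trans ∑-* (∑-cong (λ i → *-∑))

-- The ring ℚ(i).

ℚ-solver : ACR.AlmostCommutativeRing 0ℓ 0ℓ
ℚ-solver = ACR.fromCommutativeRing ℚₚ.+-*-commutativeRing (λ x → dec⇒maybe (0ℚ ℚ.≟ x))

negq : ℚi → ℚi
negq (a +iℚ b) = (ℚ.- a) +iℚ (ℚ.- b)

private
  q-dist-re : ∀ a b c d e f → a ℚ.* (c ℚ.+ e) ℚ.- b ℚ.* (d ℚ.+ f) ≡ (a ℚ.* c ℚ.- b ℚ.* d) ℚ.+ (a ℚ.* e ℚ.- b ℚ.* f)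
  q-dist-re = solve-∀ ℚ-solver
  q-dist-im : ∀ a b c d e f → a ℚ.* (d ℚ.+ f) ℚ.+ b ℚ.* (c ℚ.+ e) ≡ (a ℚ.* d ℚ.+ b ℚ.* c) ℚ.+ (a ℚ.* f ℚ.+ b ℚ.* e)
  q-dist-im = solve-∀ ℚ-solver
  q-assoc-re : ∀ a b c d e f → (a ℚ.* c ℚ.- b ℚ.* d) ℚ.* e ℚ.- (a ℚ.* d ℚ.+ b ℚ.* c) ℚ.* f ≡ a ℚ.* (c ℚ.* e ℚ.- d ℚ.* f) ℚ.- b ℚ.* (c ℚ.* f ℚ.+ d ℚ.* e)
  q-assoc-re = solve-∀ ℚ-solver
  q-assoc-im : ∀ a b c d e f → (a ℚ.* c ℚ.- b ℚ.* d) ℚ.* f ℚ.+ (a ℚ.* d ℚ.+ b ℚ.* c) ℚ.* e ≡ a ℚ.* (c ℚ.* f ℚ.+ d ℚ.* e) ℚ.+ b ℚ.* (c ℚ.* e ℚ.- d ℚ.* f)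
  q-assoc-im = solve-∀ ℚ-solver
  q-comm-re : ∀ a b c d → a ℚ.* c ℚ.- b ℚ.* d ≡ c ℚ.* a ℚ.- d ℚ.* b
  q-comm-re = solve-∀ ℚ-solver
  q-comm-im : ∀ a b c d → a ℚ.* d ℚ.+ b ℚ.* c ≡ c ℚ.* b ℚ.+ d ℚ.* a
  q-comm-im = solve-∀ ℚ-solver
  q-one-re : ∀ a b → 1ℚ ℚ.* a ℚ.- 0ℚ ℚ.* b ≡ a
  q-one-re = solve-∀ ℚ-solver
  q-one-im : ∀ a b → 1ℚ ℚ.* b ℚ.+ 0ℚ ℚ.* a ≡ b
  q-one-im = solve-∀ ℚ-solver

  ⊕-comm : ∀ x y → x ⊕q y ≡ y ⊕q x
  ⊕-comm (a +iℚ b) (c +iℚ d) = cong₂ _+iℚ_ (ℚₚ.+-comm a c) (ℚₚ.+-comm b d)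
  ⊗-comm : ∀ x y → x ⊗q y ≡ y ⊗q x
  ⊗-comm (a +iℚ b) (c +iℚ d) = cong₂ _+iℚ_ (q-comm-re a b c d) (q-comm-im a b c d)
  ⊕-identityˡ : ∀ x → 0q ⊕q x ≡ x
  ⊕-identityˡ (a +iℚ b) = cong₂ _+iℚ_ (ℚₚ.+-identityˡ a) (ℚₚ.+-identityˡ b)
  ⊗-identityˡ : ∀ x → 1q ⊗q x ≡ x
  ⊗-identityˡ (a +iℚ b) = cong₂ _+iℚ_ (q-one-re a b) (q-one-im a b)
  negq-inverseˡ : ∀ x → negq x ⊕q x ≡ 0q
  negq-inverseˡ (a +iℚ b) = cong₂ _+iℚ_ (ℚₚ.+-inverseˡ a) (ℚₚ.+-inverseˡ b)
  ⊗-distribˡ : ∀ x y z → x ⊗q (y ⊕q z) ≡ (x ⊗q y) ⊕q (x ⊗q z)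
  ⊗-distribˡ (a +iℚ b) (c +iℚ d) (e +iℚ f) = cong₂ _+iℚ_ (q-dist-re a b c d e f) (q-dist-im a b c d e f)

ℚi-isCommutativeRing : IsCommutativeRing _≡_ _⊕q_ _⊗q_ negq 0q 1q
ℚi-isCommutativeRing = record
  { isRing = record
    { +-isAbelianGroup = record
      { isGroup = record
        { isMonoid = record
          { isSemigroup = record
            { isMagma = record { isEquivalence = isEquivalence ; ∙-cong = cong₂ _⊕q_ }
            ; assoc = λ { (a +iℚ b) (c +iℚ d) (e +iℚ f) → cong₂ _+iℚ_ (ℚₚ.+-assoc a c e) (ℚₚ.+-assoc b d f) } }
          ; identity = ⊕-identityˡ , λ x → trans (⊕-comm x _) (⊕-identityˡ x) }
        ; inverse = negq-inverseˡ , λ x → trans (⊕-comm x _) (negq-inverseˡ x)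
        ; ⁻¹-cong = cong negq }
      ; comm = ⊕-comm }
    ; *-cong = cong₂ _⊗q_
    ; *-assoc = λ { (a +iℚ b) (c +iℚ d) (e +iℚ f) → cong₂ _+iℚ_ (q-assoc-re a b c d e f) (q-assoc-im a b c d e f) }
    ; *-identity = ⊗-identityˡ , λ x → trans (⊗-comm x _) (⊗-identityˡ x)
    ; distrib = ⊗-distribˡ , λ x y z → trans (⊗-comm (y ⊕q z) x) (trans (⊗-distribˡ x y z) (cong₂ _⊕q_ (⊗-comm x y) (⊗-comm x z)))
    }
  ; *-comm = ⊗-comm }

ℚi-ring : CommutativeRing 0ℓ 0ℓ
ℚi-ring = record { isCommutativeRing = ℚi-isCommutativeRing }

module ℚΣ = FiniteSum ℚi-ring
module ℤΣ = FiniteSum ℤi-ring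
open SemiringSum (CommutativeRing.semiring ℤi-ring) public using () renaming (sum to sumᵢ)

-- The embedding of ℤ[i] into ℚ(i).

private
  toℚᵘ-/1 : ∀ a → ℚ.toℚᵘ (a ℚ./ 1) ℚᵘ.≃ ℚᵘ.mkℚᵘ a 0
  toℚᵘ-/1 a = ℚₚ.toℚᵘ-fromℚᵘ (ℚᵘ.mkℚᵘ a 0)

-- Rationals are kept in lowest terms, so the embedding of ℤ is compared among unnormalised
-- fractions, where `a ℚ./ 1` is simply a over 1.
/1-+ : ∀ a b → (a ℤ.+ b) ℚ./ 1 ≡ (a ℚ./ 1) ℚ.+ (b ℚ./ 1)
/1-+ a b = ℚₚ.toℚᵘ-injective (ℚᵘₚ.≃-trans (toℚᵘ-/1 (a ℤ.+ b)) (ℚᵘₚ.≃-sym (ℚᵘₚ.≃-trans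
  (ℚₚ.toℚᵘ-homo-+ (a ℚ./ 1) (b ℚ./ 1)) (ℚᵘₚ.≃-trans (ℚᵘₚ.+-cong (toℚᵘ-/1 a) (toℚᵘ-/1 b))
   (ℚᵘ.*≡* (cong (ℤ._* ℤ.1ℤ) (cong₂ ℤ._+_ (ℤₚ.*-identityʳ a) (ℤₚ.*-identityʳ b))))))))

/1-* : ∀ a b → (a ℤ.* b) ℚ./ 1 ≡ (a ℚ./ 1) ℚ.* (b ℚ./ 1)
/1-* a b = ℚₚ.toℚᵘ-injective (ℚᵘₚ.≃-trans (toℚᵘ-/1 (a ℤ.* b)) (ℚᵘₚ.≃-sym (ℚᵘₚ.≃-trans
  (ℚₚ.toℚᵘ-homo-* (a ℚ./ 1) (b ℚ./ 1)) (ℚᵘₚ.*-cong (toℚᵘ-/1 a) (toℚᵘ-/1 b)))))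

/1-neg : ∀ a → (- a) ℚ./ 1 ≡ ℚ.- (a ℚ./ 1)
/1-neg a = ℚₚ.toℚᵘ-injective (ℚᵘₚ.≃-trans (toℚᵘ-/1 (- a)) (ℚᵘₚ.≃-sym (ℚᵘₚ.≃-trans
  (ℚₚ.toℚᵘ-homo‿- (a ℚ./ 1)) (ℚᵘₚ.-‿cong (toℚᵘ-/1 a)))))

/1-injective : ∀ a b → a ℚ./ 1 ≡ b ℚ./ 1 → a ≡ b
/1-injective a b eq with ℚᵘₚ.≃-trans (ℚᵘₚ.≃-sym (toℚᵘ-/1 a)) (ℚᵘₚ.≃-trans (ℚᵘₚ.≃-reflexive (cong ℚ.toℚᵘ eq)) (toℚᵘ-/1 b))
... | ℚᵘ.*≡* e = trans (sym (ℤₚ.*-identityʳ a)) (trans e (ℤₚ.*-identityʳ b))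

fromℤi-+ : ∀ x y → fromℤi (x ⊞ y) ≡ fromℤi x ⊕q fromℤi y
fromℤi-+ (a +i b) (c +i d) = cong₂ _+iℚ_ (/1-+ a c) (/1-+ b d)

fromℤi-* : ∀ x y → fromℤi (x ⊠ y) ≡ fromℤi x ⊗q fromℤi y
fromℤi-* (a +i b) (c +i d) = cong₂ _+iℚ_
  (trans (/1-+ (a ℤ.* c) (- (b ℤ.* d))) (cong₂ ℚ._+_ (/1-* a c) (trans (/1-neg (b ℤ.* d)) (cong ℚ.-_ (/1-* b d)))))
  (trans (/1-+ (a ℤ.* d) (b ℤ.* c)) (cong₂ ℚ._+_ (/1-* a d) (/1-* b c)))

fromℤi-injective : ∀ x y → fromℤi x ≡ fromℤi y → x ≡ y
fromℤi-injective (a +i b) (c +i d) eq = cong₂ _+i_ (/1-injective a c (cong ℚi.re eq)) (/1-injective b d (cong ℚi.im eq))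

opaque
  unfolding FiniteSum.∑

  fromℤi-∑ : ∀ {n} (f : Fin n → ℤi) → fromℤi (ℤΣ.∑ f) ≡ ℚΣ.∑ (λ i → fromℤi (f i))
  fromℤi-∑ {zero} f = refl
  fromℤi-∑ {suc n} f = trans (fromℤi-+ (f zero) _) (cong (fromℤi (f zero) ⊕q_) (fromℤi-∑ (f ∘ suc)))

  sumFin≡∑ : ∀ n (f : Fin n → ℚi) → sumFin n f ≡ ℚΣ.∑ f
  sumFin≡∑ zero f = refl
  sumFin≡∑ (suc n) f = cong (f zero ⊕q_) (sumFin≡∑ n (f ∘ suc))

-- Matrix products in the Bose-Mesner algebra through eigenvalues.

module Spectral (R : CommutativeRing 0ℓ 0ℓ) where
  open CommutativeRing R hiding (zero) renaming (refl to ≈-refl; sym to ≈-sym; trans to ≈-trans)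
  open FiniteSum R
  open import Relation.Binary.Reasoning.Setoid setoid

  module Decomposition {m n : ℕ} (s : Fin n → Fin n → Fin m) (A E : Fin m → Fin n → Fin n → Carrier) (P : Fin m → Fin m → Carrier)
    (A-on : ∀ x y → A (s x y) x y ≈ 1#)
    (A-off : ∀ x y j → ¬ (s x y ≡ j) → A j x y ≈ 0#)
    (spectral : ∀ j x y → A j x y ≈ ∑ (λ i → P i j * E i x y))
    (idempotent : ∀ i x y → ∑ (λ z → E i x z * E i z y) ≈ E i x y)
    (orthogonal : ∀ i k → ¬ (i ≡ k) → ∀ x y → ∑ (λ z → E i x z * E k z y) ≈ 0#) where

    eigenvalue : (Fin m → Carrier) → Fin m → Carrier
    eigenvalue f i = ∑ (λ j → f j * P i j)

    decompose : ∀ f x y → f (s x y) ≈ ∑ (λ i → eigenvalue f i * E i x y)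
    decompose f x y = begin
      f (s x y)
        ≈⟨ ≈-trans (*-congˡ (A-on x y)) (*-identityʳ _) ⟨
      f (s x y) * A (s x y) x y
        ≈⟨ ∑-single (s x y) (λ j ne → ≈-trans (*-congˡ (A-off x y j ne)) (zeroʳ _)) ⟨
      ∑ (λ j → f j * A j x y)
        ≈⟨ ∑-cong (λ j → ≈-trans (*-congˡ (spectral j x y)) *-∑) ⟩
      ∑ (λ j → ∑ (λ i → f j * (P i j * E i x y)))
        ≈⟨ ∑-swap ⟩
      ∑ (λ i → ∑ (λ j → f j * (P i j * E i x y)))
        ≈⟨ ∑-cong (λ i → ≈-trans (∑-*) (∑-cong λ j → *-assoc _ _ _)) ⟨
      ∑ (λ i → eigenvalue f i * E i x y) ∎

    private
      interchange : ∀ a b c d → (a * b) * (c * d) ≈ (a * c) * (b * d)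
      interchange = CommutativeSemigroupProperties.interchange *-commutativeSemigroup

    -- Orthogonal idempotents turn the matrix product into the pointwise product of eigenvalues, so
    -- an identity between n × n matrices reduces to one scalar identity per idempotent.
    convolution : ∀ f g h → (∀ i → eigenvalue f i * eigenvalue g i ≈ eigenvalue h i) →
                  ∀ x y → ∑ (λ z → f (s x z) * g (s z y)) ≈ h (s x y)
    convolution f g h eq x y = begin
      ∑ (λ z → f (s x z) * g (s z y))
        ≈⟨ ∑-cong (λ z → ≈-trans (*-cong (decompose f x z) (decompose g z y)) ∑-product) ⟩
      ∑ (λ z → ∑ (λ i → ∑ (λ k → (f̂ i * E i x z) * (ĝ k * E k z y))))
        ≈⟨ ≈-trans ∑-swap (∑-cong λ i → ∑-swap) ⟩
      ∑ (λ i → ∑ (λ k → ∑ (λ z → (f̂ i * E i x z) * (ĝ k * E k z y))))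
        ≈⟨ ∑-cong (λ i → ∑-cong λ k → ≈-trans (∑-cong λ z → interchange _ _ _ _)
             (≈-sym *-∑)) ⟩
      ∑ (λ i → ∑ (λ k → (f̂ i * ĝ k) * ∑ (λ z → E i x z * E k z y)))
        ≈⟨ ∑-cong (λ i → ∑-single i λ k ne → ≈-trans (*-congˡ (orthogonal i k ne x y)) (zeroʳ _)) ⟩
      ∑ (λ i → (f̂ i * ĝ i) * ∑ (λ z → E i x z * E i z y))
        ≈⟨ ∑-cong (λ i → *-cong (eq i) (idempotent i x y)) ⟩
      ∑ (λ i → eigenvalue h i * E i x y)
        ≈⟨ decompose h x y ⟨
      h (s x y) ∎
      where
      f̂ = eigenvalue f
      ĝ = eigenvalue g

-- Written with the transparent `sumᵢ` instead of the opaque `∑`, so that statements about `Pmat`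
-- can be decided by evaluation.
eigenvalue : (Fin 8 → Fin 8 → ℤi) → (Fin 8 → ℤi) → Fin 8 → ℤi
eigenvalue P f i = sumᵢ (λ j → f j ⊠ P i j)

module Scheme (n : ℕ) (r : Fin n → Fin n → Fin 8) (P : Fin 8 → Fin 8 → ℤi)
  (σ : Permutation′ 8) (E : Fin 8 → Mat n)
  (prim : ArePrimitiveIdempotents n (λ j → adj r (σ ⟨$⟩ʳ j)) E)
  (spectral : ∀ j x y → adj r (σ ⟨$⟩ʳ j) x y ≡ sumFin 8 (λ i → fromℤi (P i j) ⊗q E i x y)) where
  open ArePrimitiveIdempotents prim

  -- The relations numbered as the columns of `P`; `r` carries the scheme's own numbering.
  s : Fin n → Fin n → Fin 8
  s x y = σ ⟨$⟩ˡ r x y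

  adj-on : ∀ x y → adj r (σ ⟨$⟩ʳ s x y) x y ≡ 1q
  adj-on x y with r x y ≟ (σ ⟨$⟩ʳ (σ ⟨$⟩ˡ r x y))
  ... | yes _ = refl
  ... | no ne = contradiction (sym (inverseʳ σ)) ne

  adj-off : ∀ x y j → ¬ (s x y ≡ j) → adj r (σ ⟨$⟩ʳ j) x y ≡ 0q
  adj-off x y j ne with r x y ≟ (σ ⟨$⟩ʳ j)
  ... | yes eq = contradiction (trans (cong (σ ⟨$⟩ˡ_) eq) (inverseˡ σ)) ne
  ... | no _ = refl

  module Sp = Spectral.Decomposition ℚi-ring s (λ j → adj r (σ ⟨$⟩ʳ j)) E (λ i j → fromℤi (P i j)) adj-on adj-off
              (λ j x y → trans (spectral j x y) (sumFin≡∑ 8 (λ i → fromℤi (P i j) ⊗q E i x y)))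
              (λ i x y → trans (sym (sumFin≡∑ n (λ z → E i x z ⊗q E i z y))) (idempotent i x y))
              (λ i k ne x y → trans (sym (sumFin≡∑ n (λ z → E i x z ⊗q E k z y))) (orthogonal i k ne x y))

  fromℤi-∑-* : ∀ {k} (f g : Fin k → ℤi) →
               ℚΣ.∑ (λ j → fromℤi (f j) ⊗q fromℤi (g j)) ≡ fromℤi (ℤΣ.∑ (λ j → f j ⊠ g j))
  fromℤi-∑-* f g = trans (ℚΣ.∑-cong (λ j → sym (fromℤi-* (f j) (g j)))) (sym (fromℤi-∑ (λ j → f j ⊠ g j)))

  -- The idempotents have entries in ℚ(i), but they no longer occur in the resulting identity, which
  -- is therefore pulled back along the injective `fromℤi`. All later arithmetic stays in ℤ[i].
  convolution : ∀ f g h → (∀ i → eigenvalue P f i ⊠ eigenvalue P g i ≡ eigenvalue P h i) →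
                ∀ x y → ℤΣ.∑ (λ z → f (s x z) ⊠ g (s z y)) ≡ h (s x y)
  convolution f g h eq x y = fromℤi-injective _ _ (trans
    (sym (fromℤi-∑-* (λ z → f (s x z)) (λ z → g (s z y))))
    (Sp.convolution (λ j → fromℤi (f j)) (λ j → fromℤi (g j)) (λ j → fromℤi (h j)) eq′ x y))
    where
    ev : ∀ f i → Sp.eigenvalue (λ j → fromℤi (f j)) i ≡ fromℤi (eigenvalue P f i)
    ev f i = trans (fromℤi-∑-* f (P i)) (cong fromℤi (ℤΣ.∑≡sum (λ j → f j ⊠ P i j)))
    eq′ : ∀ i → Sp.eigenvalue (λ j → fromℤi (f j)) i ⊗q Sp.eigenvalue (λ j → fromℤi (g j)) i
              ≡ Sp.eigenvalue (λ j → fromℤi (h j)) i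
    eq′ i = trans (cong₂ _⊗q_ (ev f i) (ev g i))
      (trans (sym (fromℤi-* (eigenvalue P f i) (eigenvalue P g i))) (trans (cong fromℤi (eq i)) (sym (ev h i))))

-- Contractions of the fourth-moment form of a reproducing kernel.

module QuarticForms (R : CommutativeRing 0ℓ 0ℓ) where
  open CommutativeRing R hiding (zero) renaming (refl to ≈-refl; sym to ≈-sym; trans to ≈-trans)
  open FiniteSum R
  open import Relation.Binary.Reasoning.Setoid setoid
  open RingSolver commutativeSemiring using (solve; _:+_; _:*_; _:=_)

  module Form {n : ℕ} (G : Fin n → Fin n → Carrier) (c₂ c₄ : Carrier)
    (reproducing : ∀ x y → ∑ (λ z → G x z * G z y) ≈ c₂ * G x y) where

    -- `K` is the fourth moment of the points. For a suitable negative `c₄` the second summand of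
    -- `D` is the moment of a projective 2-design with its sign reversed, so the design identity
    -- says that `D` vanishes.
    K D : Fin n → Fin n → Fin n → Fin n → Carrier
    K a b c d = ∑ (λ u → (G a u * G b u) * (G u c * G u d))
    D a b c d = K a b c d + c₄ * (G a c * G b d + G a d * G b c)

    K-swapˡ : ∀ a b c d → K a b c d ≈ K b a c d
    K-swapˡ a b c d = ∑-cong λ u → *-congʳ (*-comm _ _)

    K-swapʳ : ∀ a b c d → K a b c d ≈ K a b d c
    K-swapʳ a b c d = ∑-cong λ u → *-congˡ (*-comm _ _)

    D-swapˡ : ∀ a b c d → D a b c d ≈ D b a c d
    D-swapˡ a b c d = +-cong (K-swapˡ a b c d) (*-congˡ (≈-trans (+-comm _ _) (+-cong (*-comm _ _) (*-comm _ _))))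

    D-swapʳ : ∀ a b c d → D a b c d ≈ D a b d c
    D-swapʳ a b c d = +-cong (K-swapʳ a b c d) (*-congˡ (+-comm _ _))

    private
      pull : ∀ p q r s t → (p * q * s) * (r * t) ≈ ((p * q) * (r * s)) * t
      pull = solve 5 (λ p q r s t → (p :* q :* s) :* (r :* t) := ((p :* q) :* (r :* s)) :* t) ≈-refl
      left : ∀ p q r s v → v * ((p * q) * (r * s)) ≈ (q * (r * s)) * (v * p)
      left = solve 5 (λ p q r s v → v :* ((p :* q) :* (r :* s)) := (q :* (r :* s)) :* (v :* p)) ≈-refl
      push : ∀ c p q r s → (p * q * s) * (c * r) ≈ c * ((p * q) * (r * s))
      push = solve 5 (λ c p q r s → (p :* q :* s) :* (c :* r) := c :* ((p :* q) :* (r :* s))) ≈-refl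
      pushˡ : ∀ c p q r s → (q * (r * s)) * (c * p) ≈ c * ((p * q) * (r * s))
      pushˡ = solve 5 (λ c p q r s → (q :* (r :* s)) :* (c :* p) := c :* ((p :* q) :* (r :* s))) ≈-refl
      split : ∀ k c x p y q t → (k + c * (x * p + y * q)) * t ≈ k * t + (c * p * (x * t) + c * y * (q * t))
      split = solve 7 (λ k c x p y q t → (k :+ c :* (x :* p :+ y :* q)) :* t := k :* t :+ (c :* p :* (x :* t) :+ c :* y :* (q :* t))) ≈-refl
      splitˡ : ∀ k c x p y q t → t * (k + c * (x * p + y * q)) ≈ t * k + (c * p * (t * x) + c * q * (t * y))
      splitˡ = solve 7 (λ k c x p y q t → t :* (k :+ c :* (x :* p :+ y :* q)) := t :* k :+ (c :* p :* (t :* x) :+ c :* q :* (t :* y))) ≈-refl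
      join : ∀ l k c x p y q → l * k + (c * p * (l * x) + c * y * (l * q)) ≈ l * (k + c * (x * p + y * q))
      join = solve 7 (λ l k c x p y q → l :* k :+ (c :* p :* (l :* x) :+ c :* y :* (l :* q)) := l :* (k :+ c :* (x :* p :+ y :* q))) ≈-refl

    K-reproducingʳ : ∀ a b d v → ∑ (λ c → K a b c d * G c v) ≈ c₂ * K a b v d
    K-reproducingʳ a b d v = begin
      ∑ (λ c → K a b c d * G c v)
        ≈⟨ ∑-cong (λ c → ∑-*) ⟩
      ∑ (λ c → ∑ (λ u → ((G a u * G b u) * (G u c * G u d)) * G c v))
        ≈⟨ ∑-swap ⟩
      ∑ (λ u → ∑ (λ c → ((G a u * G b u) * (G u c * G u d)) * G c v))
        ≈⟨ ∑-cong (λ u → ≈-trans (∑-cong λ c → ≈-sym (pull (G a u) (G b u) (G u c) (G u d) (G c v)))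
             (≈-trans (≈-sym *-∑) (≈-trans (*-congˡ (reproducing u v)) (push c₂ (G a u) (G b u) (G u v) (G u d))))) ⟩
      ∑ (λ u → c₂ * ((G a u * G b u) * (G u v * G u d)))
        ≈⟨ *-∑ ⟨
      c₂ * K a b v d ∎

    K-reproducingˡ : ∀ b c d v → ∑ (λ a → G v a * K a b c d) ≈ c₂ * K v b c d
    K-reproducingˡ b c d v = begin
      ∑ (λ a → G v a * K a b c d)
        ≈⟨ ∑-cong (λ a → *-∑) ⟩
      ∑ (λ a → ∑ (λ u → G v a * ((G a u * G b u) * (G u c * G u d))))
        ≈⟨ ∑-swap ⟩
      ∑ (λ u → ∑ (λ a → G v a * ((G a u * G b u) * (G u c * G u d))))
        ≈⟨ ∑-cong (λ u → ≈-trans (∑-cong λ a → left (G a u) (G b u) (G u c) (G u d) (G v a))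
             (≈-trans (≈-sym *-∑) (≈-trans (*-congˡ (reproducing v u)) (pushˡ c₂ (G v u) (G b u) (G u c) (G u d))))) ⟩
      ∑ (λ u → c₂ * ((G v u * G b u) * (G u c * G u d)))
        ≈⟨ *-∑ ⟨
      c₂ * K v b c d ∎

    -- Each term of `D` is a product or a sum of products with exactly one factor `G` in every slot,
    -- so contraction with `G` in a slot only relabels it, at the cost of a factor `c₂`.
    D-reproducingʳ : ∀ a b d v → ∑ (λ c → D a b c d * G c v) ≈ c₂ * D a b v d
    D-reproducingʳ a b d v = begin
      ∑ (λ c → D a b c d * G c v)
        ≈⟨ ∑-cong (λ c → split (K a b c d) c₄ (G a c) (G b d) (G a d) (G b c) (G c v)) ⟩
      ∑ (λ c → K a b c d * G c v + (c₄ * G b d * (G a c * G c v) + c₄ * G a d * (G b c * G c v)))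
        ≈⟨ ≈-trans ∑-+ (+-cong (K-reproducingʳ a b d v) (≈-trans ∑-+ (+-cong
             (≈-trans (≈-sym *-∑) (*-congˡ (reproducing a v))) (≈-trans (≈-sym *-∑) (*-congˡ (reproducing b v)))))) ⟩
      c₂ * K a b v d + (c₄ * G b d * (c₂ * G a v) + c₄ * G a d * (c₂ * G b v))
        ≈⟨ join c₂ (K a b v d) c₄ (G a v) (G b d) (G a d) (G b v) ⟩
      c₂ * D a b v d ∎

    D-reproducingˡ : ∀ b c d v → ∑ (λ a → G v a * D a b c d) ≈ c₂ * D v b c d
    D-reproducingˡ b c d v = begin
      ∑ (λ a → G v a * D a b c d)
        ≈⟨ ∑-cong (λ a → ≈-trans (splitˡ (K a b c d) c₄ (G a c) (G b d) (G a d) (G b c) (G v a)) ≈-refl) ⟩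
      ∑ (λ a → G v a * K a b c d + (c₄ * G b d * (G v a * G a c) + c₄ * G b c * (G v a * G a d)))
        ≈⟨ ≈-trans ∑-+ (+-cong (K-reproducingˡ b c d v) (≈-trans ∑-+ (+-cong
             (≈-trans (≈-sym *-∑) (*-congˡ (reproducing v c))) (≈-trans (≈-sym *-∑) (*-congˡ (reproducing v d)))))) ⟩
      c₂ * K v b c d + (c₄ * G b d * (c₂ * G v c) + c₄ * G b c * (c₂ * G v d))
        ≈⟨ ≈-trans (join c₂ (K v b c d) c₄ (G v c) (G b d) (G b c) (G v d)) (*-congˡ (+-congˡ (*-congˡ (+-congˡ (*-comm _ _))))) ⟩
      c₂ * D v b c d ∎

    module _ where
      private
        r1 : ∀ p q r s x → ((p * q) * (r * s)) * x ≈ (r * s) * ((x * q) * p)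
        r1 = solve 5 (λ p q r s x → ((p :* q) :* (r :* s)) :* x := (r :* s) :* ((x :* q) :* p)) ≈-refl
        r2 : ∀ c r s x → (r * s) * (c * (c * x)) ≈ (c * c) * (s * (r * x))
        r2 = solve 4 (λ c r s x → (r :* s) :* (c :* (c :* x)) := (c :* c) :* (s :* (r :* x))) ≈-refl
        r3 : ∀ c x → (c * c) * (c * (c * x)) ≈ (c * c * c * c) * x
        r3 = solve 2 (λ c x → (c :* c) :* (c :* (c :* x)) := (c :* c :* c :* c) :* x) ≈-refl
        r4 : ∀ p q x → (p * q) * x ≈ (x * q) * p
        r4 = solve 3 (λ p q x → (p :* q) :* x := (x :* q) :* p) ≈-refl

      ∑∑-G : ∀ a b v w → ∑ (λ c → ∑ (λ d → (D a b c d * G d w) * G c v)) ≈ c₂ * (c₂ * D a b v w)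
      ∑∑-G a b v w = begin
        ∑ (λ c → ∑ (λ d → (D a b c d * G d w) * G c v))
          ≈⟨ ∑-cong (λ c → ≈-trans (≈-sym ∑-*) (*-congʳ (≈-trans (∑-cong λ d → *-congʳ (D-swapʳ a b c d))
               (≈-trans (D-reproducingʳ a b c w) (*-congˡ (D-swapʳ a b w c)))))) ⟩
        ∑ (λ c → (c₂ * D a b c w) * G c v)
          ≈⟨ ≈-trans (∑-cong λ c → *-assoc _ _ _) (≈-trans (≈-sym *-∑) (*-congˡ (D-reproducingʳ a b w v))) ⟩
        c₂ * (c₂ * D a b v w) ∎

      ∑∑-G′ : ∀ v w → ∑ (λ a → ∑ (λ b → G w b * (G v a * D a b v w))) ≈ c₂ * (c₂ * D v w v w)
      ∑∑-G′ v w = begin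
        ∑ (λ a → ∑ (λ b → G w b * (G v a * D a b v w)))
          ≈⟨ ∑-swap ⟩
        ∑ (λ b → ∑ (λ a → G w b * (G v a * D a b v w)))
          ≈⟨ ∑-cong (λ b → ≈-trans (≈-sym *-∑) (*-congˡ (D-reproducingˡ b v w v))) ⟩
        ∑ (λ b → G w b * (c₂ * D v b v w))
          ≈⟨ ∑-cong (λ b → ≈-trans (≈-sym (*-assoc _ _ _)) (≈-trans (*-congʳ (*-comm _ _)) (*-assoc _ _ _))) ⟩
        ∑ (λ b → c₂ * (G w b * D v b v w))
          ≈⟨ ≈-trans (≈-sym *-∑) (*-congˡ (≈-trans (∑-cong λ b → *-congˡ (D-swapˡ v b v w)) (≈-trans (D-reproducingˡ v v w w) (*-congˡ (D-swapˡ w v v w))))) ⟩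
        c₂ * (c₂ * D v w v w) ∎

      -- Once the inner sum defining `K` is pulled out, its four factors `G` are absorbed one by one
      -- into the slots of `D`, which all become the summation variable v.
      K-pairing : ∑ (λ a → ∑ (λ b → ∑ (λ c → ∑ (λ d → K c d a b * D a b c d))))
                ≈ (c₂ * c₂ * c₂ * c₂) * ∑ (λ v → D v v v v)
      K-pairing = begin
        ∑ (λ a → ∑ (λ b → ∑ (λ c → ∑ (λ d → K c d a b * D a b c d))))
          ≈⟨ ∑-cong (λ a → ∑-cong λ b → ≈-trans (∑-cong λ c → ≈-trans (∑-cong λ d → ∑-*) ∑-swap) ∑-swap) ⟩
        ∑ (λ a → ∑ (λ b → ∑ (λ v → ∑ (λ c → ∑ (λ d → ((G c v * G d v) * (G v a * G v b)) * D a b c d)))))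
          ≈⟨ ∑-cong (λ a → ∑-cong λ b → ∑-cong λ v → ≈-trans (∑-cong λ c → ≈-trans
               (∑-cong λ d → r1 (G c v) (G d v) (G v a) (G v b) (D a b c d)) (≈-sym *-∑))
               (≈-trans (≈-sym *-∑) (≈-trans (*-congˡ (∑∑-G a b v v)) (r2 c₂ (G v a) (G v b) (D a b v v))))) ⟩
        ∑ (λ a → ∑ (λ b → ∑ (λ v → (c₂ * c₂) * (G v b * (G v a * D a b v v)))))
          ≈⟨ ≈-trans (∑-cong λ a → ∑-swap) ∑-swap ⟩
        ∑ (λ v → ∑ (λ a → ∑ (λ b → (c₂ * c₂) * (G v b * (G v a * D a b v v)))))
          ≈⟨ ∑-cong (λ v → ≈-trans (∑-cong λ a → ≈-sym *-∑) (≈-trans (≈-sym *-∑) (≈-trans (*-congˡ (∑∑-G′ v v)) (r3 c₂ (D v v v v))))) ⟩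
        ∑ (λ v → (c₂ * c₂ * c₂ * c₂) * D v v v v)
          ≈⟨ *-∑ ⟨
        (c₂ * c₂ * c₂ * c₂) * ∑ (λ v → D v v v v) ∎

      trace : Carrier
      trace = ∑ (λ a → ∑ (λ b → D a b a b))

      G-pairing : ∀ a b → ∑ (λ c → ∑ (λ d → (G c a * G d b) * D a b c d)) ≈ c₂ * (c₂ * D a b a b)
      G-pairing a b = ≈-trans (∑-cong λ c → ∑-cong λ d → r4 (G c a) (G d b) (D a b c d)) (∑∑-G a b a b)

      G-pairing′ : ∀ a b → ∑ (λ c → ∑ (λ d → (G c b * G d a) * D a b c d)) ≈ c₂ * (c₂ * D a b a b)
      G-pairing′ a b = ≈-trans (∑-cong λ c → ∑-cong λ d → r4 (G c b) (G d a) (D a b c d))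
        (≈-trans (∑∑-G a b b a) (*-congˡ (*-congˡ (D-swapʳ a b b a))))

      -- Only the first factor `D` is expanded: its `K` part leads to the diagonal sum through
      -- `K-pairing`, and each of its two products of `G` leads to `trace`.
      D-norm : ∑ (λ v → D v v v v) ≈ 0# → trace ≈ 0# →
               ∑ (λ a → ∑ (λ b → ∑ (λ c → ∑ (λ d → D c d a b * D a b c d)))) ≈ 0#
      D-norm diag≈0 trace≈0 = begin
        ∑ (λ a → ∑ (λ b → ∑ (λ c → ∑ (λ d → D c d a b * D a b c d))))
          ≈⟨ ∑-cong (λ a → ∑-cong λ b → ∑-cong λ c → ∑-cong λ d → r6 (K c d a b) c₄ (G c a * G d b) (G c b * G d a) (D a b c d)) ⟩
        ∑ (λ a → ∑ (λ b → ∑ (λ c → ∑ (λ d → K c d a b * D a b c d + c₄ * ((G c a * G d b) * D a b c d + (G c b * G d a) * D a b c d)))))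
          ≈⟨ ∑-cong (λ a → ∑-cong λ b → ≈-trans (∑-cong λ c → ∑-+) ∑-+) ⟩
        ∑ (λ a → ∑ (λ b → ∑ (λ c → ∑ (λ d → K c d a b * D a b c d))
                        + ∑ (λ c → ∑ (λ d → c₄ * ((G c a * G d b) * D a b c d + (G c b * G d a) * D a b c d)))))
          ≈⟨ ≈-trans (∑-cong λ a → ∑-+) ∑-+ ⟩
        ∑ (λ a → ∑ (λ b → ∑ (λ c → ∑ (λ d → K c d a b * D a b c d))))
          + ∑ (λ a → ∑ (λ b → ∑ (λ c → ∑ (λ d → c₄ * ((G c a * G d b) * D a b c d + (G c b * G d a) * D a b c d)))))
          ≈⟨ +-cong (≈-trans K-pairing (≈-trans (*-congˡ diag≈0) (zeroʳ _)))
               (≈-trans (∑-cong λ a → ≈-trans (∑-cong λ b →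
                  ≈-trans (∑-cong λ c → ≈-trans (≈-sym *-∑) (*-congˡ ∑-+)) (≈-trans (≈-sym *-∑)
                   (≈-trans (*-congˡ (≈-trans ∑-+ (+-cong (G-pairing a b) (G-pairing′ a b)))) (r7 c₄ c₂ (D a b a b))))) (≈-sym *-∑)) (≈-sym *-∑)) ⟩
        0# + (c₄ * (c₂ * c₂ + c₂ * c₂)) * trace
          ≈⟨ ≈-trans (+-identityˡ _) (≈-trans (*-congˡ trace≈0) (zeroʳ _)) ⟩
        0# ∎
        where
        r6 : ∀ k c x y t → (k + c * (x + y)) * t ≈ k * t + c * (x * t + y * t)
        r6 = solve 5 (λ k c x y t → (k :+ c :* (x :+ y)) :* t := k :* t :+ c :* (x :* t :+ y :* t)) ≈-refl
        r7 : ∀ c l t → c * (l * (l * t) + l * (l * t)) ≈ (c * (l * l + l * l)) * t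
        r7 = solve 3 (λ c l t → c :* (l :* (l :* t) :+ l :* (l :* t)) := (c :* (l :* l :+ l :* l)) :* t) ≈-refl

-- Intersection numbers

-- 3α_j for the inner products α_j of the unit vectors.
α : Fin 8 → ℤi
α 0F = r+ 3
α 1F = i+ 3
α 2F = r- 3
α 3F = i- 3
α 4F = r+ 1
α 5F = i+ 1
α 6F = r- 1
α 7F = i- 1

opposite : Fin 8 → Fin 8
opposite 1F = 3F
opposite 3F = 1F
opposite 5F = 7F
opposite 7F = 5F
opposite j = j

-- The relations are graded by ℤ/4 through j mod 4; intersection numbers depend on the phase difference only.
pᵏ : Fin 8 → Fin 8 → Fin 8 → ℕ
pᵏ a b c = table (toℕ a ℕ.<ᵇ 4) (toℕ b ℕ.<ᵇ 4) (toℕ c ℕ.<ᵇ 4) ((toℕ c ℕ.+ 16 ℕ.∸ (toℕ a ℕ.+ toℕ b)) % 4)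
  where
  δ₀ : ℕ → ℕ
  δ₀ 0 = 1
  δ₀ _ = 0
  table : Bool → Bool → Bool → ℕ → ℕ
  table true  true  true  p = δ₀ p
  table true  false false p = δ₀ p
  table false true  false p = δ₀ p
  table false false true  p = 63 ℕ.* δ₀ p
  table false false false 0 = 24
  table false false false 2 = 6
  table false false false _ = 16
  table _ _ _ _ = 0

intersectionNumber : Fin 8 → Fin 8 → Fin 8 → ℤi
intersectionNumber a b c = r+ (pᵏ a b c)

[_] : Fin 8 → Fin 8 → ℤi
[ a ] j = if ⌊ a ≟ j ⌋ then 1ᵢ else 0ᵢ

Convolves : (f g h : Fin 8 → ℤi) → Set
Convolves f g h = ∀ i → eigenvalue Pmat f i ⊠ eigenvalue Pmat g i ≡ eigenvalue Pmat h i

convolves? : ∀ f g h → Dec (Convolves f g h)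
convolves? f g h = all? λ i → (eigenvalue Pmat f i ⊠ eigenvalue Pmat g i) ≟ᵢ eigenvalue Pmat h i

one : Fin 8 → ℤi
one _ = 1ᵢ

α² : Fin 8 → ℤi
α² j = α j ⊠ α j

opaque
  convolves-one : Convolves one one (λ _ → r+ 256)
  convolves-one = from-yes (convolves? one one (λ _ → r+ 256))

  convolves-α : Convolves α α (λ j → r+ 96 ⊠ α j)
  convolves-α = from-yes (convolves? α α (λ j → r+ 96 ⊠ α j))

  convolves-α² : Convolves α² α² (λ j → r+ 64 ⊠ α² j)
  convolves-α² = from-yes (convolves? α² α² (λ j → r+ 64 ⊠ α² j))

  -- This certifies the table `pᵏ` against the eigenmatrix: the eigenvalues of A_a A_b are those of
  -- Σ p A_c over the relations c.
  convolves-indicator : ∀ a b → Convolves [ a ] [ b ] (intersectionNumber a b)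
  convolves-indicator = from-yes (all? λ a → all? λ b → convolves? [ a ] [ b ] (intersectionNumber a b))

  α-injective : ∀ i j → α i ≡ α j → i ≡ j
  α-injective = from-yes (all? λ i → all? λ j → (α i ≟ᵢ α j) →-dec (i ≟ j))

  α-opposite : ∀ j → α (opposite j) ≡ conj (α j)
  α-opposite = from-yes (all? λ j → α (opposite j) ≟ᵢ conj (α j))

  diagonal-relation : ∀ d → intersectionNumber d d d ≡ 1ᵢ → d ≡ 0F
  diagonal-relation = from-yes (all? λ d → (intersectionNumber d d d ≟ᵢ 1ᵢ) →-dec (d ≟ 0F))

  intersectionNumber-diagonal : ∀ a b → ¬ (intersectionNumber a b 0F ≡ 0ᵢ) → b ≡ opposite a
  intersectionNumber-diagonal = from-yes (all? λ a → all? λ b → ¬? (intersectionNumber a b 0F ≟ᵢ 0ᵢ) →-dec (b ≟ opposite a))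

-- The quartic form of the configuration

open ℤΣ using (∑; ∑≡sum; ∑-cong; ∑-swap; ∑-+; *-∑; ∑-*; ∑-0; ∑-single; ∑-product)

norm : ℤi → ℤ
norm (a +i b) = a ℤ.* a ℤ.+ b ℤ.* b

square-nonneg : ∀ a → 0ℤ ℤ.≤ a ℤ.* a
square-nonneg (+ a) = subst (0ℤ ℤ.≤_) (ℤₚ.pos-* a a) (ℤ.+≤+ ℕ.z≤n)
square-nonneg ℤ.-[1+ a ] = ℤ.+≤+ ℕ.z≤n

norm-nonneg : ∀ x → 0ℤ ℤ.≤ norm x
norm-nonneg (a +i b) = ℤₚ.+-mono-≤ (square-nonneg a) (square-nonneg b)

square-zero : ∀ a → a ℤ.* a ≡ 0ℤ → a ≡ 0ℤ
square-zero a eq with ℤₚ.i*j≡0⇒i≡0∨j≡0 a eq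
... | inj₁ p = p
... | inj₂ p = p

summand-zeroˡ : ∀ {a b} → 0ℤ ℤ.≤ a → 0ℤ ℤ.≤ b → a ℤ.+ b ℤ.≤ 0ℤ → a ≡ 0ℤ
summand-zeroˡ {a} {b} 0≤a 0≤b a+b≤0 = ℤₚ.≤-antisym
  (ℤₚ.≤-trans (subst (ℤ._≤ a ℤ.+ b) (ℤₚ.+-identityʳ a) (ℤₚ.+-monoʳ-≤ a 0≤b)) a+b≤0) 0≤a

summand-zeroʳ : ∀ {a b} → 0ℤ ℤ.≤ a → 0ℤ ℤ.≤ b → a ℤ.+ b ℤ.≤ 0ℤ → b ≡ 0ℤ
summand-zeroʳ {a} {b} 0≤a 0≤b a+b≤0 = summand-zeroˡ 0≤b 0≤a (subst (ℤ._≤ 0ℤ) (ℤₚ.+-comm a b) a+b≤0)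

norm-zero : ∀ x → norm x ≡ 0ℤ → x ≡ 0ᵢ
norm-zero (a +i b) eq = cong₂ _+i_
  (square-zero a (summand-zeroˡ (square-nonneg a) (square-nonneg b) (ℤₚ.≤-reflexive eq)))
  (square-zero b (summand-zeroʳ (square-nonneg a) (square-nonneg b) (ℤₚ.≤-reflexive eq)))

conj-⊠-self : ∀ x → conj x ⊠ x ≡ (norm x) +i 0ℤ
conj-⊠-self (a +i b) = cong₂ _+i_ (l1 a b) (l2 a b)
  where
  l1 : ∀ a b → a ℤ.* a ℤ.- (- b) ℤ.* b ≡ a ℤ.* a ℤ.+ b ℤ.* b
  l1 = solveℤ
  l2 : ∀ a b → a ℤ.* b ℤ.+ (- b) ℤ.* a ≡ + 0
  l2 = solveℤ

conj-⊞ : ∀ x y → conj (x ⊞ y) ≡ conj x ⊞ conj y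
conj-⊞ (a +i b) (c +i d) = cong ((a ℤ.+ c) +i_) (ℤₚ.neg-distrib-+ b d)

conj-⊠ : ∀ x y → conj (x ⊠ y) ≡ conj x ⊠ conj y
conj-⊠ (a +i b) (c +i d) = cong₂ _+i_ (l1 a b c d) (l2 a b c d)
  where
  l1 : ∀ a b c d → a ℤ.* c ℤ.- b ℤ.* d ≡ a ℤ.* c ℤ.- (- b) ℤ.* (- d)
  l1 = solveℤ
  l2 : ∀ a b c d → - (a ℤ.* d ℤ.+ b ℤ.* c) ≡ a ℤ.* (- d) ℤ.+ (- b) ℤ.* c
  l2 = solveℤ

conj-conj : ∀ x → conj (conj x) ≡ x
conj-conj (a +i b) = cong (a +i_) (ℤₚ.neg-involutive b)

opaque
  unfolding FiniteSum.∑

  conj-∑ : ∀ {n} (f : Fin n → ℤi) → conj (∑ f) ≡ ∑ (λ i → conj (f i))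
  conj-∑ {zero} f = refl
  conj-∑ {suc n} f = trans (conj-⊞ (f zero) _) (cong (conj (f zero) ⊞_) (conj-∑ (f ∘ suc)))

  re-∑-nonneg : ∀ {n} (f : Fin n → ℤi) → (∀ i → 0ℤ ℤ.≤ re (f i)) → 0ℤ ℤ.≤ re (∑ f)
  re-∑-nonneg {zero} f p = ℤ.+≤+ ℕ.z≤n
  re-∑-nonneg {suc n} f p = ℤₚ.+-mono-≤ (p zero) (re-∑-nonneg (f ∘ suc) (p ∘ suc))

  re-∑-zero : ∀ {n} (f : Fin n → ℤi) → (∀ i → 0ℤ ℤ.≤ re (f i)) → re (∑ f) ≡ 0ℤ → ∀ i → re (f i) ≡ 0ℤ
  re-∑-zero f p eq zero = summand-zeroˡ (p zero) (re-∑-nonneg (f ∘ suc) (p ∘ suc)) (ℤₚ.≤-reflexive eq)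
  re-∑-zero f p eq (suc i) = re-∑-zero (f ∘ suc) (p ∘ suc)
    (summand-zeroʳ (p zero) (re-∑-nonneg (f ∘ suc) (p ∘ suc)) (ℤₚ.≤-reflexive eq)) i

re-norm-nonneg : ∀ x → 0ℤ ℤ.≤ re (conj x ⊠ x)
re-norm-nonneg x = subst (λ t → 0ℤ ℤ.≤ re t) (sym (conj-⊠-self x)) (norm-nonneg x)

∑-norm-zero : ∀ {n} (f : Fin n → ℤi) → ∑ (λ i → conj (f i) ⊠ f i) ≡ 0ᵢ → ∀ i → f i ≡ 0ᵢ
∑-norm-zero f eq i = norm-zero (f i)
  (trans (sym (cong re (conj-⊠-self (f i)))) (re-∑-zero _ (λ i → re-norm-nonneg (f i)) (cong re eq) i))

-- What the geometric part retains of the scheme. `convolution` is the multiplication of its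
-- adjacency algebra on ℤ[i]-valued functions of the relation; it stands for all intersection
-- numbers at once.
record Configuration (n : ℕ) : Set where
  field
    s : Fin n → Fin n → Fin 8
    origin : Fin n
    diagonal : ∀ x → s x x ≡ 0F
    discrete : ∀ {x y} → s x y ≡ 0F → x ≡ y
    convolution : ∀ f g h → Convolves f g h → ∀ x y → ∑ (λ z → f (s x z) ⊠ g (s z y)) ≡ h (s x y)

  indicator-refl : ∀ a → [ a ] a ≡ 1ᵢ
  indicator-refl a with a ≟ a
  ... | yes _ = refl
  ... | no ne = contradiction refl ne

  -- Among the z counted by the intersection number of `s x y` and `s y x` at the pair (x, x) is z =
  -- y, so this number is not zero, and the table then determines `s y x`.
  opposite-relation : ∀ x y → s y x ≡ opposite (s x y)
  opposite-relation x y = intersectionNumber-diagonal (s x y) (s y x) λ p≡0 →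
    1≢0 (trans (sym at-y) (cong (λ t → re t +i 0ℤ) (zero-term p≡0)))
    where
    t : Fin n → ℤi
    t z = [ s x y ] (s x z) ⊠ [ s y x ] (s z x)
    t-nonneg : ∀ z → 0ℤ ℤ.≤ re (t z)
    t-nonneg z with s x y ≟ s x z | s y x ≟ s z x
    ... | yes _ | yes _ = ℤ.+≤+ ℕ.z≤n
    ... | yes _ | no _ = ℤ.+≤+ ℕ.z≤n
    ... | no _ | yes _ = ℤ.+≤+ ℕ.z≤n
    ... | no _ | no _ = ℤ.+≤+ ℕ.z≤n
    zero-term : intersectionNumber (s x y) (s y x) 0F ≡ 0ᵢ → (re (t y)) +i 0ℤ ≡ 0ᵢ
    zero-term p≡0 = cong (_+i 0ℤ) (re-∑-zero t t-nonneg (cong re (trans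
      (convolution [ s x y ] [ s y x ] (intersectionNumber (s x y) (s y x)) (convolves-indicator (s x y) (s y x)) x x)
      (trans (cong (intersectionNumber (s x y) (s y x)) (diagonal x)) p≡0))) y)
    at-y : (re (t y)) +i 0ℤ ≡ 1ᵢ
    at-y = cong (λ u → re u +i 0ℤ) (cong₂ _⊠_ (indicator-refl (s x y)) (indicator-refl (s y x)))
    1≢0 : ¬ (1ᵢ ≡ 0ᵢ)
    1≢0 ()

  G : Fin n → Fin n → ℤi
  G x y = α (s x y)

  G-hermitian : ∀ x y → G y x ≡ conj (G x y)
  G-hermitian x y = trans (cong α (opposite-relation x y)) (α-opposite (s x y))

  G-diagonal : ∀ x → G x x ≡ r+ 3
  G-diagonal x = cong α (diagonal x)

  G≡3⇒≡ : ∀ {x y} → G x y ≡ r+ 3 → x ≡ y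
  G≡3⇒≡ eq = discrete (α-injective _ 0F eq)

  G-reproducing : ∀ x y → ∑ (λ z → G x z ⊠ G z y) ≡ r+ 96 ⊠ G x y
  G-reproducing = convolution α α (λ j → r+ 96 ⊠ α j) convolves-α

  ∑-one : ∑ {n} (λ _ → 1ᵢ) ≡ r+ 256
  ∑-one = convolution one one (λ _ → r+ 256) convolves-one origin origin

  open QuarticForms.Form ℤi-ring G (r+ 96) (r- 32) G-reproducing using (K; D; trace; D-norm) public

  D-conj : ∀ a b c d → conj (D a b c d) ≡ D c d a b
  D-conj a b c d = trans (conj-⊞ (K a b c d) (r- 32 ⊠ ((G a c ⊠ G b d) ⊞ (G a d ⊠ G b c)))) (cong₂ _⊞_
    (trans (conj-∑ (λ u → (G a u ⊠ G b u) ⊠ (G u c ⊠ G u d))) (∑-cong λ u →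
      trans (conj-⊠ (G a u ⊠ G b u) (G u c ⊠ G u d)) (trans (⊠-comm (conj (G a u ⊠ G b u)) (conj (G u c ⊠ G u d)))
        (cong₂ _⊠_ (conj-G₂ u c u d) (conj-G₂ a u b u)))))
    (trans (conj-⊠ (r- 32) ((G a c ⊠ G b d) ⊞ (G a d ⊠ G b c))) (cong (r- 32 ⊠_) (trans (conj-⊞ (G a c ⊠ G b d) (G a d ⊠ G b c))
      (cong₂ _⊞_ (conj-G₂ a c b d) (trans (conj-G₂ a d b c) (⊠-comm (G d a) (G c b))))))))
    where
    conj-G₂ : ∀ x y z w → conj (G x y ⊠ G z w) ≡ G y x ⊠ G w z
    conj-G₂ x y z w = trans (conj-⊠ (G x y) (G z w)) (cong₂ _⊠_ (sym (G-hermitian x y)) (sym (G-hermitian z w)))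

  private
    q : ∀ p q r s → (p ⊠ q) ⊠ (r ⊠ s) ≡ (p ⊠ r) ⊠ (q ⊠ s)
    q = solve-∀ ℤi-solver

  -- This fixes the constant 32: the entrywise square of `G` gives 64·9 = 576 on the diagonal, and
  -- 576 = 32·(9 + 9).
  D-diagonal : ∀ v → D v v v v ≡ 0ᵢ
  D-diagonal v = trans (cong₂ _⊞_
    (trans (convolution α² α² (λ j → r+ 64 ⊠ α² j) convolves-α² v v) (cong (λ j → r+ 64 ⊠ α² j) (diagonal v)))
    (cong (λ t → r- 32 ⊠ ((t ⊠ t) ⊞ (t ⊠ t))) (G-diagonal v))) refl

  ∑-const : ∀ x → ∑ {n} (λ _ → x) ≡ x ⊠ r+ 256
  ∑-const x = trans (∑-cong (λ _ → trans (sym (⊠-identityˡ x)) (⊠-comm 1ᵢ x))) (trans (sym (*-∑ {n} {x} {λ _ → 1ᵢ})) (cong (x ⊠_) ∑-one))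

  ∑-norm-G : ∀ x → ∑ (λ z → G x z ⊠ G z x) ≡ r+ 288
  ∑-norm-G x = trans (G-reproducing x x) (cong (r+ 96 ⊠_) (G-diagonal x))

  trace-zero : trace ≡ 0ᵢ
  trace-zero = begin
    ∑ (λ a → ∑ (λ b → D a b a b))
      ≡⟨ ∑-cong (λ a → ∑-+ {n} {λ b → K a b a b} {λ b → r- 32 ⊠ ((G a a ⊠ G b b) ⊞ (G a b ⊠ G b a))}) ⟩
    ∑ (λ a → ∑ (λ b → K a b a b) ⊞ ∑ (λ b → r- 32 ⊠ ((G a a ⊠ G b b) ⊞ (G a b ⊠ G b a))))
      ≡⟨ ∑-+ {n} {λ a → ∑ (λ b → K a b a b)} {λ a → ∑ (λ b → r- 32 ⊠ ((G a a ⊠ G b b) ⊞ (G a b ⊠ G b a)))} ⟩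
    ∑ (λ a → ∑ (λ b → K a b a b)) ⊞ ∑ (λ a → ∑ (λ b → r- 32 ⊠ ((G a a ⊠ G b b) ⊞ (G a b ⊠ G b a))))
      ≡⟨ cong₂ _⊞_ K-part G-part ⟩
    0ᵢ ∎
    where
    open ≡-Reasoning
    -- 256·288² here cancels against -32·(9·256² + 256·288) in `G-part`.
    K-part : ∑ (λ a → ∑ (λ b → K a b a b)) ≡ r+ 21233664
    K-part = begin
      ∑ (λ a → ∑ (λ b → ∑ (λ u → (G a u ⊠ G b u) ⊠ (G u a ⊠ G u b))))
        ≡⟨ trans (∑-cong λ a → ∑-swap) ∑-swap ⟩
      ∑ (λ u → ∑ (λ a → ∑ (λ b → (G a u ⊠ G b u) ⊠ (G u a ⊠ G u b))))
        ≡⟨ ∑-cong (λ u → trans (∑-cong λ a → ∑-cong λ b →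
             trans (q (G a u) (G b u) (G u a) (G u b)) (cong₂ _⊠_ (⊠-comm (G a u) (G u a)) (⊠-comm (G b u) (G u b))))
             (trans (sym (∑-product {n} {n} {λ a → G u a ⊠ G a u} {λ b → G u b ⊠ G b u})) (cong₂ _⊠_ (∑-norm-G u) (∑-norm-G u)))) ⟩
      ∑ (λ u → r+ 82944)
        ≡⟨ ∑-const (r+ 82944) ⟩
      r+ 21233664 ∎
    G-part : ∑ (λ a → ∑ (λ b → r- 32 ⊠ ((G a a ⊠ G b b) ⊞ (G a b ⊠ G b a)))) ≡ r- 21233664
    G-part = begin
      ∑ (λ a → ∑ (λ b → r- 32 ⊠ ((G a a ⊠ G b b) ⊞ (G a b ⊠ G b a))))
        ≡⟨ ∑-cong (λ a → trans (sym (*-∑ {n} {r- 32} {λ b → (G a a ⊠ G b b) ⊞ (G a b ⊠ G b a)})) (cong (r- 32 ⊠_) (trans (∑-+ {n} {λ b → G a a ⊠ G b b} {λ b → G a b ⊠ G b a}) (cong₂ _⊞_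
             (trans (∑-cong λ b → cong₂ _⊠_ (G-diagonal a) (G-diagonal b)) (∑-const (r+ 9))) (∑-norm-G a))))) ⟩
      ∑ (λ a → r- 82944)
        ≡⟨ ∑-const (r- 82944) ⟩
      r- 21233664 ∎

  -- By `D-conj` the vanishing sum of `D-norm` is Σ |D|², a sum of nonnegative terms; the four
  -- nested sums are peeled off from the outside.
  D-zero : ∀ a b c d → D a b c d ≡ 0ᵢ
  D-zero a b c d = norm-zero (D a b c d) (trans (sym (cong re (conj-⊠-self (D a b c d)))) re-zero)
    where
    t : Fin n → Fin n → Fin n → Fin n → ℤi
    t a b c d = conj (D a b c d) ⊠ D a b c d
    t-nonneg : ∀ a b c d → 0ℤ ℤ.≤ re (t a b c d)
    t-nonneg a b c d = re-norm-nonneg (D a b c d)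
    total : ∑ (λ a → ∑ (λ b → ∑ (λ c → ∑ (λ d → t a b c d)))) ≡ 0ᵢ
    total = trans
      (∑-cong λ a → ∑-cong λ b → ∑-cong λ c → ∑-cong λ d → cong (_⊠ D a b c d) (D-conj a b c d))
      (D-norm (∑-0 D-diagonal) trace-zero)
    n₁ : ∀ a b c → 0ℤ ℤ.≤ re (∑ (t a b c))
    n₁ a b c = re-∑-nonneg (t a b c) (t-nonneg a b c)
    n₂ : ∀ a b → 0ℤ ℤ.≤ re (∑ (λ c → ∑ (t a b c)))
    n₂ a b = re-∑-nonneg (λ c → ∑ (t a b c)) (n₁ a b)
    n₃ : ∀ a → 0ℤ ℤ.≤ re (∑ (λ b → ∑ (λ c → ∑ (t a b c))))
    n₃ a = re-∑-nonneg (λ b → ∑ (λ c → ∑ (t a b c))) (n₂ a)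
    re-zero : re (t a b c d) ≡ 0ℤ
    re-zero = re-∑-zero (t a b c) (t-nonneg a b c)
      (re-∑-zero (λ c → ∑ (t a b c)) (n₁ a b)
        (re-∑-zero (λ b → ∑ (λ c → ∑ (t a b c))) (n₂ a)
          (re-∑-zero (λ a → ∑ (λ b → ∑ (λ c → ∑ (t a b c)))) n₃ (cong re total) a) b) c) d

  quartic : ∀ a b c d → ∑ (λ u → (G a u ⊠ G b u) ⊠ (G u c ⊠ G u d)) ≡ r+ 32 ⊠ ((G a c ⊠ G b d) ⊞ (G a d ⊠ G b c))
  quartic a b c d = begin
    K a b c d ≡⟨ l (K a b c d) X ⟩
    D a b c d ⊞ (r+ 32 ⊠ X) ≡⟨ cong (_⊞ (r+ 32 ⊠ X)) (D-zero a b c d) ⟩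
    0ᵢ ⊞ (r+ 32 ⊠ X) ≡⟨ ⊞-identityˡ (r+ 32 ⊠ X) ⟩
    r+ 32 ⊠ X ∎
    where
    open ≡-Reasoning
    X = (G a c ⊠ G b d) ⊞ (G a d ⊠ G b c)
    l : ∀ k x → k ≡ (k ⊞ (r- 32 ⊠ x)) ⊞ (r+ 32 ⊠ x)
    l = solve-∀ ℤi-solver

-- The lattice spanned by the points

∑-linear : ∀ {n} c (f g : Fin n → ℤi) → ∑ (λ u → (c ⊠ f u) ⊞ g u) ≡ (c ⊠ ∑ f) ⊞ ∑ g
∑-linear c f g = trans (∑-+ {f = λ u → c ⊠ f u} {g}) (cong (_⊞ ∑ g) (sym (*-∑ {x = c} {f})))

⊠-zeroʳ : ∀ x → x ⊠ 0ᵢ ≡ 0ᵢ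
⊠-zeroʳ = CommutativeRing.zeroʳ ℤi-ring

module Lattice {n : ℕ} (C : Configuration n) where
  open Configuration C

  -- A formal ℤ[i]-combination of points; ⟪ w ⟫ u is the inner product of u with the vector it denotes.
  Word : Set
  Word = List (ℤi × Fin n)

  ⟪_⟫ : Word → Fin n → ℤi
  ⟪ [] ⟫ u = 0ᵢ
  ⟪ (c , x) ∷ w ⟫ u = (c ⊠ G u x) ⊞ ⟪ w ⟫ u

  ⟨_,_⟩ : Word → Word → ℤi
  ⟨ [] , w ⟩ = 0ᵢ
  ⟨ (c , x) ∷ v , w ⟩ = (conj c ⊠ ⟪ w ⟫ x) ⊞ ⟨ v , w ⟩

  conj-⟪⟫ : ∀ c x w u → conj (⟪ (c , x) ∷ w ⟫ u) ≡ (conj c ⊠ G x u) ⊞ conj (⟪ w ⟫ u)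
  conj-⟪⟫ c x w u = trans (conj-⊞ (c ⊠ G u x) (⟪ w ⟫ u))
    (cong (_⊞ conj (⟪ w ⟫ u)) (trans (conj-⊠ c (G u x)) (cong (conj c ⊠_) (sym (G-hermitian u x)))))

  ⟪⟫-reproducing : ∀ w x → ∑ (λ z → G x z ⊠ ⟪ w ⟫ z) ≡ r+ 96 ⊠ ⟪ w ⟫ x
  ⟪⟫-reproducing [] x = ∑-0 (λ z → ⊠-zeroʳ (G x z))
  ⟪⟫-reproducing ((c , y) ∷ w) x = begin
    ∑ (λ z → G x z ⊠ ((c ⊠ G z y) ⊞ ⟪ w ⟫ z))
      ≡⟨ ∑-cong (λ z → l1 c (G x z) (G z y) (⟪ w ⟫ z)) ⟩
    ∑ (λ z → (c ⊠ (G x z ⊠ G z y)) ⊞ (G x z ⊠ ⟪ w ⟫ z))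
      ≡⟨ ∑-linear c (λ z → G x z ⊠ G z y) (λ z → G x z ⊠ ⟪ w ⟫ z) ⟩
    (c ⊠ ∑ (λ z → G x z ⊠ G z y)) ⊞ ∑ (λ z → G x z ⊠ ⟪ w ⟫ z)
      ≡⟨ cong₂ (λ a b → (c ⊠ a) ⊞ b) (G-reproducing x y) (⟪⟫-reproducing w x) ⟩
    (c ⊠ (r+ 96 ⊠ G x y)) ⊞ (r+ 96 ⊠ ⟪ w ⟫ x)
      ≡⟨ l2 c (r+ 96) (G x y) (⟪ w ⟫ x) ⟩
    r+ 96 ⊠ ((c ⊠ G x y) ⊞ ⟪ w ⟫ x) ∎
    where
    open ≡-Reasoning
    l1 : ∀ c p q r → p ⊠ ((c ⊠ q) ⊞ r) ≡ (c ⊠ (p ⊠ q)) ⊞ (p ⊠ r)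
    l1 = solve-∀ ℤi-solver
    l2 : ∀ c k p q → (c ⊠ (k ⊠ p)) ⊞ (k ⊠ q) ≡ k ⊠ ((c ⊠ p) ⊞ q)
    l2 = solve-∀ ℤi-solver

  ⟨,⟩-sum : ∀ v w → ∑ (λ z → conj (⟪ v ⟫ z) ⊠ ⟪ w ⟫ z) ≡ r+ 96 ⊠ ⟨ v , w ⟩
  ⟨,⟩-sum [] w = ∑-0 (λ z → ⊠-zeroˡ (⟪ w ⟫ z))
    where ⊠-zeroˡ : ∀ x → conj 0ᵢ ⊠ x ≡ 0ᵢ
          ⊠-zeroˡ x = trans (⊠-comm 0ᵢ x) (⊠-zeroʳ x)
  ⟨,⟩-sum ((c , x) ∷ v) w = begin
    ∑ (λ z → conj (⟪ (c , x) ∷ v ⟫ z) ⊠ ⟪ w ⟫ z)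
      ≡⟨ ∑-cong (λ z → trans (cong (_⊠ ⟪ w ⟫ z) (conj-⟪⟫ c x v z)) (l1 (conj c) (G x z) (⟪ w ⟫ z) (conj (⟪ v ⟫ z)))) ⟩
    ∑ (λ z → (conj c ⊠ (G x z ⊠ ⟪ w ⟫ z)) ⊞ (conj (⟪ v ⟫ z) ⊠ ⟪ w ⟫ z))
      ≡⟨ ∑-linear (conj c) (λ z → G x z ⊠ ⟪ w ⟫ z) (λ z → conj (⟪ v ⟫ z) ⊠ ⟪ w ⟫ z) ⟩
    (conj c ⊠ ∑ (λ z → G x z ⊠ ⟪ w ⟫ z)) ⊞ ∑ (λ z → conj (⟪ v ⟫ z) ⊠ ⟪ w ⟫ z)
      ≡⟨ cong₂ (λ a b → (conj c ⊠ a) ⊞ b) (⟪⟫-reproducing w x) (⟨,⟩-sum v w) ⟩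
    (conj c ⊠ (r+ 96 ⊠ ⟪ w ⟫ x)) ⊞ (r+ 96 ⊠ ⟨ v , w ⟩)
      ≡⟨ l2 (conj c) (r+ 96) (⟪ w ⟫ x) ⟨ v , w ⟩ ⟩
    r+ 96 ⊠ ((conj c ⊠ ⟪ w ⟫ x) ⊞ ⟨ v , w ⟩) ∎
    where
    open ≡-Reasoning
    l1 : ∀ c p q r → ((c ⊠ p) ⊞ r) ⊠ q ≡ (c ⊠ (p ⊠ q)) ⊞ (r ⊠ q)
    l1 = solve-∀ ℤi-solver
    l2 : ∀ c k p q → (c ⊠ (k ⊠ p)) ⊞ (k ⊠ q) ≡ k ⊠ ((c ⊠ p) ⊞ q)
    l2 = solve-∀ ℤi-solver

  private
    -- If f, g are evaluations of the quartic form at two arguments of one slot, so is c f + g at their combination.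
    combine : ∀ (F f g : Fin n → ℤi) c {a b p q r s} → (∀ u → F u ≡ (c ⊠ f u) ⊞ g u) →
              ∑ f ≡ r+ 32 ⊠ ((a ⊠ p) ⊞ (b ⊠ q)) → ∑ g ≡ r+ 32 ⊠ ((r ⊠ p) ⊞ (s ⊠ q)) →
              ∑ F ≡ r+ 32 ⊠ ((((c ⊠ a) ⊞ r) ⊠ p) ⊞ (((c ⊠ b) ⊞ s) ⊠ q))
    combine F f g c {a} {b} {p} {q} {r} {s} F≡ f≡ g≡ = trans (∑-cong F≡) (trans (∑-linear c f g)
      (trans (cong₂ (λ x y → (c ⊠ x) ⊞ y) f≡ g≡) (l c (r+ 32) a b p q r s)))
      where
      l : ∀ c k a b p q r s → (c ⊠ (k ⊠ ((a ⊠ p) ⊞ (b ⊠ q)))) ⊞ (k ⊠ ((r ⊠ p) ⊞ (s ⊠ q)))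
        ≡ k ⊠ ((((c ⊠ a) ⊞ r) ⊠ p) ⊞ (((c ⊠ b) ⊞ s) ⊠ q))
      l = solve-∀ ℤi-solver

    vanish : ∀ (F : Fin n → ℤi) p q → (∀ u → F u ≡ 0ᵢ) → ∑ F ≡ r+ 32 ⊠ ((0ᵢ ⊠ p) ⊞ (0ᵢ ⊠ q))
    vanish F p q F≡0 = trans (∑-0 F≡0) (l (r+ 32) p q)
      where
      l : ∀ k p q → 0ᵢ ≡ k ⊠ ((0ᵢ ⊠ p) ⊞ (0ᵢ ⊠ q))
      l = solve-∀ ℤi-solver

    d4 : ∀ a b c k x y → (a ⊠ b) ⊠ (c ⊠ ((k ⊠ x) ⊞ y)) ≡ (k ⊠ ((a ⊠ b) ⊠ (c ⊠ x))) ⊞ ((a ⊠ b) ⊠ (c ⊠ y))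
    d4 = solve-∀ ℤi-solver
    d3 : ∀ a b c k x y → (a ⊠ b) ⊠ (((k ⊠ x) ⊞ y) ⊠ c) ≡ (k ⊠ ((a ⊠ b) ⊠ (x ⊠ c))) ⊞ ((a ⊠ b) ⊠ (y ⊠ c))
    d3 = solve-∀ ℤi-solver
    d2 : ∀ a b c k x y → (a ⊠ ((k ⊠ x) ⊞ y)) ⊠ (b ⊠ c) ≡ (k ⊠ ((a ⊠ x) ⊠ (b ⊠ c))) ⊞ ((a ⊠ y) ⊠ (b ⊠ c))
    d2 = solve-∀ ℤi-solver
    d1 : ∀ a b c k x y → (((k ⊠ x) ⊞ y) ⊠ a) ⊠ (b ⊠ c) ≡ (k ⊠ ((x ⊠ a) ⊠ (b ⊠ c))) ⊞ ((y ⊠ a) ⊠ (b ⊠ c))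
    d1 = solve-∀ ℤi-solver
    z4 : ∀ a b c → (a ⊠ b) ⊠ (c ⊠ 0ᵢ) ≡ 0ᵢ
    z4 = solve-∀ ℤi-solver
    z3 : ∀ a b c → (a ⊠ b) ⊠ (0ᵢ ⊠ c) ≡ 0ᵢ
    z3 = solve-∀ ℤi-solver
    z2 : ∀ a b c → (a ⊠ 0ᵢ) ⊠ (b ⊠ c) ≡ 0ᵢ
    z2 = solve-∀ ℤi-solver
    z1 : ∀ a b c → (0ᵢ ⊠ a) ⊠ (b ⊠ c) ≡ 0ᵢ
    z1 = solve-∀ ℤi-solver

    swap₁ : ∀ a b c d → r+ 32 ⊠ ((a ⊠ b) ⊞ (c ⊠ d)) ≡ r+ 32 ⊠ ((c ⊠ d) ⊞ (b ⊠ a))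
    swap₁ a b c d = cong (r+ 32 ⊠_) (trans (⊞-comm (a ⊠ b) (c ⊠ d)) (cong ((c ⊠ d) ⊞_) (⊠-comm a b)))
    swap₂ : ∀ a b c d → r+ 32 ⊠ ((a ⊠ b) ⊞ (c ⊠ d)) ≡ r+ 32 ⊠ ((d ⊠ c) ⊞ (b ⊠ a))
    swap₂ a b c d = cong (r+ 32 ⊠_) (trans (⊞-comm (a ⊠ b) (c ⊠ d)) (cong₂ _⊞_ (⊠-comm c d) (⊠-comm a b)))
    swap₃ : ∀ a b c d → r+ 32 ⊠ ((a ⊠ b) ⊞ (c ⊠ d)) ≡ r+ 32 ⊠ ((a ⊠ b) ⊞ (d ⊠ c))
    swap₃ a b c d = cong (λ t → r+ 32 ⊠ ((a ⊠ b) ⊞ t)) (⊠-comm c d)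
    swap₄ : ∀ a b c d → r+ 32 ⊠ ((a ⊠ b) ⊞ (c ⊠ d)) ≡ r+ 32 ⊠ ((b ⊠ a) ⊞ (d ⊠ c))
    swap₄ a b c d = cong (r+ 32 ⊠_) (cong₂ _⊞_ (⊠-comm a b) (⊠-comm c d))

  -- The design identity passes from points to lattice vectors by linearity, one slot per lemma; the
  -- two left slots, treated last, are conjugate-linear.
  quartic₁ : ∀ a b c w → ∑ (λ u → (G a u ⊠ G b u) ⊠ (G u c ⊠ ⟪ w ⟫ u))
           ≡ r+ 32 ⊠ ((⟪ w ⟫ a ⊠ G b c) ⊞ (⟪ w ⟫ b ⊠ G a c))
  quartic₁ a b c [] = vanish (λ u → (G a u ⊠ G b u) ⊠ (G u c ⊠ 0ᵢ)) (G b c) (G a c) (λ u → z4 (G a u) (G b u) (G u c))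
  quartic₁ a b c ((k , d) ∷ w) = combine
    (λ u → (G a u ⊠ G b u) ⊠ (G u c ⊠ ⟪ (k , d) ∷ w ⟫ u)) (λ u → (G a u ⊠ G b u) ⊠ (G u c ⊠ G u d))
    (λ u → (G a u ⊠ G b u) ⊠ (G u c ⊠ ⟪ w ⟫ u)) k (λ u → d4 (G a u) (G b u) (G u c) k (G u d) (⟪ w ⟫ u))
    (trans (quartic a b c d) (swap₁ (G a c) (G b d) (G a d) (G b c))) (quartic₁ a b c w)

  quartic₂ : ∀ a b v w → ∑ (λ u → (G a u ⊠ G b u) ⊠ (⟪ v ⟫ u ⊠ ⟪ w ⟫ u))
           ≡ r+ 32 ⊠ ((⟪ v ⟫ a ⊠ ⟪ w ⟫ b) ⊞ (⟪ v ⟫ b ⊠ ⟪ w ⟫ a))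
  quartic₂ a b [] w = vanish (λ u → (G a u ⊠ G b u) ⊠ (0ᵢ ⊠ ⟪ w ⟫ u)) (⟪ w ⟫ b) (⟪ w ⟫ a) (λ u → z3 (G a u) (G b u) (⟪ w ⟫ u))
  quartic₂ a b ((k , c) ∷ v) w = combine
    (λ u → (G a u ⊠ G b u) ⊠ (⟪ (k , c) ∷ v ⟫ u ⊠ ⟪ w ⟫ u)) (λ u → (G a u ⊠ G b u) ⊠ (G u c ⊠ ⟪ w ⟫ u))
    (λ u → (G a u ⊠ G b u) ⊠ (⟪ v ⟫ u ⊠ ⟪ w ⟫ u)) k (λ u → d3 (G a u) (G b u) (⟪ w ⟫ u) k (G u c) (⟪ v ⟫ u))
    (trans (quartic₁ a b c w) (swap₂ (⟪ w ⟫ a) (G b c) (⟪ w ⟫ b) (G a c))) (quartic₂ a b v w)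

  quartic₃ : ∀ b v w w′ → ∑ (λ u → (conj (⟪ v ⟫ u) ⊠ G b u) ⊠ (⟪ w ⟫ u ⊠ ⟪ w′ ⟫ u))
           ≡ r+ 32 ⊠ ((⟨ v , w ⟩ ⊠ ⟪ w′ ⟫ b) ⊞ (⟨ v , w′ ⟩ ⊠ ⟪ w ⟫ b))
  quartic₃ b [] w w′ = vanish (λ u → (0ᵢ ⊠ G b u) ⊠ (⟪ w ⟫ u ⊠ ⟪ w′ ⟫ u)) (⟪ w′ ⟫ b) (⟪ w ⟫ b) (λ u → z1 (G b u) (⟪ w ⟫ u) (⟪ w′ ⟫ u))
  quartic₃ b ((k , c) ∷ v) w w′ = combine
    (λ u → (conj (⟪ (k , c) ∷ v ⟫ u) ⊠ G b u) ⊠ (⟪ w ⟫ u ⊠ ⟪ w′ ⟫ u)) (λ u → (G c u ⊠ G b u) ⊠ (⟪ w ⟫ u ⊠ ⟪ w′ ⟫ u))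
    (λ u → (conj (⟪ v ⟫ u) ⊠ G b u) ⊠ (⟪ w ⟫ u ⊠ ⟪ w′ ⟫ u)) (conj k)
    (λ u → trans (cong (λ t → (t ⊠ G b u) ⊠ (⟪ w ⟫ u ⊠ ⟪ w′ ⟫ u)) (conj-⟪⟫ k c v u))
                 (d1 (G b u) (⟪ w ⟫ u) (⟪ w′ ⟫ u) (conj k) (G c u) (conj (⟪ v ⟫ u))))
    (trans (quartic₂ c b w w′) (swap₃ (⟪ w ⟫ c) (⟪ w′ ⟫ b) (⟪ w ⟫ b) (⟪ w′ ⟫ c))) (quartic₃ b v w w′)

  quartic₄ : ∀ v v′ w w′ → ∑ (λ u → (conj (⟪ v ⟫ u) ⊠ conj (⟪ v′ ⟫ u)) ⊠ (⟪ w ⟫ u ⊠ ⟪ w′ ⟫ u))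
           ≡ r+ 32 ⊠ ((⟨ v′ , w′ ⟩ ⊠ ⟨ v , w ⟩) ⊞ (⟨ v′ , w ⟩ ⊠ ⟨ v , w′ ⟩))
  quartic₄ v [] w w′ = vanish (λ u → (conj (⟪ v ⟫ u) ⊠ 0ᵢ) ⊠ (⟪ w ⟫ u ⊠ ⟪ w′ ⟫ u)) ⟨ v , w ⟩ ⟨ v , w′ ⟩ (λ u → z2 (conj (⟪ v ⟫ u)) (⟪ w ⟫ u) (⟪ w′ ⟫ u))
  quartic₄ v ((k , c) ∷ v′) w w′ = combine
    (λ u → (conj (⟪ v ⟫ u) ⊠ conj (⟪ (k , c) ∷ v′ ⟫ u)) ⊠ (⟪ w ⟫ u ⊠ ⟪ w′ ⟫ u))
    (λ u → (conj (⟪ v ⟫ u) ⊠ G c u) ⊠ (⟪ w ⟫ u ⊠ ⟪ w′ ⟫ u))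
    (λ u → (conj (⟪ v ⟫ u) ⊠ conj (⟪ v′ ⟫ u)) ⊠ (⟪ w ⟫ u ⊠ ⟪ w′ ⟫ u)) (conj k)
    (λ u → trans (cong (λ t → (conj (⟪ v ⟫ u) ⊠ t) ⊠ (⟪ w ⟫ u ⊠ ⟪ w′ ⟫ u)) (conj-⟪⟫ k c v′ u))
                 (d2 (conj (⟪ v ⟫ u)) (⟪ w ⟫ u) (⟪ w′ ⟫ u) (conj k) (G c u) (conj (⟪ v′ ⟫ u))))
    (trans (quartic₃ c v w w′) (swap₄ ⟨ v , w ⟩ (⟪ w′ ⟫ c) ⟨ v , w′ ⟩ (⟪ w ⟫ c))) (quartic₄ v v′ w w′)

  module _ (w : Word) (unit : ⟨ w , w ⟩ ≡ r+ 3) where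
    open ≡-Reasoning

    private
      W : Fin n → ℤi
      W = ⟪ w ⟫

    ∑-norm : ∑ (λ z → conj (W z) ⊠ W z) ≡ r+ 288
    ∑-norm = trans (⟨,⟩-sum w w) (cong (r+ 96 ⊠_) unit)

    ∑-norm² : ∑ (λ z → (conj (W z) ⊠ conj (W z)) ⊠ (W z ⊠ W z)) ≡ r+ 576
    ∑-norm² = trans (quartic₄ w w w w) (cong (λ t → r+ 32 ⊠ ((t ⊠ t) ⊞ (t ⊠ t))) unit)

    -- Equality case of Cauchy–Schwarz for w and u: Σ |3 w − ⟨u,w⟩ u|² = 96 · (27 − 3 |⟨u,w⟩|²).
    defect : Fin n → Fin n → ℤi
    defect u z = (r+ 3 ⊠ W z) ⊞ neg (W u ⊠ G z u)

    ∑-defect : ∀ u → ∑ (λ z → conj (defect u z) ⊠ defect u z) ≡ r+ 2592 ⊞ (r- 288 ⊠ (conj (W u) ⊠ W u))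
    ∑-defect u = begin
      ∑ (λ z → conj (defect u z) ⊠ defect u z)
        ≡⟨ ∑-cong (λ z → trans (cong (_⊠ defect u z) (conj-defect z)) (expand a ā (W z) (conj (W z)) (G z u) (G u z))) ⟩
      ∑ (λ z → (r+ 9 ⊠ (conj (W z) ⊠ W z)) ⊞ (((r- 3 ⊠ ā) ⊠ (G u z ⊠ W z)) ⊞
               (((r- 3 ⊠ a) ⊠ (conj (W z) ⊠ G z u)) ⊞ ((ā ⊠ a) ⊠ (G u z ⊠ G z u)))))
        ≡⟨ trans (∑-linear (r+ 9) (λ z → conj (W z) ⊠ W z) t₁) (cong₂ _⊞_ (cong (r+ 9 ⊠_) ∑-norm)
            (trans (∑-linear (r- 3 ⊠ ā) (λ z → G u z ⊠ W z) t₂) (cong₂ _⊞_ (cong ((r- 3 ⊠ ā) ⊠_) (⟪⟫-reproducing w u))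
              (trans (∑-linear (r- 3 ⊠ a) (λ z → conj (W z) ⊠ G z u) t₃) (cong₂ _⊞_ (cong ((r- 3 ⊠ a) ⊠_) conj-reproducing)
                (trans (sym (*-∑ {x = ā ⊠ a} {λ z → G u z ⊠ G z u})) (cong ((ā ⊠ a) ⊠_) (∑-norm-G u)))))))) ⟩
      (r+ 9 ⊠ r+ 288) ⊞ (((r- 3 ⊠ ā) ⊠ (r+ 96 ⊠ a)) ⊞ (((r- 3 ⊠ a) ⊠ (r+ 96 ⊠ ā)) ⊞ ((ā ⊠ a) ⊠ r+ 288)))
        ≡⟨ collect a ā ⟩
      r+ 2592 ⊞ (r- 288 ⊠ (ā ⊠ a)) ∎
      where
      a ā : ℤi
      a = W u
      ā = conj (W u)
      t₁ t₂ t₃ : Fin n → ℤi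
      t₃ z = (ā ⊠ a) ⊠ (G u z ⊠ G z u)
      t₂ z = ((r- 3 ⊠ a) ⊠ (conj (W z) ⊠ G z u)) ⊞ t₃ z
      t₁ z = ((r- 3 ⊠ ā) ⊠ (G u z ⊠ W z)) ⊞ t₂ z
      conj-neg : ∀ x → conj (neg x) ≡ neg (conj x)
      conj-neg (x +i y) = refl
      conj-defect : ∀ z → conj (defect u z) ≡ (r+ 3 ⊠ conj (W z)) ⊞ neg (ā ⊠ G u z)
      conj-defect z = trans (conj-⊞ (r+ 3 ⊠ W z) (neg (a ⊠ G z u))) (cong₂ _⊞_ (conj-⊠ (r+ 3) (W z))
        (trans (conj-neg (a ⊠ G z u)) (cong neg (trans (conj-⊠ a (G z u)) (cong (ā ⊠_) (sym (G-hermitian z u)))))))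
      expand : ∀ a ā x x̄ g ḡ → ((r+ 3 ⊠ x̄) ⊞ neg (ā ⊠ ḡ)) ⊠ ((r+ 3 ⊠ x) ⊞ neg (a ⊠ g)) ≡
               (r+ 9 ⊠ (x̄ ⊠ x)) ⊞ (((r- 3 ⊠ ā) ⊠ (ḡ ⊠ x)) ⊞ (((r- 3 ⊠ a) ⊠ (x̄ ⊠ g)) ⊞ ((ā ⊠ a) ⊠ (ḡ ⊠ g))))
      expand = solve-∀ ℤi-solver
      collect : ∀ a ā → (r+ 9 ⊠ r+ 288) ⊞ (((r- 3 ⊠ ā) ⊠ (r+ 96 ⊠ a)) ⊞ (((r- 3 ⊠ a) ⊠ (r+ 96 ⊠ ā)) ⊞ ((ā ⊠ a) ⊠ r+ 288)))
              ≡ r+ 2592 ⊞ (r- 288 ⊠ (ā ⊠ a))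
      collect = solve-∀ ℤi-solver
      conj-reproducing : ∑ (λ z → conj (W z) ⊠ G z u) ≡ r+ 96 ⊠ ā
      conj-reproducing = begin
        ∑ (λ z → conj (W z) ⊠ G z u)
          ≡⟨ ∑-cong (λ z → trans (cong (conj (W z) ⊠_) (G-hermitian u z)) (trans (sym (conj-⊠ (W z) (G u z))) (cong conj (⊠-comm (W z) (G u z))))) ⟩
        ∑ (λ z → conj (G u z ⊠ W z))
          ≡⟨ conj-∑ (λ z → G u z ⊠ W z) ⟨
        conj (∑ (λ z → G u z ⊠ W z))
          ≡⟨ trans (cong conj (⟪⟫-reproducing w u)) (conj-⊠ (r+ 96) a) ⟩
        r+ 96 ⊠ ā ∎

-- Induction on the list: the term at its head is split off and set to zero in the remaining sum, so
-- repeated entries do no harm.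
re-∑-≤-length : ∀ {n} (f : Fin n → ℤi) (K : List (Fin n)) → (∀ z → re (f z) ℤ.≤ + 1) →
                (∀ z → z ∉ K → f z ≡ 0ᵢ) → re (∑ f) ℤ.≤ + length K
re-∑-≤-length f [] _ f≡0 = ℤₚ.≤-reflexive (cong re (∑-0 (λ z → f≡0 z λ ())))
re-∑-≤-length {n} f (v ∷ K) f≤1 f≡0 =
  subst (ℤ._≤ + suc (length K)) (sym (cong re total)) (ℤₚ.+-mono-≤ (at-v≤1 v) (re-∑-≤-length off K off≤1 off≡0))
  where
  on off : Fin n → ℤi
  on z = if ⌊ v ≟ z ⌋ then f z else 0ᵢ
  off z = if ⌊ v ≟ z ⌋ then 0ᵢ else f z
  split : ∀ z → f z ≡ on z ⊞ off z
  split z with v ≟ z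
  ... | yes _ = sym (trans (⊞-comm (f z) 0ᵢ) (⊞-identityˡ (f z)))
  ... | no _ = sym (⊞-identityˡ (f z))
  on-off : ∀ z → ¬ (v ≡ z) → on z ≡ 0ᵢ
  on-off z ne with v ≟ z
  ... | yes eq = contradiction eq ne
  ... | no _ = refl
  total : ∑ f ≡ on v ⊞ ∑ off
  total = trans (∑-cong split) (trans (∑-+ {f = on} {off}) (cong (_⊞ ∑ off) (∑-single v {on} on-off)))
  at-v≤1 : ∀ z → re (on z) ℤ.≤ + 1
  at-v≤1 z with v ≟ z
  ... | yes _ = f≤1 z
  ... | no _ = ℤ.+≤+ ℕ.z≤n
  off≤1 : ∀ z → re (off z) ℤ.≤ + 1
  off≤1 z with v ≟ z
  ... | yes _ = ℤ.+≤+ ℕ.z≤n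
  ... | no _ = f≤1 z
  off≡0 : ∀ z → z ∉ K → off z ≡ 0ᵢ
  off≡0 z z∉K with v ≟ z
  ... | yes _ = refl
  ... | no v≢z = f≡0 z λ { (here z≡v) → v≢z (sym z≡v) ; (there z∈K) → z∉K z∈K }

-- Parity and small norms in ℤ[i].

π : ℤi
π = (+ 1) +i (+ 1)

-- Congruence modulo the prime 1 + i of ℤ[i].
Even : ℤi → Set
Even x = ∃[ q ] x ≡ π ⊠ q

even-⊞ : ∀ {x y} → Even x → Even y → Even (x ⊞ y)
even-⊞ {x} {y} (p , x≡) (q , y≡) = p ⊞ q , trans (cong₂ _⊞_ x≡ y≡) (sym (⊠-distribˡ π p q))

even-⊠ : ∀ {x} c → Even x → Even (c ⊠ x)
even-⊠ {x} c (q , x≡) = c ⊠ q , trans (cong (c ⊠_) x≡) (l c π q)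
  where
  l : ∀ c k q → c ⊠ (k ⊠ q) ≡ k ⊠ (c ⊠ q)
  l = solve-∀ ℤi-solver

-- The difference is -2bi = -b(1 + i)², so conjugation is trivial modulo 1 + i.
even-conj : ∀ c → Even (conj c ⊞ neg c)
even-conj (a +i b) = (- b) +i (- b) , cong₂ _+i_ (l₁ a b) (l₂ b)
  where
  l₁ : ∀ a b → a ℤ.+ (- a) ≡ (+ 1) ℤ.* (- b) ℤ.- (+ 1) ℤ.* (- b)
  l₁ = solveℤ
  l₂ : ∀ b → - b ℤ.+ (- b) ≡ (+ 1) ℤ.* (- b) ℤ.+ (+ 1) ℤ.* (- b)
  l₂ = solveℤ

3-odd : ¬ Even (r+ 3)
3-odd ((a +i b) , eq) = odd ℤ.∣ a ∣ (trans (cong ℤ.∣_∣ 3≡2a) (ℤₚ.abs-* (+ 2) a))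
  where
  l : ∀ a b → ((+ 1) ℤ.* a ℤ.- (+ 1) ℤ.* b) ℤ.+ ((+ 1) ℤ.* b ℤ.+ (+ 1) ℤ.* a) ≡ (+ 2) ℤ.* a
  l = solveℤ
  3≡2a : + 3 ≡ (+ 2) ℤ.* a
  3≡2a = trans (cong (λ x → re x ℤ.+ im x) {r+ 3} {π ⊠ (a +i b)} eq) (l a b)
  odd : ∀ m → ¬ (3 ≡ 2 ℕ.* m)
  odd (suc (suc m)) eq = contradiction (trans eq (ℕₚ.*-comm 2 (suc (suc m)))) λ ()

small : Fin 7 → ℤ
small i = + toℕ i ℤ.- + 3

small-complete : ∀ a → a ℤ.* a ℤ.≤ + 9 → ∃[ i ] a ≡ small i
small-complete (+ 0) _ = 3F , refl
small-complete (+ 1) _ = 4F , refl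
small-complete (+ 2) _ = 5F , refl
small-complete (+ 3) _ = 6F , refl
small-complete -[1+ 0 ] _ = 2F , refl
small-complete -[1+ 1 ] _ = 1F , refl
small-complete -[1+ 2 ] _ = 0F , refl
small-complete (+ suc (suc (suc (suc k)))) a²≤9 = contradiction
  (ℕₚ.≤-trans (ℕₚ.*-mono-≤ (ℕₚ.m≤m+n 4 k) (ℕₚ.m≤m+n 4 k)) (ℤₚ.drop‿+≤+ (subst (ℤ._≤ + 9) (sym (ℤₚ.pos-* (4 ℕ.+ k) (4 ℕ.+ k))) a²≤9)))
  (λ { (ℕ.s≤s (ℕ.s≤s (ℕ.s≤s (ℕ.s≤s (ℕ.s≤s (ℕ.s≤s (ℕ.s≤s (ℕ.s≤s (ℕ.s≤s ()))))))))) })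
small-complete -[1+ suc (suc (suc k)) ] a²≤9 = contradiction
  (ℕₚ.≤-trans (ℕₚ.*-mono-≤ (ℕₚ.m≤m+n 4 k) (ℕₚ.m≤m+n 4 k)) (ℤₚ.drop‿+≤+ a²≤9))
  (λ { (ℕ.s≤s (ℕ.s≤s (ℕ.s≤s (ℕ.s≤s (ℕ.s≤s (ℕ.s≤s (ℕ.s≤s (ℕ.s≤s (ℕ.s≤s ()))))))))) })

smallᵢ : Fin 7 → Fin 7 → ℤi
smallᵢ i j = small i +i small j

opaque
  -- The odd norms up to 9 are 1, 5 and 9, because 3 and 7 are not sums of two squares; as 3 stays
  -- prime in ℤ[i], norm 9 occurs only for 3 times a power of i. Quotients by 1 + i stay in the same
  -- small range.
  classification : ∀ i j → norm (smallᵢ i j) ℤ.≤ + 9 →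
    (norm (smallᵢ i j) ≡ + 1 ⊎ norm (smallᵢ i j) ≡ + 5)
    ⊎ ((∃[ p ] ∃[ q ] smallᵢ i j ≡ π ⊠ smallᵢ p q)
    ⊎ (∃[ k ] (smallᵢ i j ≡ α k × norm (α k) ≡ + 9)))
  classification = from-yes (all? λ i → all? λ j → (norm (smallᵢ i j) ℤ.≤? + 9) →-dec
    (((norm (smallᵢ i j) ℤ.≟ + 1) ⊎-dec (norm (smallᵢ i j) ℤ.≟ + 5)) ⊎-dec
     ((any? λ p → any? λ q → smallᵢ i j ≟ᵢ (π ⊠ smallᵢ p q)) ⊎-dec
      (any? λ k → (smallᵢ i j ≟ᵢ α k) ×-dec (norm (α k) ℤ.≟ + 9)))))

small-odd-norm : ∀ x → norm x ℤ.≤ + 9 → ¬ Even x →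
  (norm x ≡ + 1 ⊎ norm x ≡ + 5) ⊎ (∃[ k ] (x ≡ α k × norm (α k) ≡ + 9))
small-odd-norm (a +i b) norm≤9 odd with small-complete a (ℤₚ.≤-trans (subst (ℤ._≤ norm (a +i b)) (ℤₚ.+-identityʳ _) (ℤₚ.+-monoʳ-≤ (a ℤ.* a) (square-nonneg b))) norm≤9)
                               | small-complete b (ℤₚ.≤-trans (subst (ℤ._≤ norm (a +i b)) (ℤₚ.+-identityˡ _) (ℤₚ.+-monoˡ-≤ (b ℤ.* b) (square-nonneg a))) norm≤9)
... | i , refl | j , refl with classification i j norm≤9
... | inj₁ small-norm = inj₁ small-norm
... | inj₂ (inj₁ (p , q , eq)) = contradiction (smallᵢ p q , eq) odd
... | inj₂ (inj₂ large) = inj₂ large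

opaque
  α-odd : ∀ j → ∃[ p ] ∃[ q ] α j ⊞ neg 1ᵢ ≡ π ⊠ smallᵢ p q
  α-odd = from-yes (all? λ j → any? λ p → any? λ q → (α j ⊞ neg 1ᵢ) ≟ᵢ (π ⊠ smallᵢ p q))

  intersectionNumber-opposite : ∀ k → 0 ℕ.< pᵏ k (opposite k) 0F
  intersectionNumber-opposite = from-yes (all? λ k → 0 ℕ.<? pᵏ k (opposite k) 0F)

even-α : ∀ j → Even (α j ⊞ neg 1ᵢ)
even-α j = let p , q , eq = α-odd j in smallᵢ p q , eq

-- Every lattice vector of norm 3 is a point.

module Closure {n : ℕ} (C : Configuration n) where
  open Configuration C
  open Lattice C
  open DecMembership (_≟_ {n}) using (_∈?_)

  opaque
    -- The intersection number is a sum of zeros and ones over all z. Were every solution in `K`, it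
    -- would be at most `length K`.
    new-point : ∀ x y a b (K : List (Fin n)) → length K ℕ.< pᵏ a b (s x y) →
                ∃[ z ] (s x z ≡ a × s z y ≡ b × z ∉ K)
    new-point x y a b K K<p with any? (λ z → (s x z ≟ a) ×-dec (s z y ≟ b) ×-dec ¬? (z ∈? K))
    ... | yes found = found
    ... | no none = contradiction
      (ℤₚ.drop‿+≤+ (subst (ℤ._≤ + length K) (cong re (convolution [ a ] [ b ] (intersectionNumber a b) (convolves-indicator a b) x y))
        (re-∑-≤-length t K t≤1 t≡0)))
      (ℕₚ.<⇒≱ K<p)
      where
      t : Fin n → ℤi
      t z = [ a ] (s x z) ⊠ [ b ] (s z y)
      t≤1 : ∀ z → re (t z) ℤ.≤ + 1
      t≤1 z with a ≟ s x z | b ≟ s z y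
      ... | yes _ | yes _ = ℤ.+≤+ (ℕ.s≤s ℕ.z≤n)
      ... | yes _ | no _ = ℤ.+≤+ ℕ.z≤n
      ... | no _ | yes _ = ℤ.+≤+ ℕ.z≤n
      ... | no _ | no _ = ℤ.+≤+ ℕ.z≤n
      t≡0 : ∀ z → z ∉ K → t z ≡ 0ᵢ
      t≡0 z z∉K with a ≟ s x z | b ≟ s z y
      ... | yes a≡ | yes b≡ = contradiction (z , sym a≡ , sym b≡ , z∉K) none
      ... | yes _ | no _ = refl
      ... | no _ | yes _ = refl
      ... | no _ | no _ = refl

  opaque
    neighbour : ∀ u k → ∃[ v ] s u v ≡ k
    neighbour u k =
      let v , suv≡k , _ = new-point u u k (opposite k) []
                            (subst (λ t → 0 ℕ.< pᵏ k (opposite k) t) (sym (diagonal u)) (intersectionNumber-opposite k))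
      in v , suv≡k

  coefficientSum : Word → ℤi
  coefficientSum [] = 0ᵢ
  coefficientSum ((c , _) ∷ w) = c ⊞ coefficientSum w

  -- All inner products of points are 1 modulo 1 + i, so modulo 1 + i a word acts through its
  -- coefficient sum alone, whatever u is.
  ⟪⟫-parity : ∀ w u → Even (⟪ w ⟫ u ⊞ neg (coefficientSum w))
  ⟪⟫-parity [] u = 0ᵢ , refl
  ⟪⟫-parity ((c , x) ∷ w) u = subst Even (l c (G u x) (⟪ w ⟫ u) (coefficientSum w))
    (even-⊞ (even-⊠ c (even-α (s u x))) (⟪⟫-parity w u))
    where
    l : ∀ c g y t → (c ⊠ (g ⊞ neg 1ᵢ)) ⊞ (y ⊞ neg t) ≡ ((c ⊠ g) ⊞ y) ⊞ neg (c ⊞ t)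
    l = solve-∀ ℤi-solver

  ⟨,⟩-parity : ∀ v w → Even (⟨ v , w ⟩ ⊞ neg (coefficientSum v ⊠ coefficientSum w))
  ⟨,⟩-parity [] w = 0ᵢ , l (coefficientSum w)
    where
    l : ∀ t → 0ᵢ ⊞ neg (0ᵢ ⊠ t) ≡ π ⊠ 0ᵢ
    l = solve-∀ ℤi-solver
  ⟨,⟩-parity ((c , x) ∷ v) w = subst Even (l c (conj c) (⟪ w ⟫ x) (coefficientSum w) ⟨ v , w ⟩ (coefficientSum v))
    (even-⊞ (even-⊞ (even-⊠ (conj c) (⟪⟫-parity w x)) (even-⊠ (coefficientSum w) (even-conj c))) (⟨,⟩-parity v w))
    where
    l : ∀ c c̄ y t i s → ((c̄ ⊠ (y ⊞ neg t)) ⊞ (t ⊠ (c̄ ⊞ neg c))) ⊞ (i ⊞ neg (s ⊠ t)) ≡ ((c̄ ⊠ y) ⊞ i) ⊞ neg ((c ⊞ s) ⊠ t)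
    l = solve-∀ ℤi-solver

  -- A single even value would make the coefficient sum t even, and then ⟨w,w⟩, which is t² modulo 1
  -- + i, would be even instead of 3.
  odd-values : ∀ w → ⟨ w , w ⟩ ≡ r+ 3 → ∀ u → ¬ Even (⟪ w ⟫ u)
  odd-values w unit u even = 3-odd (subst Even (l₂ (r+ 3) (t ⊠ t))
    (even-⊞ (subst (λ i → Even (i ⊞ neg (t ⊠ t))) unit (⟨,⟩-parity w w)) (even-⊠ t t-even)))
    where
    t = coefficientSum w
    l₁ : ∀ y t → y ⊞ (neg 1ᵢ ⊠ (y ⊞ neg t)) ≡ t
    l₁ = solve-∀ ℤi-solver
    l₂ : ∀ x y → (x ⊞ neg y) ⊞ y ≡ x
    l₂ = solve-∀ ℤi-solver
    t-even : Even t
    t-even = subst Even (l₁ (⟪ w ⟫ u) t) (even-⊞ even (even-⊠ (neg 1ᵢ) (⟪⟫-parity w u)))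

  private
    defect-value : ∀ m → + 2592 ℤ.+ ((- (+ 288)) ℤ.* m ℤ.- (+ 0) ℤ.* (+ 0)) ≡ + 288 ℤ.* (+ 9 ℤ.- m)
    defect-value = solveℤ

  -- Cauchy-Schwarz: `∑-defect` is a sum of norms and equals 288·(9 - |⟨u,w⟩|²). The equality case
  -- is `parallel`.
  norm≤9 : ∀ w → ⟨ w , w ⟩ ≡ r+ 3 → ∀ u → norm (⟪ w ⟫ u) ℤ.≤ + 9
  norm≤9 w unit u = ℤₚ.0≤i-j⇒j≤i (ℤₚ.*-cancelˡ-≤-pos 0ℤ _ (+ 288) (subst (0ℤ ℤ.≤_)
    (trans (cong re (trans (∑-defect w unit u) (cong (λ t → r+ 2592 ⊞ (r- 288 ⊠ t)) (conj-⊠-self (⟪ w ⟫ u)))))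
      (defect-value (norm (⟪ w ⟫ u))))
    (re-∑-nonneg _ (λ z → re-norm-nonneg (defect w unit u z)))))

  parallel : ∀ w → ⟨ w , w ⟩ ≡ r+ 3 → ∀ u → norm (⟪ w ⟫ u) ≡ + 9 → ∀ z → r+ 3 ⊠ ⟪ w ⟫ z ≡ ⟪ w ⟫ u ⊠ G z u
  parallel w unit u norm≡9 z = begin
    r+ 3 ⊠ ⟪ w ⟫ z
      ≡⟨ l (r+ 3 ⊠ ⟪ w ⟫ z) (⟪ w ⟫ u ⊠ G z u) ⟩
    defect w unit u z ⊞ (⟪ w ⟫ u ⊠ G z u)
      ≡⟨ cong (_⊞ (⟪ w ⟫ u ⊠ G z u)) (∑-norm-zero (defect w unit u) total z) ⟩
    0ᵢ ⊞ (⟪ w ⟫ u ⊠ G z u)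
      ≡⟨ ⊞-identityˡ _ ⟩
    ⟪ w ⟫ u ⊠ G z u ∎
    where
    open ≡-Reasoning
    l : ∀ x y → x ≡ (x ⊞ neg y) ⊞ y
    l = solve-∀ ℤi-solver
    total : ∑ (λ z → conj (defect w unit u z) ⊠ defect w unit u z) ≡ 0ᵢ
    total = trans (∑-defect w unit u) (cong (λ t → r+ 2592 ⊞ (r- 288 ⊠ t))
      (trans (conj-⊠-self (⟪ w ⟫ u)) (cong (_+i 0ℤ) norm≡9)))

  point : Fin n → Word
  point v = (1ᵢ , v) ∷ []

  ⟪point⟫ : ∀ v u → ⟪ point v ⟫ u ≡ G u v
  ⟪point⟫ v u = l (G u v)
    where
    l : ∀ x → (1ᵢ ⊠ x) ⊞ 0ᵢ ≡ x
    l = solve-∀ ℤi-solver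

  point-unit : ∀ v → ⟨ point v , point v ⟩ ≡ r+ 3
  point-unit v = cong (λ t → (1ᵢ ⊠ ((1ᵢ ⊠ t) ⊞ 0ᵢ)) ⊞ 0ᵢ) (G-diagonal v)

  cancel-3 : ∀ {x y} → r+ 3 ⊠ x ≡ r+ 3 ⊠ y → x ≡ y
  cancel-3 {a +i b} {c +i d} eq = cong₂ _+i_
    (ℤₚ.*-cancelˡ-≡ (+ 3) a c (trans (sym (l₁ a b)) (trans (cong re eq) (l₁ c d))))
    (ℤₚ.*-cancelˡ-≡ (+ 3) b d (trans (sym (l₂ a b)) (trans (cong im eq) (l₂ c d))))
    where
    l₁ : ∀ a b → (+ 3) ℤ.* a ℤ.- (+ 0) ℤ.* b ≡ (+ 3) ℤ.* a
    l₁ = solveℤ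
    l₂ : ∀ a b → (+ 3) ℤ.* b ℤ.+ (+ 0) ℤ.* a ≡ (+ 3) ℤ.* b
    l₂ = solveℤ

  private
    quadratic : ℤi → ℤi
    quadratic x = (r+ 1 ⊠ ((conj x ⊠ conj x) ⊠ (x ⊠ x))) ⊞ ((r- 6 ⊠ (conj x ⊠ x)) ⊞ (r+ 5 ⊠ 1ᵢ))

    quadratic-zero : ∀ x → norm x ≡ + 1 ⊎ norm x ≡ + 5 → quadratic x ≡ 0ᵢ
    quadratic-zero x h = trans (l (conj x) x) (trans (cong q (conj-⊠-self x)) (vanishes h))
      where
      q : ℤi → ℤi
      q t = (t ⊠ t) ⊞ ((r- 6 ⊠ t) ⊞ r+ 5)
      l : ∀ x̄ x → (r+ 1 ⊠ ((x̄ ⊠ x̄) ⊠ (x ⊠ x))) ⊞ ((r- 6 ⊠ (x̄ ⊠ x)) ⊞ (r+ 5 ⊠ 1ᵢ))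
                ≡ ((x̄ ⊠ x) ⊠ (x̄ ⊠ x)) ⊞ ((r- 6 ⊠ (x̄ ⊠ x)) ⊞ r+ 5)
      l = solve-∀ ℤi-solver
      vanishes : norm x ≡ + 1 ⊎ norm x ≡ + 5 → q (norm x +i 0ℤ) ≡ 0ᵢ
      vanishes (inj₁ eq) = cong (λ t → q (t +i 0ℤ)) eq
      vanishes (inj₂ eq) = cong (λ t → q (t +i 0ℤ)) eq

  -- The values |⟨u,w⟩|² are odd sums of two squares at most 9, and Σ (t − 1)(t − 5) = 128 > 0 forces a value 9.
  opaque
    maximal-value : ∀ w → ⟨ w , w ⟩ ≡ r+ 3 → ∃[ u ] ∃[ k ] (⟪ w ⟫ u ≡ α k × norm (α k) ≡ + 9)
    maximal-value w unit = search (any? λ u → any? λ k → (W u ≟ᵢ α k) ×-dec (norm (α k) ℤ.≟ + 9))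
      where
      W : Fin n → ℤi
      W = ⟪ w ⟫
      Maximal : Set
      Maximal = ∃[ u ] ∃[ k ] (W u ≡ α k × norm (α k) ≡ + 9)
      total : ∑ (λ u → quadratic (W u)) ≡ r+ 128
      total = trans (∑-linear (r+ 1) (λ u → (conj (W u) ⊠ conj (W u)) ⊠ (W u ⊠ W u)) (λ u → (r- 6 ⊠ (conj (W u) ⊠ W u)) ⊞ (r+ 5 ⊠ 1ᵢ)))
        (cong₂ (λ a b → (r+ 1 ⊠ a) ⊞ b) (∑-norm² w unit)
          (trans (∑-linear (r- 6) (λ u → conj (W u) ⊠ W u) (λ _ → r+ 5 ⊠ 1ᵢ))
            (cong₂ (λ a b → (r- 6 ⊠ a) ⊞ b) (∑-norm w unit) (∑-const (r+ 5 ⊠ 1ᵢ)))))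
      sum-zero : (∀ u → norm (W u) ≡ + 1 ⊎ norm (W u) ≡ + 5) → ∑ (λ u → quadratic (W u)) ≡ 0ᵢ
      sum-zero h = ∑-0 {f = λ u → quadratic (W u)} (λ u → quadratic-zero (W u) (h u))
      not-zero : ¬ (∑ (λ u → quadratic (W u)) ≡ 0ᵢ)
      not-zero eq = contradiction (cong re (trans (sym total) eq)) λ ()
      search : Dec Maximal → Maximal
      search (yes found) = found
      search (no none) = contradiction (sum-zero
        λ u → [ (λ h → h) , (λ (k , h) → contradiction (u , k , h) none) ]′
                 (small-odd-norm (W u) (norm≤9 w unit u) (odd-values w unit u)))
        not-zero

  opaque
    -- At the maximal value, w is a unit multiple of the point u. The neighbour v of u with the same
    -- inner product is parallel to u with the same factor, so it has the inner products of w with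
    -- all points.
    closure : ∀ w → ⟨ w , w ⟩ ≡ r+ 3 → ∃[ v ] (∀ z → G z v ≡ ⟪ w ⟫ z)
    closure w unit =
      let u , k , Wu≡ , norm≡9 = maximal-value w unit
          v , suv≡k = neighbour u k
          value : ⟪ point v ⟫ u ≡ α k
          value = trans (⟪point⟫ v u) (cong α suv≡k)
      in v , λ z → cancel-3 (begin
        r+ 3 ⊠ G z v
          ≡⟨ cong (r+ 3 ⊠_) (⟪point⟫ v z) ⟨
        r+ 3 ⊠ ⟪ point v ⟫ z
          ≡⟨ parallel (point v) (point-unit v) u (trans (cong norm value) norm≡9) z ⟩
        ⟪ point v ⟫ u ⊠ G z u
          ≡⟨ cong (_⊠ G z u) (trans value (sym Wu≡)) ⟩
        ⟪ w ⟫ u ⊠ G z u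
          ≡⟨ parallel w unit u (trans (cong norm Wu≡) norm≡9) z ⟨
        r+ 3 ⊠ ⟪ w ⟫ z ∎)
      where
      open ≡-Reasoning

-- Searching through Gram matrices

Row : Set
Row = List ℤi

infix 4 _≟ᵣ_
_≟ᵣ_ : (p q : Row) → Dec (p ≡ q)
_≟ᵣ_ = List-≡-dec _≟ᵢ_

-- Decimal digits of a row, the last digit first; missing leading digits are zero.
digit : ℕ → ℤi
digit 1 = r+ 1
digit 2 = i+ 1
digit 3 = r- 1
digit 4 = i- 1
digit 5 = (+ 1) +i (+ 1)
digit 6 = (- (+ 1)) +i (+ 1)
digit 7 = (- (+ 1)) +i (- (+ 1))
digit 8 = (+ 1) +i (- (+ 1))
digit 9 = r+ 2
digit _ = 0ᵢ

row : ℕ → Row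
-- Nine digits suffice: the largest frame has eight vectors, and outcomes add the new point.
row = go 9
  where
  go : ℕ → ℕ → Row
  go (suc fuel) m@(suc _) = digit (m % 10) ∷ go fuel (m / 10)
  go _ _ = []

-- The lower triangle of a Gram matrix with diagonal 3; the newest vector comes first.
Gram : Set
Gram = List Row

-- ⟨c,p⟩ = Σ c̄ᵢ pᵢ, lists being padded by zeros.
dot : Row → Row → ℤi
dot (c ∷ cs) (p ∷ ps) = (conj c ⊠ p) ⊞ dot cs ps
dot _ _ = 0ᵢ

_·_ : Gram → Row → Row
[] · _ = []
(q ∷ M) · [] = 0ᵢ ∷ (M · [])
(q ∷ M) · (c ∷ cs) = ((c ⊠ r+ 3) ⊞ conj (dot cs q)) ∷ zipWith (λ qⱼ m → (c ⊠ qⱼ) ⊞ m) q (M · cs)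

IsUnit : Gram → Row → Set
IsUnit M c = dot c (M · c) ≡ r+ 3

isUnit? : ∀ M c → Dec (IsUnit M c)
isUnit? M c = dot c (M · c) ≟ᵢ r+ 3

units : List ℤi
units = r+ 1 ∷ i+ 1 ∷ r- 1 ∷ i- 1 ∷ []

-- A Gram matrix together with coefficient vectors of further points, each stored at the newest of its vectors.
Frame : Set
Frame = List (Row × List Row)

gram : Frame → Gram
gram = map proj₁

elements : Frame → List Row
elements [] = []
elements ((_ , els) ∷ F) = (r+ 1 ∷ []) ∷ els ++ map (0ᵢ ∷_) (elements F)

HasUnitValue : Row → Row → Set
HasUnitValue p c = norm (dot c p) ≡ + 1

hasUnitValue? : ∀ p c → Dec (HasUnitValue p c)
hasUnitValue? p c = norm (dot c p) ℤ.≟ + 1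

-- All inner products with the elements are powers of i unless the point is proportional to one of them.
unitPatterns : Frame → List Row
unitPatterns [] = [] ∷ []
unitPatterns ((_ , els) ∷ F) =
  filter (λ p → All.all? (hasUnitValue? p) els) (cartesianProductWith _∷_ units (unitPatterns F))

-- The patterns of the exceptional points: unit multiples of a known element, whose inner product
-- with that element has norm 9.
multiples : Gram → List Row → List Row
multiples M els = cartesianProductWith (λ ε c → map (ε ⊠_) (M · c)) units els

candidates : Frame → List Row
candidates F = unitPatterns F ++ multiples (gram F) (elements F)

-- How to continue from a pattern of inner products with a new point: two points with an impossible
-- inner product, or points realizing one of the later Gram matrices.
data Outcome : Set where
  dead : ℕ → ℕ → Outcome
  next : ℕ → List ℕ → Outcome

-- The new point z has ⟨a,z⟩ = 1 and ⟨b,z⟩ = α j, where ⟨a,b⟩ = α l, and differs from the exceptions.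
record Stage : Set where
  constructor stage
  no-eta-equality
  field
    frame : Frame
    a b : Row
    l j : Fin 8
    exceptions : List Row
    outcomes : List Outcome

-- The vectors `cs` need not belong to the frame of `N`: having norm 3, they are points by
-- `closure`. A search step may therefore replace the whole frame.
Matches : Gram → Gram → List Row → Set
Matches N [] [] = ⊤
Matches N (q ∷ M) (c ∷ cs) = IsUnit N c × map (λ d → dot d (N · c)) cs ≡ q × Matches N M cs
Matches N _ _ = ⊥

matches? : ∀ N M cs → Dec (Matches N M cs)
matches? N [] [] = yes tt
matches? N (q ∷ M) (c ∷ cs) = isUnit? N c ×-dec (map (λ d → dot d (N · c)) cs ≟ᵣ q) ×-dec matches? N M cs
matches? N [] (_ ∷ _) = no λ ()
matches? N (_ ∷ _) [] = no λ ()

Reaches : List Gram → ℕ → Gram → List Row → Set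
Reaches [] _ _ _ = ⊥
Reaches (M ∷ _) 0 N cs = Matches N M cs
Reaches (_ ∷ Ms) (suc i) N cs = Reaches Ms i N cs

reaches? : ∀ Ms i N cs → Dec (Reaches Ms i N cs)
reaches? [] _ _ _ = no λ ()
reaches? (M ∷ _) 0 N cs = matches? N M cs
reaches? (_ ∷ Ms) (suc i) N cs = reaches? Ms i N cs

Valid : List Gram → Gram → Outcome → Set
Valid Ms N (dead c d) = IsUnit N (row c) × IsUnit N (row d) ×
  ¬ (norm (dot (row c) (N · row d)) ≡ + 1 ⊎ norm (dot (row c) (N · row d)) ≡ + 9)
Valid Ms N (next i cs) = Reaches Ms i N (map row cs)

valid? : ∀ Ms N o → Dec (Valid Ms N o)
valid? Ms N (dead c d) = isUnit? N (row c) ×-dec isUnit? N (row d) ×-dec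
  ¬? ((norm (dot (row c) (N · row d)) ℤ.≟ + 1) ⊎-dec (norm (dot (row c) (N · row d)) ℤ.≟ + 9))
valid? Ms N (next i cs) = reaches? Ms i N (map row cs)

-- Outcomes are paired with patterns by position in the enumeration; unequal lengths are rejected,
-- so no pattern escapes.
Covers : List Gram → Gram → List Row → List Outcome → Set
Covers Ms M [] [] = ⊤
Covers Ms M (p ∷ ps) (o ∷ os) = Valid Ms (p ∷ M) o × Covers Ms M ps os
Covers Ms M _ _ = ⊥

covers? : ∀ Ms M ps os → Dec (Covers Ms M ps os)
covers? Ms M [] [] = yes tt
covers? Ms M (p ∷ ps) (o ∷ os) = valid? Ms (p ∷ M) o ×-dec covers? Ms M ps os
covers? Ms M [] (_ ∷ _) = no λ ()
covers? Ms M (_ ∷ _) [] = no λ ()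

module _ (S : Stage) where
  open Stage S

  Admissible : Row → Set
  Admissible p = dot a p ≡ r+ 1 × dot b p ≡ α j × All (λ c → ¬ (dot c p ≡ r+ 3)) exceptions

  admissible? : ∀ p → Dec (Admissible p)
  admissible? p = (dot a p ≟ᵢ r+ 1) ×-dec (dot b p ≟ᵢ α j) ×-dec All.all? (λ c → ¬? (dot c p ≟ᵢ r+ 3)) exceptions

  record Sound (Ms : List Gram) : Set where
    constructor sound
    field
      checks : All (IsUnit (gram frame)) (elements frame) × IsUnit (gram frame) a × IsUnit (gram frame) b
             × dot a (gram frame · b) ≡ α l × All (IsUnit (gram frame)) exceptions
             -- The intersection number reads the relations from a to z and from z to b, hence the
             -- opposite of the prescribed relation `j` from b to z. Strict inequality leaves a
             -- point outside the exceptions.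
             × length exceptions ℕ.< pᵏ 4F (opposite j) l
      covers : Covers Ms (gram frame) (filter admissible? (candidates frame)) outcomes

  sound? : ∀ Ms → Dec (Sound Ms)
  sound? Ms with (All.all? (isUnit? (gram frame)) (elements frame) ×-dec isUnit? (gram frame) a ×-dec isUnit? (gram frame) b
             ×-dec (dot a (gram frame · b) ≟ᵢ α l) ×-dec All.all? (isUnit? (gram frame)) exceptions
             ×-dec (length exceptions ℕ.<? pᵏ 4F (opposite j) l))
             | covers? Ms (gram frame) (filter admissible? (candidates frame)) outcomes
  ... | yes c | yes d = yes (sound c d)
  ... | no ¬c | _ = no (¬c ∘ Sound.checks)
  ... | yes _ | no ¬d = no (¬d ∘ Sound.covers)

opaque
  norm-α : ∀ j → norm (α j) ≡ + 1 ⊎ norm (α j) ≡ + 9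
  norm-α = from-yes (all? λ j → (norm (α j) ℤ.≟ + 1) ⊎-dec (norm (α j) ℤ.≟ + 9))

  unit-multiple : ∀ j → norm (α j) ≡ + 9 → ∃[ i ] (α j ≡ r+ 3 ⊠ α i × norm (α i) ≡ + 1)
  unit-multiple = from-yes (all? λ j → (norm (α j) ℤ.≟ + 9) →-dec (any? λ i → (α j ≟ᵢ (r+ 3 ⊠ α i)) ×-dec (norm (α i) ℤ.≟ + 1)))

  opposite-involutive : ∀ j → opposite (opposite j) ≡ j
  opposite-involutive = from-yes (all? λ j → opposite (opposite j) ≟ j)

α∈units : ∀ j → norm (α j) ≡ + 1 → α j ∈ units
α∈units 4F _ = here refl
α∈units 5F _ = there (here refl)
α∈units 6F _ = there (there (here refl))
α∈units 7F _ = there (there (there (here refl)))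

-- From computations with Gram matrices to points of the configuration.

module Realization {n : ℕ} (C : Configuration n) where
  open Configuration C
  open Lattice C
  open Closure C

  Realizes : Gram → List (Fin n) → Set
  Realizes [] [] = ⊤
  Realizes (q ∷ M) (z ∷ ω) = map (λ x → G x z) ω ≡ q × Realizes M ω
  Realizes _ _ = ⊥

  word : Row → List (Fin n) → Word
  word (c ∷ cs) (x ∷ ω) = (c , x) ∷ word cs ω
  word _ _ = []

  ⟨word,⟩ : ∀ c ω w → ⟨ word c ω , w ⟩ ≡ dot c (map ⟪ w ⟫ ω)
  ⟨word,⟩ [] [] w = refl
  ⟨word,⟩ [] (x ∷ ω) w = refl
  ⟨word,⟩ (c ∷ cs) [] w = refl
  ⟨word,⟩ (c ∷ cs) (x ∷ ω) w = cong ((conj c ⊠ ⟪ w ⟫ x) ⊞_) (⟨word,⟩ cs ω w)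

  conj-⟪word⟫ : ∀ c ω z → conj (⟪ word c ω ⟫ z) ≡ dot c (map (λ x → G x z) ω)
  conj-⟪word⟫ [] [] z = refl
  conj-⟪word⟫ [] (x ∷ ω) z = refl
  conj-⟪word⟫ (c ∷ cs) [] z = refl
  conj-⟪word⟫ (c ∷ cs) (x ∷ ω) z = trans (conj-⟪⟫ c x (word cs ω) z) (cong ((conj c ⊠ G x z) ⊞_) (conj-⟪word⟫ cs ω z))

  private
    zipWith-map : ∀ {A : Set} (f : ℤi → ℤi → ℤi) (g h k : A → ℤi) → (∀ x → f (g x) (h x) ≡ k x) →
                  ∀ xs → zipWith f (map g xs) (map h xs) ≡ map k xs
    zipWith-map f g h k eq [] = refl
    zipWith-map f g h k eq (x ∷ xs) = cong₂ _∷_ (eq x) (zipWith-map f g h k eq xs)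

  gram-product : ∀ M ω → Realizes M ω → ∀ c → map ⟪ word c ω ⟫ ω ≡ M · c
  gram-product [] [] _ c = refl
  gram-product (q ∷ M) (z ∷ ω) (_ , real) [] = cong (0ᵢ ∷_) (trans (cong (λ w → map ⟪ w ⟫ ω) (sym (word-[] ω))) (gram-product M ω real []))
    where
    word-[] : ∀ ω → word [] ω ≡ []
    word-[] [] = refl
    word-[] (_ ∷ _) = refl
  gram-product (q ∷ M) (z ∷ ω) (refl , real) (c ∷ cs) = cong₂ _∷_
    (cong₂ (λ g t → (c ⊠ g) ⊞ t) (G-diagonal z) (trans (sym (conj-conj (⟪ word cs ω ⟫ z))) (cong conj (conj-⟪word⟫ cs ω z))))
    (trans (sym (zipWith-map (λ qⱼ m → (c ⊠ qⱼ) ⊞ m) (λ x → G x z) ⟪ word cs ω ⟫ (λ x → (c ⊠ G x z) ⊞ ⟪ word cs ω ⟫ x) (λ _ → refl) ω))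
           (cong (zipWith (λ qⱼ m → (c ⊠ qⱼ) ⊞ m) q) (gram-product M ω real cs)))

  module _ {M : Gram} {ω : List (Fin n)} (real : Realizes M ω) where

    word-unit : ∀ c → IsUnit M c → ⟨ word c ω , word c ω ⟩ ≡ r+ 3
    word-unit c unit = trans (⟨word,⟩ c ω (word c ω)) (trans (cong (dot c) (gram-product M ω real c)) unit)

    vertex : ∀ c → IsUnit M c → Fin n
    vertex c unit = proj₁ (closure (word c ω) (word-unit c unit))

    G-vertexʳ : ∀ c unit z → G z (vertex c unit) ≡ ⟪ word c ω ⟫ z
    G-vertexʳ c unit = proj₂ (closure (word c ω) (word-unit c unit))

    G-vertexˡ : ∀ c unit z → G (vertex c unit) z ≡ dot c (map (λ x → G x z) ω)
    G-vertexˡ c unit z = trans (G-hermitian z (vertex c unit)) (trans (cong conj (G-vertexʳ c unit z)) (conj-⟪word⟫ c ω z))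

    map-G-vertex : ∀ c unit → map (λ x → G x (vertex c unit)) ω ≡ M · c
    map-G-vertex c unit = trans (map-cong ω) (gram-product M ω real c)
      where
      map-cong : ∀ xs → map (λ x → G x (vertex c unit)) xs ≡ map ⟪ word c ω ⟫ xs
      map-cong [] = refl
      map-cong (x ∷ xs) = cong₂ _∷_ (G-vertexʳ c unit x) (map-cong xs)

    G-vertex-vertex : ∀ c d uc ud → G (vertex c uc) (vertex d ud) ≡ dot c (M · d)
    G-vertex-vertex c d uc ud = trans (G-vertexˡ c uc (vertex d ud)) (cong (dot c) (map-G-vertex d ud))

    matches : ∀ M′ cs → Matches M M′ cs → ∃[ ω′ ] Realizes M′ ω′
    matches M′ cs m = points M′ cs m , realized M′ cs m
      where
      points : ∀ M′ cs → Matches M M′ cs → List (Fin n)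
      points [] [] _ = []
      points (q ∷ M′) (c ∷ cs) (unit , _ , m) = vertex c unit ∷ points M′ cs m
      rows : ∀ M′ cs m c unit → map (λ x → G x (vertex c unit)) (points M′ cs m) ≡ map (λ d → dot d (M · c)) cs
      rows [] [] m c unit = refl
      rows (q ∷ M′) (d ∷ cs) (ud , _ , m) c unit = cong₂ _∷_ (G-vertex-vertex d c ud unit) (rows M′ cs m c unit)
      realized : ∀ M′ cs m → Realizes M′ (points M′ cs m)
      realized [] [] m = tt
      realized (q ∷ M′) (c ∷ cs) (unit , row≡q , m) = trans (rows M′ cs m c unit) row≡q , realized M′ cs m

    norm-G : ∀ x y → norm (G x y) ≡ + 1 ⊎ norm (G x y) ≡ + 9
    norm-G x y = norm-α (s x y)

    reaches : ∀ Ms i cs → Reaches Ms i M cs → ∃[ M′ ] (M′ ∈ Ms × ∃[ ω′ ] Realizes M′ ω′)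
    reaches (M′ ∷ _) 0 cs m = M′ , here refl , matches M′ cs m
    reaches (_ ∷ Ms) (suc i) cs r with reaches Ms i cs r
    ... | M′ , M′∈ , real′ = M′ , there M′∈ , real′

    valid : ∀ Ms o → Valid Ms M o → ∃[ M′ ] (M′ ∈ Ms × ∃[ ω′ ] Realizes M′ ω′)
    valid Ms (dead c d) (uc , ud , impossible) = contradiction
      (subst (λ t → norm t ≡ + 1 ⊎ norm t ≡ + 9) (G-vertex-vertex (row c) (row d) uc ud)
        (norm-G (vertex (row c) uc) (vertex (row d) ud))) impossible
    valid Ms (next i cs) r = reaches Ms i (map row cs) r

    vertices : ∀ cs → All (IsUnit M) cs → List (Fin n)
    vertices [] [] = []
    vertices (c ∷ cs) (u ∷ us) = vertex c u ∷ vertices cs us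

    length-vertices : ∀ cs us → length (vertices cs us) ≡ length cs
    length-vertices [] [] = refl
    length-vertices (c ∷ cs) (u ∷ us) = cong suc (length-vertices cs us)

    avoids : ∀ cs us z → z ∉ vertices cs us → All (λ c → ¬ (dot c (map (λ x → G x z) ω) ≡ r+ 3)) cs
    avoids [] [] z _ = []
    avoids (c ∷ cs) (u ∷ us) z z∉ = (λ eq → z∉ (here (sym (G≡3⇒≡ (trans (G-vertexˡ c u z) eq)))))
      ∷ avoids cs us z (z∉ ∘ there)

    -- Norm 9 is the equality case of Cauchy-Schwarz, so z is a unit multiple of the vertex and its
    -- pattern is that multiple of the vertex's pattern.
    proportional : ∀ c (u : IsUnit M c) z → norm (G (vertex c u) z) ≡ + 9 →
                   ∃[ ε ] (ε ∈ units × map (λ x → G x z) ω ≡ map (ε ⊠_) (M · c))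
    proportional c u z norm≡9 with unit-multiple (s (vertex c u) z) norm≡9
    ... | i , α≡ , ni = α i , α∈units i ni , trans (pointwise ω) (cong (map (α i ⊠_)) (map-G-vertex c u))
      where
      at : ∀ y → G y z ≡ α i ⊠ G y (vertex c u)
      at y = cancel-3 (begin
        r+ 3 ⊠ G y z
          ≡⟨ cong (r+ 3 ⊠_) (⟪point⟫ z y) ⟨
        r+ 3 ⊠ ⟪ point z ⟫ y
          ≡⟨ parallel (point z) (point-unit z) (vertex c u) (trans (cong norm (⟪point⟫ z (vertex c u))) norm≡9) y ⟩
        ⟪ point z ⟫ (vertex c u) ⊠ G y (vertex c u)
          ≡⟨ cong (_⊠ G y (vertex c u)) (trans (⟪point⟫ z (vertex c u)) α≡) ⟩
        (r+ 3 ⊠ α i) ⊠ G y (vertex c u)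
          ≡⟨ l (r+ 3) (α i) (G y (vertex c u)) ⟩
        r+ 3 ⊠ (α i ⊠ G y (vertex c u)) ∎)
        where
        open ≡-Reasoning
        l : ∀ x y z → (x ⊠ y) ⊠ z ≡ x ⊠ (y ⊠ z)
        l = solve-∀ ℤi-solver
      pointwise : ∀ xs → map (λ x → G x z) xs ≡ map (α i ⊠_) (map (λ x → G x (vertex c u)) xs)
      pointwise [] = refl
      pointwise (x ∷ xs) = cong₂ _∷_ (at x) (pointwise xs)

  private
    dot-[1] : ∀ u p → dot (r+ 1 ∷ []) (u ∷ p) ≡ u
    dot-[1] u p = l u
      where
      l : ∀ u → (r+ 1 ⊠ u) ⊞ 0ᵢ ≡ u
      l = solve-∀ ℤi-solver

    dot-0∷ : ∀ c u p → dot (0ᵢ ∷ c) (u ∷ p) ≡ dot c p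
    dot-0∷ c u p = l u (dot c p)
      where
      l : ∀ u t → (0ᵢ ⊠ u) ⊞ t ≡ t
      l = solve-∀ ℤi-solver

  pattern∈unitPatterns : ∀ F ω → Realizes (gram F) ω → ∀ z → All (HasUnitValue (map (λ x → G x z) ω)) (elements F) →
                         map (λ x → G x z) ω ∈ unitPatterns F
  pattern∈unitPatterns [] [] _ z _ = here refl
  pattern∈unitPatterns ((q , els) ∷ F) (x ∷ ω) (_ , real) z (newest ∷ values) =
    ∈-filter⁺ _ (∈-cartesianProductWith⁺ _∷_
      (α∈units (s x z) (trans (cong norm (sym (dot-[1] (G x z) p))) newest))
      (pattern∈unitPatterns F ω real z (All.map (λ {c} → trans (cong norm (sym (dot-0∷ c (G x z) p)))) (Allₚ.map⁻ (Allₚ.++⁻ʳ els values)))))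
      (Allₚ.++⁻ˡ els values)
    where p = map (λ x → G x z) ω

  -- Inner products of points have norm 1 or 9. Either all those with the elements have norm 1, and
  -- the pattern survives every filter, or one has norm 9, and z is a multiple of that element.
  pattern∈candidates : ∀ F ω → Realizes (gram F) ω → All (IsUnit (gram F)) (elements F) → ∀ z →
                       map (λ x → G x z) ω ∈ candidates F
  pattern∈candidates F ω real us z with All.all? (hasUnitValue? (map (λ x → G x z) ω)) (elements F)
  ... | yes values = ∈-++⁺ˡ (pattern∈unitPatterns F ω real z values)
  ... | no exceptional with find us (Allₚ.¬All⇒Any¬ (hasUnitValue? _) (elements F) exceptional)
    where
    open import Data.List.Relation.Unary.Any using (Any)
    find : ∀ {P : Row → Set} {cs} → All (IsUnit (gram F)) cs → Any P cs → ∃[ c ] (c ∈ cs × IsUnit (gram F) c × P c)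
    find (u ∷ _) (here px) = _ , here refl , u , px
    find (_ ∷ us) (there any) with find us any
    ... | c , c∈ , rest = c , there c∈ , rest
  ... | c , c∈ , u , not-unit with proportional real c u z (large (norm-G real (vertex real c u) z))
    where
    large : norm (G (vertex real c u) z) ≡ + 1 ⊎ norm (G (vertex real c u) z) ≡ + 9 → norm (G (vertex real c u) z) ≡ + 9
    large (inj₁ eq) = contradiction (trans (cong norm (sym (G-vertexˡ real c u z))) eq) not-unit
    large (inj₂ eq) = eq
  ... | ε , ε∈ , eq = ∈-++⁺ʳ (unitPatterns F) (subst (_∈ multiples (gram F) (elements F)) (sym eq)
    (∈-cartesianProductWith⁺ (λ ε c → map (ε ⊠_) (gram F · c)) ε∈ c∈))

  covered : ∀ {Ms M ω} → Realizes M ω → ∀ ps os → Covers Ms M ps os → ∀ z → map (λ x → G x z) ω ∈ ps →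
            ∃[ M′ ] (M′ ∈ Ms × ∃[ ω′ ] Realizes M′ ω′)
  covered {Ms} {ω = ω} real (p ∷ ps) (o ∷ os) (v , _) z (here eq) = valid {ω = z ∷ ω} (eq , real) Ms o v
  covered real (p ∷ ps) (o ∷ os) (_ , c) z (there p∈) = covered real ps os c z p∈

  -- The intersection number yields a point, whose pattern must occur in the checked list; its
  -- outcome either contradicts the possible inner products or names points that realize a later
  -- Gram matrix.
  advance : ∀ S Ms → Sound S Ms → ∀ ω → Realizes (gram (Stage.frame S)) ω →
            ∃[ M ] (M ∈ Ms × ∃[ ω′ ] Realizes M ω′)
  advance S Ms (sound (us , ua , ub , ab≡l , ue , few) covers) ω real
    with new-point (vertex real a ua) (vertex real b ub) 4F (opposite j) (vertices real exceptions ue)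
           (subst (ℕ._< _) (sym (length-vertices real exceptions ue)) (subst (λ t → length exceptions ℕ.< pᵏ 4F (opposite j) t) (sym sab≡l) few))
    where
    open Stage S
    sab≡l : s (vertex real a ua) (vertex real b ub) ≡ l
    sab≡l = α-injective _ l (trans (G-vertex-vertex real a b ua ub) ab≡l)
  ... | z , az , zb , z∉ = covered real _ outcomes covers z (∈-filter⁺ (admissible? S) (pattern∈candidates frame ω real us z)
      ( trans (sym (G-vertexˡ real a ua z)) (cong α az)
      , trans (sym (G-vertexˡ real b ub z)) (cong α (trans (opposite-relation z (vertex real b ub)) (trans (cong opposite zb) (opposite-involutive j))))
      , avoids real exceptions ue z z∉))
    where
    open Stage S

-- The stages of the search and their verification.

SoundChain : List Stage → Gram → Set
SoundChain [] M = ⊤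
SoundChain (S ∷ Ss) M = Sound S (map (gram ∘ Stage.frame) Ss ++ (M ∷ [])) × SoundChain Ss M

codedFrame : List (ℕ × List ℕ) → Frame
codedFrame = map (λ (q , els) → row q , map row els)

coded : List (ℕ × List ℕ) → ℕ → ℕ → Fin 8 → Fin 8 → List ℕ → List Outcome → Stage
coded F a b l j K o = stage (codedFrame F) (row a) (row b) l j (map row K) o

-- The stages were found by computer search.  In row codes the last digit belongs to the newest vector, and
-- `next i` leads to the i-th of the stages after the current one (finalGram being the last).
stage0 : Stage
stage0 = coded
  ((3 , []) ∷ (0 , []) ∷ [])
  1 10 6F 4F []
  ( next 0 (1 ∷ 10 ∷ 100 ∷ [])
  ∷ [])

stage1 : Stage
stage1 = coded
  ((11 , 113 ∷ []) ∷ (3 , []) ∷ (0 , []) ∷ [])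
  10 100 6F 5F []
  ( next 0 (100 ∷ 2240 ∷ 4000 ∷ 1 ∷ [])
  ∷ next 0 (100 ∷ 20 ∷ 4000 ∷ 1 ∷ [])
  ∷ [])

stage2 : Stage
stage2 = coded
  ((144 , 443 ∷ []) ∷ (13 , []) ∷ (3 , []) ∷ (0 , []) ∷ [])
  10 100 6F 4F (2 ∷ 114 ∷ [])
  ( next 0 (20 ∷ 11003 ∷ 30000 ∷ 100 ∷ 1000 ∷ [])
  ∷ next 0 (400 ∷ 32214 ∷ 10000 ∷ 4430 ∷ 10 ∷ [])
  ∷ next 0 (20 ∷ 10301 ∷ 30000 ∷ 100 ∷ 1000 ∷ [])
  ∷ next 0 (10000 ∷ 400 ∷ 4000 ∷ 2 ∷ 10 ∷ [])
  ∷ [])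

-- The search first branches here, to `stage4` or `stage5`. A `dead` entry names two vectors of norm
-- 3 that cannot both be points, so by `closure` the pattern does not occur.
stage3 : Stage
stage3 = coded
  ((1142 , 11003 ∷ []) ∷ (133 , 1033 ∷ 333 ∷ []) ∷ (13 , []) ∷ (3 , []) ∷ (0 , []) ∷ [])
  1 100 5F 5F []
  ( dead 1000 30013
  ∷ next 1 (10 ∷ 1 ∷ 100 ∷ 1000 ∷ 10000 ∷ 100000 ∷ [])
  ∷ dead 103300 2013
  ∷ next 0 (10 ∷ 1102 ∷ 100 ∷ 1000 ∷ 10000 ∷ 100000 ∷ [])
  ∷ next 1 (10 ∷ 2013 ∷ 100 ∷ 1000 ∷ 10000 ∷ 100000 ∷ [])
  ∷ dead 1000 300013
  ∷ dead 33300 2013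
  ∷ next 0 (10 ∷ 124 ∷ 100 ∷ 1000 ∷ 10000 ∷ 100000 ∷ [])
  ∷ dead 10 200403
  ∷ dead 1000 300013
  ∷ dead 10 402003
  ∷ dead 10 22003
  ∷ dead 10 402003
  ∷ dead 1000 30013
  ∷ dead 10 40403
  ∷ dead 10 200403
  ∷ [])

stage4 : Stage
stage4 = coded
  ((11424 , 110003 ∷ 243 ∷ 330421 ∷ []) ∷ (1311 , []) ∷ (133 , 1033 ∷ []) ∷ (13 , []) ∷ (3 , []) ∷ (0 , []) ∷ [])
  1000 100000 4F 6F (300 ∷ 301100 ∷ [])
  ( dead 10 3010003
  ∷ dead 10 3010003
  ∷ next 3 (4210 ∷ 10 ∷ 110003 ∷ 3103 ∷ 111000 ∷ 30000 ∷ 1000000 ∷ [])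
  ∷ dead 2430 3010003
  ∷ dead 2430 3010003
  ∷ dead 2430 3010003
  ∷ dead 2430 110003
  ∷ next 2 (2181302 ∷ 1030001 ∷ 400 ∷ 3300010 ∷ 1102430 ∷ 20000 ∷ 10 ∷ [])
  ∷ dead 1100030 3010003
  ∷ next 2 (111304 ∷ 3 ∷ 400 ∷ 3300010 ∷ 1102430 ∷ 20000 ∷ 10 ∷ [])
  ∷ dead 1100030 3010003
  ∷ dead 1100030 3010003
  ∷ next 3 (4210 ∷ 10 ∷ 10303 ∷ 303003 ∷ 111000 ∷ 30000 ∷ 1000000 ∷ [])
  ∷ dead 1100030 3011303
  ∷ dead 10 3010003
  ∷ dead 10 3010003
  ∷ [])

stage5 : Stage
stage5 = coded
  ((11421 , 110003 ∷ 442135 ∷ []) ∷ (1421 , []) ∷ (133 , 1033 ∷ []) ∷ (13 , []) ∷ (3 , []) ∷ (0 , []) ∷ [])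
  1000 100000 4F 6F (300 ∷ 301100 ∷ [])
  ( dead 10 3010003
  ∷ dead 100 3010003
  ∷ dead 100 3010003
  ∷ dead 1100030 111303
  ∷ next 0 (10 ∷ 8062724 ∷ 10240 ∷ 10000 ∷ 1000 ∷ 100000 ∷ 1000000 ∷ [])
  ∷ dead 40130 110003
  ∷ next 0 (10 ∷ 603544 ∷ 1102430 ∷ 10000 ∷ 1000 ∷ 100000 ∷ 1000000 ∷ [])
  ∷ dead 1100030 3010003
  ∷ next 0 (10 ∷ 2643542 ∷ 1102430 ∷ 10000 ∷ 1000 ∷ 100000 ∷ 1000000 ∷ [])
  ∷ next 0 (10 ∷ 1032722 ∷ 10240 ∷ 10000 ∷ 1000 ∷ 100000 ∷ 1000000 ∷ [])
  ∷ [])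

stage6 : Stage
stage6 = coded
  ((112421 , 1100003 ∷ 3002411 ∷ 2370441 ∷ 2232408 ∷ []) ∷ (12242 , 22003 ∷ []) ∷ (1421 , []) ∷ (133 , 1033 ∷ []) ∷ (13 , []) ∷ (3 , []) ∷ (0 , []) ∷ [])
  10000 1000000 4F 6F (3000 ∷ 3011000 ∷ [])
  ( next 3 (1 ∷ 10 ∷ 100 ∷ 1000 ∷ 10000 ∷ 100000 ∷ 1000000 ∷ 10000000 ∷ [])
  ∷ next 3 (70105220 ∷ 11000030 ∷ 43035024 ∷ 24010 ∷ 100000 ∷ 10000 ∷ 1000000 ∷ 10000000 ∷ [])
  ∷ next 3 (70105220 ∷ 11000030 ∷ 3435022 ∷ 24010 ∷ 100000 ∷ 10000 ∷ 1000000 ∷ 10000000 ∷ [])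
  ∷ next 3 (30100003 ∷ 10 ∷ 100 ∷ 1000 ∷ 10000 ∷ 100000 ∷ 1000000 ∷ 10000000 ∷ [])
  ∷ [])

stage7 : Stage
stage7 = coded
  ((131442 , 423 ∷ 111034 ∷ 3001241 ∷ 4336012 ∷ 1047026 ∷ []) ∷ (12141 , []) ∷ (1311 , []) ∷ (133 , 1033 ∷ 333 ∷ []) ∷ (13 , []) ∷ (3 , []) ∷ (0 , []) ∷ [])
  100000 1000000 6F 4F (1033000 ∷ 111000 ∷ [])
  ( dead 10 1001003
  ∷ next 1 (513442 ∷ 100 ∷ 113402 ∷ 113000 ∷ 3000000 ∷ 1110000 ∷ 300000 ∷ 10000000 ∷ [])
  ∷ dead 100 11000003
  ∷ dead 100 11000003
  ∷ dead 100 11000003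
  ∷ dead 100 11000003
  ∷ dead 100 11000003
  ∷ dead 100 11000003
  ∷ dead 100 11000003
  ∷ dead 100 11000003
  ∷ dead 4230 1010003
  ∷ dead 11000003 30012410
  ∷ dead 1010003 1110340
  ∷ next 1 (80033222 ∷ 11140306 ∷ 400201 ∷ 113000 ∷ 3000000 ∷ 1110000 ∷ 300000 ∷ 10000000 ∷ [])
  ∷ dead 4230 11000003
  ∷ dead 11000003 1110340
  ∷ dead 4230 11000003
  ∷ dead 4230 11000003
  ∷ dead 4230 1010003
  ∷ next 1 (80330222 ∷ 11445306 ∷ 4201 ∷ 113000 ∷ 3000000 ∷ 1110000 ∷ 300000 ∷ 10000000 ∷ [])
  ∷ dead 10 10003003
  ∷ dead 4230 11000003
  ∷ dead 4230 11000003
  ∷ dead 4230 11000003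
  ∷ dead 10 1010003
  ∷ next 1 (210442 ∷ 100 ∷ 10402 ∷ 113000 ∷ 3000000 ∷ 1110000 ∷ 300000 ∷ 10000000 ∷ [])
  ∷ dead 10 1010003
  ∷ dead 4230 11000003
  ∷ [])

-- This Gram matrix does not occur: the intersection number is 16, yet no candidate is admissible,
-- so the list of outcomes is empty.
stage8 : Stage
stage8 = coded
  ((141211 , 400013 ∷ 2013 ∷ 3011042 ∷ 33124 ∷ 2204031 ∷ 204231 ∷ 2244231 ∷ 3019342 ∷ []) ∷ (12141 , []) ∷ (1311 , 113 ∷ []) ∷ (133 , 1033 ∷ 333 ∷ []) ∷ (13 , []) ∷ (3 , []) ∷ (0 , []) ∷ [])
  4402453 1 5F 6F []
  []

stage9 : Stage
stage9 = coded
  ((1424111 , 331013 ∷ 2023021 ∷ 18771207 ∷ 730524 ∷ 201486 ∷ 84330523 ∷ []) ∷ (131442 , 1047026 ∷ []) ∷ (12141 , []) ∷ (1311 , []) ∷ (133 , 1033 ∷ 333 ∷ []) ∷ (13 , []) ∷ (3 , []) ∷ (0 , []) ∷ [])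
  1000000 10000000 6F 4F (10330000 ∷ 1110000 ∷ [])
  ( next 0 (12010833 ∷ 1 ∷ 123302204 ∷ 1130310 ∷ 100000 ∷ 1000000 ∷ 10000000 ∷ 100000000 ∷ [])
  ∷ next 0 (21030613 ∷ 112040003 ∷ 222104404 ∷ 440020135 ∷ 100000 ∷ 1000000 ∷ 10000000 ∷ 100000000 ∷ [])
  ∷ next 0 (14456042 ∷ 110000003 ∷ 803302202 ∷ 1130310 ∷ 100000 ∷ 1000000 ∷ 10000000 ∷ 100000000 ∷ [])
  ∷ next 0 (361030611 ∷ 2040001 ∷ 2104402 ∷ 110020137 ∷ 100000 ∷ 1000000 ∷ 10000000 ∷ 100000000 ∷ [])
  ∷ [])

finalGram : Gram
finalGram = map row (3213343 ∷ 112421 ∷ 12242 ∷ 1421 ∷ 133 ∷ 13 ∷ 3 ∷ 0 ∷ [])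

opaque
  -- Each stage is verified by evaluating its decision procedure; opacity keeps the result from
  -- being unfolded later.
  sound0 : Sound stage0 (map (gram ∘ Stage.frame) (stage1 ∷ stage2 ∷ stage3 ∷ stage4 ∷ stage5 ∷ stage6 ∷ stage7 ∷ stage8 ∷ stage9 ∷ []) ++ (finalGram ∷ []))
  sound0 = from-yes (sound? stage0 (map (gram ∘ Stage.frame) (stage1 ∷ stage2 ∷ stage3 ∷ stage4 ∷ stage5 ∷ stage6 ∷ stage7 ∷ stage8 ∷ stage9 ∷ []) ++ (finalGram ∷ [])))

opaque
  sound1 : Sound stage1 (map (gram ∘ Stage.frame) (stage2 ∷ stage3 ∷ stage4 ∷ stage5 ∷ stage6 ∷ stage7 ∷ stage8 ∷ stage9 ∷ []) ++ (finalGram ∷ []))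
  sound1 = from-yes (sound? stage1 (map (gram ∘ Stage.frame) (stage2 ∷ stage3 ∷ stage4 ∷ stage5 ∷ stage6 ∷ stage7 ∷ stage8 ∷ stage9 ∷ []) ++ (finalGram ∷ [])))

opaque
  sound2 : Sound stage2 (map (gram ∘ Stage.frame) (stage3 ∷ stage4 ∷ stage5 ∷ stage6 ∷ stage7 ∷ stage8 ∷ stage9 ∷ []) ++ (finalGram ∷ []))
  sound2 = from-yes (sound? stage2 (map (gram ∘ Stage.frame) (stage3 ∷ stage4 ∷ stage5 ∷ stage6 ∷ stage7 ∷ stage8 ∷ stage9 ∷ []) ++ (finalGram ∷ [])))

opaque
  sound3 : Sound stage3 (map (gram ∘ Stage.frame) (stage4 ∷ stage5 ∷ stage6 ∷ stage7 ∷ stage8 ∷ stage9 ∷ []) ++ (finalGram ∷ []))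
  sound3 = from-yes (sound? stage3 (map (gram ∘ Stage.frame) (stage4 ∷ stage5 ∷ stage6 ∷ stage7 ∷ stage8 ∷ stage9 ∷ []) ++ (finalGram ∷ [])))

opaque
  sound4 : Sound stage4 (map (gram ∘ Stage.frame) (stage5 ∷ stage6 ∷ stage7 ∷ stage8 ∷ stage9 ∷ []) ++ (finalGram ∷ []))
  sound4 = from-yes (sound? stage4 (map (gram ∘ Stage.frame) (stage5 ∷ stage6 ∷ stage7 ∷ stage8 ∷ stage9 ∷ []) ++ (finalGram ∷ [])))

opaque
  sound5 : Sound stage5 (map (gram ∘ Stage.frame) (stage6 ∷ stage7 ∷ stage8 ∷ stage9 ∷ []) ++ (finalGram ∷ []))
  sound5 = from-yes (sound? stage5 (map (gram ∘ Stage.frame) (stage6 ∷ stage7 ∷ stage8 ∷ stage9 ∷ []) ++ (finalGram ∷ [])))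

opaque
  sound6 : Sound stage6 (map (gram ∘ Stage.frame) (stage7 ∷ stage8 ∷ stage9 ∷ []) ++ (finalGram ∷ []))
  sound6 = from-yes (sound? stage6 (map (gram ∘ Stage.frame) (stage7 ∷ stage8 ∷ stage9 ∷ []) ++ (finalGram ∷ [])))

opaque
  sound7 : Sound stage7 (map (gram ∘ Stage.frame) (stage8 ∷ stage9 ∷ []) ++ (finalGram ∷ []))
  sound7 = from-yes (sound? stage7 (map (gram ∘ Stage.frame) (stage8 ∷ stage9 ∷ []) ++ (finalGram ∷ [])))

opaque
  sound8 : Sound stage8 (map (gram ∘ Stage.frame) (stage9 ∷ []) ++ (finalGram ∷ []))
  sound8 = from-yes (sound? stage8 (map (gram ∘ Stage.frame) (stage9 ∷ []) ++ (finalGram ∷ [])))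

opaque
  sound9 : Sound stage9 (map (gram ∘ Stage.frame) ([]) ++ (finalGram ∷ []))
  sound9 = from-yes (sound? stage9 (map (gram ∘ Stage.frame) ([]) ++ (finalGram ∷ [])))

stages : List Stage
stages = stage0 ∷ stage1 ∷ stage2 ∷ stage3 ∷ stage4 ∷ stage5 ∷ stage6 ∷ stage7 ∷ stage8 ∷ stage9 ∷ []

stages-sound : SoundChain stages finalGram
stages-sound = sound0 , sound1 , sound2 , sound3 , sound4 , sound5 , sound6 , sound7 , sound8 , sound9 , _

-- Coordinates of Ω in a basis of its lattice

-- Eight vectors of Ω that generate its lattice, with Gram matrix 2 · finalGram.
basis : List ΩIdx
basis = map index
  ( (2 , (false , false , true ) , (false , true  , false))
  ∷ (3 , (true  , false , false) , (true  , false , false))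
  ∷ (2 , (true  , false , true ) , (true  , false , true ))
  ∷ (1 , (true  , true  , true ) , (false , false , true ))
  ∷ (0 , (false , false , false) , (true  , true  , false))
  ∷ (2 , (false , false , false) , (true  , false , false))
  ∷ (2 , (false , false , false) , (false , false , true ))
  ∷ (0 , (false , false , false) , (false , false , false))
  ∷ [])
  where
  index : ℕ × Line → ΩIdx
  index (0 , l) = 0F , l
  index (1 , l) = 1F , l
  index (2 , l) = 2F , l
  index (_ , l) = 3F , l

-- 4 B⁻¹ for the matrix B with columns the basis; an entry a + b i is coded by the digits a + 5 and b + 5,
-- and the coordinates of ℂ⁸ run from right to left.
inverse : List Row
inverse = map (entries 8)
  ( 7555466635756644 ∷ 5755466635976644 ∷ 5755466653756644 ∷ 7755577537737535
  ∷ 4464553564465555 ∷ 6464755366425337 ∷ 5355644455336446 ∷ 5355535555355575 ∷ [])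
  where
  entries : ℕ → ℕ → Row
  entries zero _ = []
  entries (suc k) m = ((+ (m / 10 % 10) ℤ.- + 5) +i (+ (m % 10) ℤ.- + 5)) ∷ entries k (m / 100)

bilinear : Row → Row → ℤi
bilinear (c ∷ cs) (p ∷ ps) = (c ⊠ p) ⊞ bilinear cs ps
bilinear _ _ = 0ᵢ

coefficients : ΩIdx → Row
coefficients a = map (λ c → quarter (bilinear c (map (ωVec a) pts))) inverse
  where
  -- The floor division is harmless: `coefficients-correct` checks that the resulting coordinates
  -- are the right ones.
  quarter : ℤi → ℤi
  quarter (x +i y) = (x /ℕ 4) +i (y /ℕ 4)

combination : Row → List ΩIdx → P3 → ℤi
combination (c ∷ cs) (h ∷ hs) x = (c ⊠ ωVec h x) ⊞ combination cs hs x
combination _ _ x = 0ᵢ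

allBool? : {P : Bool → Set} → (∀ b → Dec (P b)) → Dec (∀ b → P b)
allBool? P? = map′ (λ { (f , t) false → f ; (f , t) true → t }) (λ h → h false , h true) (P? false ×-dec P? true)

allP3? : {P : P3 → Set} → (∀ x → Dec (P x)) → Dec (∀ x → P x)
allP3? P? = map′ (λ { h (a , b , c) → h a b c }) (λ h a b c → h (a , b , c))
  (allBool? λ a → allBool? λ b → allBool? λ c → P? (a , b , c))

allΩ? : {P : ΩIdx → Set} → (∀ a → Dec (P a)) → Dec (∀ a → P a)
allΩ? P? = map′ (λ { h (k , a , b) → h k a b }) (λ h k a b → h (k , a , b))
  (all? λ k → allP3? λ a → allP3? λ b → P? (k , a , b))

_≟Ω_ : DecidableEquality ΩIdx
_≟Ω_ = ×-≡-dec _≟_ (×-≡-dec _≟₃_ _≟₃_)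
  where
  _≟₃_ : DecidableEquality P3
  _≟₃_ = ×-≡-dec Boolₚ._≟_ (×-≡-dec Boolₚ._≟_ Boolₚ._≟_)

opaque
  -- This is the hypothesis of `closure`: wherever `finalGram` is realized, the coordinates of each
  -- vector of Ω give a point.
  coefficients-unit : ∀ a → IsUnit finalGram (coefficients a)
  coefficients-unit = from-yes (allΩ? λ a → isUnit? finalGram (coefficients a))

opaque
  coefficients-correct : ∀ a x → combination (coefficients a) basis x ≡ ωVec a x
  coefficients-correct = from-yes (allΩ? λ a → allP3? λ x → combination (coefficients a) basis x ≟ᵢ ωVec a x)

opaque
  -- Checking eight products per vector is enough: by linearity they determine the products of all
  -- pairs in `inner-gram`. The factor 2 passes from norm 3 to the norm 6 of the stored vectors.
  basis-products : ∀ a → map (λ h → inner (ωVec h) (ωVec a)) basis ≡ map (r+ 2 ⊠_) (finalGram · coefficients a)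
  basis-products = from-yes (allΩ? λ a → map (λ h → inner (ωVec h) (ωVec a)) basis ≟ᵣ map (r+ 2 ⊠_) (finalGram · coefficients a))

opaque
  ωVec-injective : ∀ a b → All (λ x → ωVec a x ≡ ωVec b x) pts → a ≡ b
  ωVec-injective = from-yes (allΩ? λ a → allΩ? λ b → All.all? (λ x → ωVec a x ≟ᵢ ωVec b x) pts →-dec (a ≟Ω b))

-- Identification with Hoggar's scheme

-- `inner` is the case `pts`; a variable list of coordinates permits induction.
innerOn : List P3 → (P3 → ℤi) → (P3 → ℤi) → ℤi
innerOn xs u w = foldr (λ x s → (conj (u x) ⊠ w x) ⊞ s) 0ᵢ xs

innerOn-cong : ∀ xs {u v w} → (∀ x → u x ≡ v x) → innerOn xs u w ≡ innerOn xs v w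
innerOn-cong [] eq = refl
innerOn-cong (x ∷ xs) {w = w} eq = cong₂ (λ t s → (conj t ⊠ w x) ⊞ s) (eq x) (innerOn-cong xs eq)

innerOn-combination : ∀ xs cs hs w →
  innerOn xs (combination cs hs) w ≡ dot cs (map (λ h → innerOn xs (ωVec h) w) hs)
innerOn-combination xs [] hs w = innerOn-zero xs
  where
  innerOn-zero : ∀ xs → innerOn xs (λ _ → 0ᵢ) w ≡ 0ᵢ
  innerOn-zero [] = refl
  innerOn-zero (x ∷ xs) = trans (cong ((0ᵢ ⊠ w x) ⊞_) (innerOn-zero xs)) (l (w x))
    where
    l : ∀ y → (0ᵢ ⊠ y) ⊞ 0ᵢ ≡ 0ᵢ
    l = solve-∀ ℤi-solver
innerOn-combination xs (c ∷ cs) [] w = innerOn-combination xs [] [] w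
innerOn-combination xs (c ∷ cs) (h ∷ hs) w = trans (linear xs) (cong ((conj c ⊠ innerOn xs (ωVec h) w) ⊞_) (innerOn-combination xs cs hs w))
  where
  l : ∀ c u v y a b → (((c ⊠ u) ⊞ v) ⊠ y) ⊞ ((c ⊠ a) ⊞ b) ≡ (c ⊠ ((u ⊠ y) ⊞ a)) ⊞ ((v ⊠ y) ⊞ b)
  l = solve-∀ ℤi-solver
  z : ∀ c → 0ᵢ ≡ (c ⊠ 0ᵢ) ⊞ 0ᵢ
  z = solve-∀ ℤi-solver
  linear : ∀ xs → innerOn xs (combination (c ∷ cs) (h ∷ hs)) w
                ≡ (conj c ⊠ innerOn xs (ωVec h) w) ⊞ innerOn xs (combination cs hs) w
  linear [] = z (conj c)
  linear (x ∷ xs) = trans (cong₂ (λ t s → (t ⊠ w x) ⊞ s)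
      (trans (conj-⊞ (c ⊠ ωVec h x) (combination cs hs x)) (cong (_⊞ conj (combination cs hs x)) (conj-⊠ c (ωVec h x))))
      (linear xs))
    (l (conj c) (conj (ωVec h x)) (conj (combination cs hs x)) (w x) (innerOn xs (ωVec h) w) (innerOn xs (combination cs hs) w))

dot-scale : ∀ k c q → dot c (map (k ⊠_) q) ≡ k ⊠ dot c q
dot-scale k [] q = sym (⊠-zeroʳ k)
dot-scale k (c ∷ cs) [] = sym (⊠-zeroʳ k)
dot-scale k (c ∷ cs) (p ∷ q) = trans (cong ((conj c ⊠ (k ⊠ p)) ⊞_) (dot-scale k cs q)) (l k (conj c) p (dot cs q))
  where
  l : ∀ k c p d → (c ⊠ (k ⊠ p)) ⊞ (k ⊠ d) ≡ k ⊠ ((c ⊠ p) ⊞ d)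
  l = solve-∀ ℤi-solver

inner-basis : ∀ a w → inner (ωVec a) w ≡ dot (coefficients a) (map (λ h → inner (ωVec h) w) basis)
inner-basis a w = trans (innerOn-cong pts {w = w} (λ x → sym (coefficients-correct a x)))
  (innerOn-combination pts (coefficients a) basis w)

inner-gram : ∀ a b → inner (ωVec a) (ωVec b) ≡ r+ 2 ⊠ dot (coefficients a) (finalGram · coefficients b)
inner-gram a b = trans (inner-basis a (ωVec b)) (trans (cong (dot (coefficients a)) (basis-products b))
  (dot-scale (r+ 2) (coefficients a) (finalGram · coefficients b)))

-- The two hypotheses make the squared norm of u - v vanish, and it is a sum of nonnegative terms
-- over the coordinates.
distance-zero : ∀ xs u v → innerOn xs u u ≡ innerOn xs u v → innerOn xs v u ≡ innerOn xs v v →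
                All (λ x → u x ≡ v x) xs
distance-zero xs u v uu≡uv vu≡vv = zeros xs (trans (expand xs) (trans
    (cong₂ (λ s t → (s ⊞ neg (innerOn xs u v)) ⊞ (innerOn xs v v ⊞ neg t)) uu≡uv vu≡vv)
    (l (innerOn xs u v) (innerOn xs v v))))
  where
  l : ∀ a b → (a ⊞ neg a) ⊞ (b ⊞ neg b) ≡ 0ᵢ
  l = solve-∀ ℤi-solver
  d : P3 → ℤi
  d x = u x ⊞ (r- 1 ⊠ v x)
  expand : ∀ xs → innerOn xs d d ≡ (innerOn xs u u ⊞ neg (innerOn xs u v)) ⊞ (innerOn xs v v ⊞ neg (innerOn xs v u))
  expand [] = refl
  expand (x ∷ xs) = trans (cong₂ (λ t s → (t ⊠ d x) ⊞ s)
      (trans (conj-⊞ (u x) (r- 1 ⊠ v x)) (cong (conj (u x) ⊞_) (conj-⊠ (r- 1) (v x)))) (expand xs))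
    (e (u x) (v x) (conj (u x)) (conj (v x)) (innerOn xs u u) (innerOn xs u v) (innerOn xs v v) (innerOn xs v u))
    where
    e : ∀ u v ū v̄ a b c t → ((ū ⊞ (r- 1 ⊠ v̄)) ⊠ (u ⊞ (r- 1 ⊠ v))) ⊞ ((a ⊞ neg b) ⊞ (c ⊞ neg t))
      ≡ (((ū ⊠ u) ⊞ a) ⊞ neg ((ū ⊠ v) ⊞ b)) ⊞ (((v̄ ⊠ v) ⊞ c) ⊞ neg ((v̄ ⊠ u) ⊞ t))
    e = solve-∀ ℤi-solver
  nonneg : ∀ xs → 0ℤ ℤ.≤ re (innerOn xs d d)
  nonneg [] = ℤ.+≤+ ℕ.z≤n
  nonneg (x ∷ xs) = ℤₚ.+-mono-≤ (re-norm-nonneg (d x)) (nonneg xs)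
  zeros : ∀ xs → innerOn xs d d ≡ 0ᵢ → All (λ x → u x ≡ v x) xs
  zeros xs eq = go xs (cong re eq)
    where
    cancel : ∀ a b → a ≡ (a ⊞ (r- 1 ⊠ b)) ⊞ b
    cancel = solve-∀ ℤi-solver
    go : ∀ xs → re (innerOn xs d d) ≡ 0ℤ → All (λ x → u x ≡ v x) xs
    go [] _ = []
    go (x ∷ xs) eq = trans (cancel (u x) (v x)) (trans (cong (_⊞ v x) dx≡0) (⊞-identityˡ (v x)))
      ∷ go xs (summand-zeroʳ (re-norm-nonneg (d x)) (nonneg xs) (ℤₚ.≤-reflexive eq))
      where
      dx≡0 : d x ≡ 0ᵢ
      dx≡0 = norm-zero (d x) (trans (sym (cong re (conj-⊠-self (d x))))
        (summand-zeroˡ (re-norm-nonneg (d x)) (nonneg xs) (ℤₚ.≤-reflexive eq)))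

opaque
  unfolding FiniteSum.∑

  ∑-ones : ∀ n → ∑ {n} (λ _ → 1ᵢ) ≡ r+ n
  ∑-ones zero = refl
  ∑-ones (suc n) = cong (1ᵢ ⊞_) (∑-ones n)

opaque
  Fin↔ΩIdx : Fin 256 ↔ ΩIdx
  Fin↔ΩIdx = (↔-id (Fin 4) ×-↔ ((P3↔ ×-↔ P3↔) ↔-∘ *↔× {8} {8})) ↔-∘ *↔× {4} {64}
    where
    P3↔ : Fin 8 ↔ P3
    P3↔ = (2↔Bool ×-↔ ((2↔Bool ×-↔ 2↔Bool) ↔-∘ *↔× {2} {2})) ↔-∘ *↔× {2} {4}

-- A missed value y put in front of the values of f would give an injection from n + 1 elements into
-- n.
injective⇒surjective : ∀ {n} (f : Fin n → Fin n) → (∀ i j → f i ≡ f j → i ≡ j) → ∀ y → ∃[ i ] f i ≡ y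
injective⇒surjective {n} f inj y with any? (λ i → f i ≟ y)
... | yes found = found
... | no none with pigeonhole (ℕₚ.n<1+n n) g
  where
  g : Fin (suc n) → Fin n
  g zero = y
  g (suc i) = f i
... | zero , suc j , _ , eq = contradiction (j , sym eq) none
... | suc i , suc j , i<j , eq = contradiction (cong toℕ (inj i j eq)) (ℕₚ.<⇒≢ (ℕ.s<s⁻¹ i<j))

α6-α : ∀ j → α6 j ≡ r+ 2 ⊠ α j
α6-α 0F = refl
α6-α 1F = refl
α6-α 2F = refl
α6-α 3F = refl
α6-α 4F = refl
α6-α 5F = refl
α6-α 6F = refl
α6-α 7F = refl

opaque
  α6-injective : ∀ i j → α6 i ≡ α6 j → i ≡ j
  α6-injective = from-yes (all? λ i → all? λ j → (α6 i ≟ᵢ α6 j) →-dec (i ≟ j))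

module Identification {n : ℕ} (C : Configuration n) where
  open Configuration C
  open Realization C

  opaque
    -- A stage leads only to later entries of the chain, so the branching search is a recursion on
    -- the list of stages and ends at its last Gram matrix.
    descend : ∀ Ss M → SoundChain Ss M → ∀ M′ → M′ ∈ map (gram ∘ Stage.frame) Ss ++ (M ∷ []) →
              ∀ ω → Realizes M′ ω → ∃[ ω′ ] Realizes M ω′
    descend [] M _ M′ (here refl) ω real = ω , real
    descend (S ∷ Ss) M (ok , chain) M′ (here refl) ω real =
      let M″ , M″∈ , ω′ , real′ = advance S _ ok ω real
      in descend Ss M chain M″ M″∈ ω′ real′
    descend (S ∷ Ss) M (_ , chain) M′ (there M′∈) ω real = descend Ss M chain M′ M′∈ ω real

  module _ (ω : List (Fin n)) (real : Realizes finalGram ω) where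

    opaque
      embed : ΩIdx → Fin n
      embed a = vertex real (coefficients a) (coefficients-unit a)

      inner-embed : ∀ a b → inner (ωVec a) (ωVec b) ≡ r+ 2 ⊠ G (embed a) (embed b)
      inner-embed a b = trans (inner-gram a b) (cong (r+ 2 ⊠_)
        (sym (G-vertex-vertex real (coefficients a) (coefficients b) (coefficients-unit a) (coefficients-unit b))))

    -- If the points agree, the two vectors have equal inner products with all of Ω, in particular
    -- with each other and themselves, so their distance is zero.
    embed-injective : ∀ a b → embed a ≡ embed b → a ≡ b
    embed-injective a b eq = ωVec-injective a b (distance-zero pts (ωVec a) (ωVec b) (same a) (same b))
      where
      same : ∀ y → inner (ωVec y) (ωVec a) ≡ inner (ωVec y) (ωVec b)
      same y = trans (inner-embed y a) (trans (cong (λ v → r+ 2 ⊠ G (embed y) v) eq) (sym (inner-embed y b)))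

    -- The all-ones matrix squares to 256 times itself, and its square also counts the points.
    -- Surjectivity of `embed` then follows from injectivity.
    size : n ≡ 256
    size = ℤₚ.+-injective (cong re (trans (sym (∑-ones n)) ∑-one))

    embed-surjective : ∀ v → ∃[ a ] embed a ≡ v
    embed-surjective v = go size
      where
      open Inverse Fin↔ΩIdx
      go : n ≡ 256 → ∃[ a ] embed a ≡ v
      go n≡256 =
        let i , eq = injective⇒surjective (λ i → embed (to (subst Fin n≡256 i)))
                       (λ i j e → subst-injective n≡256 (to-injective (embed-injective (to (subst Fin n≡256 i)) (to (subst Fin n≡256 j)) e))) v
        in to (subst Fin n≡256 i) , eq
        where
        subst-injective : ∀ {m k} (e : m ≡ k) {i j : Fin m} → subst Fin e i ≡ subst Fin e j → i ≡ j
        subst-injective refl eq = eq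
        to-injective : ∀ {i j} → to i ≡ to j → i ≡ j
        to-injective {i} {j} e = trans (sym (strictlyInverseʳ i)) (trans (cong from e) (strictlyInverseʳ j))

    Fin↔Ω : Fin n ↔ ΩIdx
    Fin↔Ω = mk↔ₛ′ (λ v → proj₁ (embed-surjective v)) embed
      (λ a → embed-injective _ a (proj₂ (embed-surjective (embed a))))
      (λ v → proj₂ (embed-surjective v))

    inner-Fin↔Ω : ∀ x y → inner (ωVec (Inverse.to Fin↔Ω x)) (ωVec (Inverse.to Fin↔Ω y)) ≡ α6 (s x y)
    inner-Fin↔Ω x y = trans (inner-embed _ _) (trans
      (cong₂ (λ a b → r+ 2 ⊠ G a b) (proj₂ (embed-surjective x)) (proj₂ (embed-surjective y))) (sym (α6-α (s x y))))

-- The configuration attached to a scheme, and the isomorphism.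

theorem6p1 : (n : ℕ) (r : Fin n → Fin n → Fin 8)
    → IsAssociationScheme n r
    → IsCommutative n r
    → HasFirstEigenmatrix n r Pmat
    → IsoToHoggar n r
theorem6p1 n r scheme _ (σ , E , prim , spectral) = Fin↔Ω ω real , σ , λ x y j → mk⇔
    (λ rxy≡ → trans (inner-Fin↔Ω ω real x y) (cong α6 (trans (cong (σ ⟨$⟩ˡ_) rxy≡) (inverseˡ σ))))
    (λ related → trans (sym (inverseʳ σ)) (cong (σ ⟨$⟩ʳ_) (α6-injective (s x y) j (trans (sym (inner-Fin↔Ω ω real x y)) related))))
  where
  open IsAssociationScheme scheme
  open Scheme n r Pmat σ E prim spectral using (s; convolution)

  -- Two points with inner product -1 in the scaling of `α` start the search; the first also serves
  -- as `origin`.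
  edge : ∃[ x ] ∃[ y ] r x y ≡ σ ⟨$⟩ʳ 6F
  edge = nonempty (σ ⟨$⟩ʳ 6F)

  x₀ y₀ : Fin n
  x₀ = proj₁ edge
  y₀ = proj₁ (proj₂ edge)

  r-refl : ∀ x → r x x ≡ 0F
  r-refl x = Equivalence.from (diagonal x x) refl

  -- The ordering `σ` is not assumed to put the diagonal relation in column 0; d is the column it
  -- occupies.
  d : Fin 8
  d = σ ⟨$⟩ˡ 0F

  s-refl : ∀ x → s x x ≡ d
  s-refl x = cong (σ ⟨$⟩ˡ_) (r-refl x)

  s-discrete : ∀ {x y} → s x y ≡ d → x ≡ y
  s-discrete {x} {y} eq = Equivalence.to (diagonal x y) (trans (sym (inverseʳ σ)) (trans (cong (σ ⟨$⟩ʳ_) eq) (inverseʳ σ)))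

  [d]-diagonal : [ d ] (s x₀ x₀) ≡ 1ᵢ
  [d]-diagonal with d ≟ s x₀ x₀
  ... | yes _ = refl
  ... | no ne = contradiction (sym (s-refl x₀)) ne

  [d]-off : ∀ z → ¬ (x₀ ≡ z) → [ d ] (s x₀ z) ⊠ [ d ] (s z x₀) ≡ 0ᵢ
  [d]-off z ne with d ≟ s x₀ z
  ... | yes eq = contradiction (s-discrete (sym eq)) ne
  ... | no _ = trans (⊠-comm 0ᵢ ([ d ] (s z x₀))) (⊠-zeroʳ ([ d ] (s z x₀)))

  -- For the diagonal relation, the only z with both (x₀, z) and (z, x₀) in it is x₀ itself, so the
  -- intersection number of d, d at d is 1; in the table this happens only at index 0.
  d≡0 : d ≡ 0F
  d≡0 = diagonal-relation d (trans (sym (trans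
    (convolution [ d ] [ d ] (intersectionNumber d d) (convolves-indicator d d) x₀ x₀)
    (cong (intersectionNumber d d) (s-refl x₀))))
    (trans (∑-single x₀ {λ z → [ d ] (s x₀ z) ⊠ [ d ] (s z x₀)} [d]-off) (cong₂ _⊠_ [d]-diagonal [d]-diagonal)))

  configuration : Configuration n
  configuration = record
    { s = s
    ; origin = x₀
    ; diagonal = λ x → trans (s-refl x) d≡0
    ; discrete = λ eq → s-discrete (trans eq (sym d≡0))
    ; convolution = convolution }

  open Identification configuration
  open Realization configuration using (Realizes)

  start : Realizes (gram (Stage.frame stage0)) (y₀ ∷ x₀ ∷ [])
  start = cong (λ j → α j ∷ []) (trans (cong (σ ⟨$⟩ˡ_) (proj₂ (proj₂ edge))) (inverseˡ σ)) , refl , tt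

  realized : ∃[ ω ] Realizes finalGram ω
  realized = descend stages finalGram stages-sound _ (here refl) (y₀ ∷ x₀ ∷ []) start

  ω : List (Fin n)
  ω = proj₁ realized

  real : Realizes finalGram ω
  real = proj₂ realized
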